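{- Let $n\ge 2$. The set $$\{\boldsymbol{u}^i\boldsymbol{u}^j : 1\le i,j\le n-1,\ i\neq j\}\ \cup\ \{\overline{\boldsymbol{x}}^i\}_{i=1}^{k-1}\ \cup\ \{\overline{\boldsymbol{y}}^i\}_{i=1}^{k'-1}$$ is an orthogonal basis of $\overline{V}_n$.
   Context: $\overline{V}_n$ is the space of real $n\times n$ matrices $(x_{ab})_{1\le a,b\le n}$ all of whose row sums and column sums are zero and which satisfy $\sum_{a} x_{a,a}=0=\sum_a x_{a,n-a+1}$; matrices carry the entrywise (Frobenius) dot product. For $\boldsymbol{a},\boldsymbol{b}\in\mathbb{R}^n$, $\boldsymbol{a}\boldsymbol{b}$ denotes the outer product (the $n\times n$ matrix with $(p,q)$ entry $a_pb_q$). Definition of $\boldsymbol{w}(r)$ for integers $r\geq 2$: $\boldsymbol{w}(r)=(w(r)_0,\dots,w(r)_{r-1})$, where: if $r$ is odd, $w(r)_i=(r-1)/2$ for $i$ even and $-(r+1)/2$ for $i$ odd; $\boldsymbol{w}(2)=(1,-1)$; $\boldsymbol{w}(4)=(1,-1,-1,1)$; if $r=2m$ is even with $r>4$, $w(r)_i=w(m)_{i\bmod m}$. Definition of $U(N)$ for $N\ge2$: build a rooted, vector-labeled binary tree $T_N$ whose root is labeled $\boldsymbol{w}(N)\in\mathbb{R}^N$. For a vertex with label $\boldsymbol{u}$, let $i_0<\dots<i_{a'-1}$ be the indices with $u_i>0$ and $j_0<\dots<j_{a''-1}$ those with $u_j<0$. If $a'\ge2$, add a left child labeled $\boldsymbol{u}'$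 with $u'_{i_r}=w(a')_r$ and $0$ elsewhere; if $a''\ge2$, add a right child labeled $\boldsymbol{u}''$ with $u''_{j_r}=w(a'')_r$ and $0$ elsewhere; if $a'=a''=1$ the vertex is a leaf. $U(N)=\{\boldsymbol{u}^{N;1},\dots,\boldsymbol{u}^{N;N-1}\}$, where $\boldsymbol{u}^{N;i}$ is the label of the $i$-th vertex in a depth-first (preorder) traversal of $T_N$, left child before right child. Write $\boldsymbol{u}^i=\boldsymbol{u}^{n;i}$. An element of $U(N)$ is skew-symmetric if its nonzero entries, read in order, are $(1,-1)$, and symmetric otherwise. For $\boldsymbol{v}\in U(N)$ write $v_j$ ($1\le j\le N-1$... ) — here, for a vector $\boldsymbol{v}=(v_0,\dots,v_{N-1})$ and $1\le j\le N$, write $v_{(j)}$ for its $j$-th entry $v_{j-1}$. Let $k=\lfloor n/2\rfloor$ and $k'=\lfloor (n-1)/2\rfloor$ (the numbers of skew-symmetric and symmetric elements of $U(n)$). Let $\boldsymbol{x}^1,\dots,\boldsymbol{x}^k$ be the matrices $\boldsymbol{u}^i\boldsymbol{u}^i$ with $\boldsymbol{u}^i$ skew-symmetric, and $\boldsymbol{y}^1,\dots,\boldsymbol{y}^{k'}$ the matrices $\boldsymbol{u}^i\boldsymbol{u}^i$ with $\boldsymbol{u}^i$ symmetric (each listed in increasing order of $i$). For $1\le i\le k-1$ set $\overline{\boldsymbol{x}}^i=\sum_{j=1}^{k}u^{k;i}_{(j)}\,\boldsymbol{x}^j$. Let $\ell_i=\sum_{a=1}^n(\boldsymbol{y}^i)_{aa}$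 (the trace of $\boldsymbol{y}^i$) for $1\le i\le k'$ and $\ell=\operatorname{lcm}\{\ell_1,\dots,\ell_{k'}\}$; for $1\le i\le k'-1$ set $\overline{\boldsymbol{y}}^i=\sum_{j=1}^{k'}\frac{\ell}{\ell_j}u^{k';i}_{(j)}\,\boldsymbol{y}^j$. (When $k\le 1$, respectively $k'\le 1$, the corresponding family is empty.)
   Formalization: The space of matrices is taken over the rationals instead of the reals: the set is shown to be an orthogonal basis of the rational matrices satisfying the defining equations, with rational coefficients in linear independence and spanning. -}

module Defs where

open import Data.Nat as ℕ using (ℕ; zero; suc; _∸_; _≤ᵇ_)
import Data.Nat.DivMod as ND
open import Data.Nat.LCM using (lcm)
open import Data.Integer as ℤ using (ℤ; +_; -[1+_]; ∣_∣)
open import Data.Rational as ℚ using (ℚ; 0ℚ)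
open import Data.Fin using (Fin; toℕ; opposite)
open import Data.List as L using (List; []; _∷_; _++_; upTo; tabulate; length; zip; map; concatMap; filterᵇ; foldr)
open import Data.List.Relation.Unary.All using (All)
open import Data.Product using (_×_; _,_; proj₁; proj₂; ∃)
open import Data.Bool using (Bool; true; false; if_then_else_; not; _∧_)
open import Relation.Binary.PropositionalEquality using (_≡_; _≢_)

nth1 : ∀ {A : Set} → A → List A → ℕ → A
nth1 d xs zero = d
nth1 d [] (suc i) = d
nth1 d (x ∷ xs) (suc zero) = x
nth1 d (x ∷ xs) (suc (suc i)) = nth1 d xs (suc i)

oneTo : ℕ → List ℕ
oneTo m = L.map suc (upTo m)

-- natural-number division a / b (b is always nonzero where used; returns 0 if b = 0)
divℕ : ℕ → ℕ → ℕ
divℕ a zero = zero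
divℕ a (suc b) = a ND./ suc b

infix 4 _≡ℤᵇ_
_≡ℤᵇ_ : ℤ → ℤ → Bool
a ≡ℤᵇ b = (a ℤ.≤ᵇ b) ∧ (b ℤ.≤ᵇ a)

ℤ→ℚ : ℤ → ℚ
ℤ→ℚ z = z ℚ./ 1

-- The vectors w(r), as a function of (r, i), i the 0-based index.
-- The first argument is fuel (recursion r ↦ r/2); wEntry r r i is w(r)_i.

wAux : ℕ → ℕ → ℕ → ℤ
wAux zero r i = + 0
wAux (suc f) r i with r ND.% 2
... | suc _ =
  if (i ND.% 2) ℕ.≡ᵇ 0 then + ((r ∸ 1) ND./ 2) else ℤ.- (+ ((r ℕ.+ 1) ND./ 2))
... | zero with r
...   | 2 = if i ℕ.≡ᵇ 0 then + 1 else ℤ.- (+ 1)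
...   | 4 = if (i ℕ.≡ᵇ 0) Data.Bool.∨ (i ℕ.≡ᵇ 3) then + 1 else ℤ.- (+ 1)
...   | r' with r' ND./ 2
...     | zero = + 0
...     | suc m' = wAux f (suc m') (i ND.% suc m')

wList : ℕ → List ℤ
wList r = L.map (wAux r r) (upTo r)

-- The tree T_N. A vertex label u ∈ ℝ^N is stored as its support:
-- the list of pairs (position, value) with value ≠ 0, positions increasing.

Label : Set
Label = List (ℕ × ℤ)

positives : Label → List ℕ
positives u = L.map proj₁ (filterᵇ (λ p → ℤ._≤ᵇ_ (+ 1) (proj₂ p)) u)

negatives : Label → List ℕ
negatives u = L.map proj₁ (filterᵇ (λ p → ℤ._≤ᵇ_ (proj₂ p) (ℤ.- (+ 1))) u)

childLabel : List ℕ → Label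
childLabel ps = zip ps (wList (length ps))

-- preorder (depth-first, left before right) list of labels of the subtree
-- rooted at a vertex with label u; first argument is fuel (the depth of T_N
-- is at most N, since supports strictly shrink).
preorder : ℕ → Label → List Label
preorder zero u = []
preorder (suc f) u = u ∷ (left ++ right)
  where
  ps = positives u
  ns = negatives u
  left  = if 2 ≤ᵇ length ps then preorder f (childLabel ps) else []
  right = if 2 ≤ᵇ length ns then preorder f (childLabel ns) else []

rootLabel : ℕ → Label
rootLabel N = zip (upTo N) (wList N)

-- U(N) as the list (u^{N;1}, ..., u^{N;N-1}) of labels
ULabels : ℕ → List Label
ULabels N = preorder N (rootLabel N)

labelAt : Label → ℕ → ℤ
labelAt [] p = + 0
labelAt ((q , v) ∷ u) p = if q ℕ.≡ᵇ p then v else labelAt u p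

uvec : (N : ℕ) → ℕ → Fin N → ℤ
uvec N i p = labelAt (nth1 [] (ULabels N) i) (toℕ p)

uEntry : ℕ → ℕ → ℕ → ℤ
uEntry N i j = labelAt (nth1 [] (ULabels N) i) (j ∸ 1)

nonzeros : ∀ {N} → (Fin N → ℤ) → List ℤ
nonzeros v = filterᵇ (λ z → not (z ≡ℤᵇ + 0)) (tabulate v)

isSkewᵇ : List ℤ → Bool
isSkewᵇ (a ∷ b ∷ []) = (a ≡ℤᵇ + 1) ∧ (b ≡ℤᵇ ℤ.- (+ 1))
isSkewᵇ _ = false

skew : (n i : ℕ) → Bool
skew n i = isSkewᵇ (nonzeros (uvec n i))

Mat : ℕ → Set
Mat n = Fin n → Fin n → ℚ

zeroMat : ∀ {n} → Mat n
zeroMat a b = 0ℚ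

sumFin : ∀ {m} → (Fin m → ℚ) → ℚ
sumFin {zero} f = 0ℚ
sumFin {suc m} f = f Fin.zero ℚ.+ sumFin (λ i → f (Fin.suc i))
  where import Data.Fin as Fin

sumTo : ℕ → (ℕ → ℚ) → ℚ
sumTo m f = foldr (λ j s → f j ℚ.+ s) 0ℚ (oneTo m)

dot : ∀ {n} → Mat n → Mat n → ℚ
dot x y = sumFin (λ a → sumFin (λ b → x a b ℚ.* y a b))

outer : ∀ {n} → (Fin n → ℤ) → (Fin n → ℤ) → Mat n
outer u v p q = ℤ→ℚ (u p ℤ.* v q)

record InVbar (n : ℕ) (x : Mat n) : Set where
  field
    rowSums  : ∀ a → sumFin (λ b → x a b) ≡ 0ℚ
    colSums  : ∀ b → sumFin (λ a → x a b) ≡ 0ℚ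
    diagSum  : sumFin (λ a → x a a) ≡ 0ℚ
    antiDiagSum : sumFin (λ a → x a (opposite a)) ≡ 0ℚ

k : ℕ → ℕ
k n = n ND./ 2

k' : ℕ → ℕ
k' n = (n ∸ 1) ND./ 2

skewIdx : ℕ → List ℕ
skewIdx n = filterᵇ (skew n) (oneTo (n ∸ 1))

symIdx : ℕ → List ℕ
symIdx n = filterᵇ (λ i → not (skew n i)) (oneTo (n ∸ 1))

xmat : (n : ℕ) → ℕ → Mat n
xmat n j = let i = nth1 0 (skewIdx n) j in outer (uvec n i) (uvec n i)

ymat : (n : ℕ) → ℕ → Mat n
ymat n j = let i = nth1 0 (symIdx n) j in outer (uvec n i) (uvec n i)

xbar : (n : ℕ) → ℕ → Mat n
xbar n i a b = sumTo (k n) (λ j → ℤ→ℚ (uEntry (k n) i j) ℚ.* xmat n j a b)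

trace : ∀ {n} → Mat n → ℚ
trace x = sumFin (λ a → x a a)

-- ℓ_i = trace y^i, an integer; computed directly as Σ_a (u^i_a)^2 ∈ ℤ
ℓi : ℕ → ℕ → ℕ
ℓi n j = let i = nth1 0 (symIdx n) j in
  ∣ foldr ℤ._+_ (+ 0) (tabulate (λ (a : Fin n) → uvec n i a ℤ.* uvec n i a)) ∣

ℓ : ℕ → ℕ
ℓ n = foldr (λ j acc → lcm (ℓi n j) acc) 1 (oneTo (k' n))

ybar : (n : ℕ) → ℕ → Mat n
ybar n i a b = sumTo (k' n) (λ j →
  ℤ→ℚ (+ divℕ (ℓ n) (ℓi n j) ℤ.* uEntry (k' n) i j) ℚ.* ymat n j a b)

pairMats : (n : ℕ) → List (Mat n)
pairMats n = concatMap (λ i → concatMap (λ j →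
    if i ℕ.≡ᵇ j then [] else outer (uvec n i) (uvec n j) ∷ []) (oneTo (n ∸ 1)))
  (oneTo (n ∸ 1))

family : (n : ℕ) → List (Mat n)
family n = pairMats n ++ L.map (xbar n) (oneTo (k n ∸ 1)) ++ L.map (ybar n) (oneTo (k' n ∸ 1))

lincomb : ∀ {n} (bs : List (Mat n)) → (Fin (length bs) → ℚ) → Mat n
lincomb bs c a b = sumFin (λ t → c t ℚ.* L.lookup bs t a b)

record IsOrthogonalBasisVbar (n : ℕ) (bs : List (Mat n)) : Set where
  field
    members     : ∀ t → InVbar n (L.lookup bs t)
    orthogonal  : ∀ s t → s ≢ t → dot (L.lookup bs s) (L.lookup bs t) ≡ 0ℚ
    independent : ∀ (c : Fin (length bs) → ℚ) →
                  (∀ a b → lincomb bs c a b ≡ 0ℚ) → ∀ t → c t ≡ 0ℚ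
    spanning    : ∀ (x : Mat n) → InVbar n x →
                  ∃ λ (c : Fin (length bs) → ℚ) → ∀ a b → x a b ≡ lincomb bs c a b

-- Every label u of the tree takes one value a > 0 on its positive positions, one value −b < 0 on its negative
-- positions, and sums to zero. The labels below u are supported in one of the two sign classes, where u is
-- constant, so U(n) is orthogonal; and a vector of sum zero orthogonal to u has sum zero on each sign class, so by
-- induction a vector of sum zero orthogonal to all of U(n) vanishes. Since w(r) is a palindrome for r ≥ 3, every
-- label is symmetric or antisymmetric under p ↦ n − 1 − p, and this determines the antidiagonal sum of uⁱuⁱ from
-- its trace.
-- A family of nonzero, pairwise orthogonal matrices of V̄ₙ is a basis as soon as only 0 is orthogonal to it. If
-- x ∈ V̄ₙ is orthogonal to all uⁱuʲ with i ≠ j, then x = Σᵢ dᵢ uⁱuⁱ, and its trace and antitrace give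
-- Σ dᵢ|uⁱ|² = 0 separately over the skew and the symmetric i. These are the sum conditions under which
-- orthogonality to the x̄ⁱ and the ȳⁱ, whose coefficients are U(k) and U(k′), forces all dᵢ = 0.
{-# OPTIONS --safe #-}
module Submission where

open import Defs
open import Data.Nat using (ℕ; _≤_)
open import Data.Nat as ℕ using (zero; suc; _<_; z≤n; s≤s)
import Data.Nat.Properties as ℕ
import Data.Nat.DivMod as ND
open import Data.Nat.Divisibility using (_∣_; ∣-trans)
open import Data.Nat.GCD using (gcd)
open import Data.Nat.LCM using (lcm; m∣lcm[m,n]; n∣lcm[m,n]; gcd*lcm)
open import Data.Integer as ℤ using (ℤ)
import Data.Integer.Properties as ℤ
open import Data.Rational as ℚ using (ℚ; 0ℚ; 1ℚ)
import Data.Rational.Properties as ℚ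
open import Data.Rational.Solver using (module +-*-Solver)
open import Data.Rational.Unnormalised as ℚᵘ using (mkℚᵘ)
import Data.Rational.Unnormalised.Properties as ℚᵘ
open import Data.Bool using (Bool; true; false; if_then_else_; not; T)
open import Data.Bool.Properties using (T?; T-≡; T-not-≡)
open import Data.Empty using (⊥-elim)
open import Data.Fin as Fin using (Fin; toℕ; opposite)
import Data.Fin.Properties as Fin
open import Data.List hiding (sum)
open import Data.List.Properties
open import Data.List.Membership.Propositional
open import Data.List.Membership.Propositional.Properties
open import Data.List.Membership.DecPropositional ℕ._≟_ using (_∈?_)
open import Data.List.Relation.Unary.All as All using (All; []; _∷_)
import Data.List.Relation.Unary.All.Properties as All
open import Data.List.Relation.Unary.AllPairs as AllPairs using (AllPairs; []; _∷_)
import Data.List.Relation.Unary.AllPairs.Properties as AllPairs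
open import Data.List.Relation.Unary.Any using (here; there)
import Data.List.Relation.Unary.Any.Properties as Any
open import Data.Product hiding (map; zip)
open import Data.Sum using (_⊎_; inj₁; inj₂; [_,_]′)
open import Function using (_∘_; id; const; case_of_)
open import Function.Bundles using (Equivalence)
open import Relation.Nullary using (Dec; yes; no; ¬_; contradiction)
open import Relation.Binary.PropositionalEquality
  using (_≡_; _≢_; refl; sym; trans; cong; cong₂; subst; module ≡-Reasoning)

-- The rescaling by `ℓ / ℓⱼ` lets one argument serve both families of diagonal combinations. If the
-- coefficients `cⱼ` make `cⱼ|uʲ|²` a constant `κ`, then `Σⱼ cⱼ eⱼ uʲuʲ` has trace `κ Σⱼ eⱼ`, and
-- the dot product of two such matrices is `κ²` times that of their coefficient vectors. Trace
-- conditions and orthogonality thus descend to `U(k)` and `U(k′)`. All skew elements have square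
-- norm 2, so `cⱼ = 1` works for them; the norms of symmetric elements differ, and `ℓ / ℓⱼ` is an
-- integral choice.
--
-- A numerical point shapes the combinatorics: the coefficient vectors have lengths `k` and `k′`, so
-- there must be exactly that many skew and symmetric elements. For sign classes of sizes `p` and
-- `q`, the sum `⌊p/2⌋ + ⌊q/2⌋` equals `⌊(p+q)/2⌋` unless both are odd. This exception must be ruled
-- out for every `w(r)` with `r ≥ 3`; it does occur for `w(2)`, which is where the single skew
-- element is created.
--
-- The integer data of the tree are kept apart from the linear algebra, which sees only functions
-- that are constant on two classes of positions.

private variable
  A B : Set

-- The weight vectors w(r): two values, sum zero, palindromes.

module Weights where
  open import Data.Nat using (_+_; _*_; ⌊_/2⌋; ⌈_/2⌉)
  open import Data.Nat.Properties
  open import Data.Integer using (+_; -[1+_])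

  m+m%2≡0 : ∀ m → (m + m) ND.% 2 ≡ 0
  m+m%2≡0 m = trans (cong (ND._% 2) (trans (cong (λ z → m + z) (sym (+-identityʳ m))) (*-comm 2 m)))
    (ND.m*n%n≡0 m 2)

  m+m/2≡m : ∀ m → (m + m) ND./ 2 ≡ m
  m+m/2≡m m = trans (cong (ND._/ 2) (trans (cong (λ z → m + z) (sym (+-identityʳ m))) (*-comm 2 m)))
    (ND.m*n/n≡m m 2)

  -- With the argument in the form `6 + x` the clauses for 2 and 4 are excluded by computation, so
  -- only the doubling clause remains.
  wAux-even : ∀ f x m i → (6 + x) ND.% 2 ≡ 0 → (6 + x) ND./ 2 ≡ suc m →
    wAux (suc f) (6 + x) i ≡ wAux f (suc m) (i ND.% suc m)
  wAux-even f x m i e h with (6 + x) ND.% 2 | e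
  ... | .0 | refl with (6 + x) ND./ 2 | h
  ... | .(suc m) | refl = refl

  wAux-odd : ∀ f r i e → r ND.% 2 ≡ suc e →
    wAux (suc f) r i ≡ (if ((i ND.% 2) ℕ.≡ᵇ 0) then + ((r ℕ.∸ 1) ND./ 2) else ℤ.- (+ ((r ℕ.+ 1) ND./ 2)))
  wAux-odd f r i e h with r ND.% 2 | h
  ... | .(suc e) | refl = refl

  parity : ∀ r → ∃ λ m → r ≡ m + m ⊎ r ≡ suc (m + m)
  parity zero = 0 , inj₁ refl
  parity (suc r) with parity r
  ... | m , inj₁ refl = m , inj₂ refl
  ... | m , inj₂ refl = suc m , inj₁ (cong suc (sym (+-suc m m)))

  1+m+m%2≡1 : ∀ m → suc (m + m) ND.% 2 ≡ 1
  1+m+m%2≡1 m = trans (cong (λ z → suc (m + z) ND.% 2) (sym (+-identityʳ m)))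
    (trans (cong (λ z → suc z ND.% 2) (*-comm 2 m)) (ND.[m+kn]%n≡m%n 1 m 2))

  alternating : ℤ → ℤ → ℕ → List ℤ
  alternating x y zero    = x ∷ []
  alternating x y (suc h) = x ∷ y ∷ alternating x y h

  applyUpTo-cong : ∀ {A : Set} {f g : ℕ → A} n → (∀ {i} → i < n → f i ≡ g i) → applyUpTo f n ≡ applyUpTo g n
  applyUpTo-cong zero eq = refl
  applyUpTo-cong (suc n) eq = cong₂ _∷_ (eq (s≤s z≤n)) (applyUpTo-cong n (λ lt → eq (s≤s lt)))

  applyUpTo-+ : ∀ {A : Set} (f : ℕ → A) m n → applyUpTo f (m + n) ≡ applyUpTo f m ++ applyUpTo (λ i →
    f (m + i)) n
  applyUpTo-+ f zero n = refl
  applyUpTo-+ f (suc m) n = cong (f 0 ∷_) (applyUpTo-+ (f ∘ suc) m n)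

  applyUpTo-alternating : ∀ (f : ℕ → ℤ) {x y} h → f 0 ≡ x → f 1 ≡ y → (∀ i → f (2 + i) ≡ f i) →
    applyUpTo f (suc (h + h)) ≡ alternating x y h
  applyUpTo-alternating f zero refl refl per = refl
  applyUpTo-alternating f {x} {y} (suc h) refl refl per rewrite +-suc h h =
    cong (λ zs → x ∷ y ∷ zs) (applyUpTo-alternating (λ i → f (2 + i)) h (per 0) (per 1) (λ i → per (2 + i)))

  alternating-∷ʳ : ∀ x y h → alternating x y h ++ y ∷ x ∷ [] ≡ alternating x y (suc h)
  alternating-∷ʳ x y zero = refl
  alternating-∷ʳ x y (suc h) = cong (λ zs → x ∷ y ∷ zs) (alternating-∷ʳ x y h)

  reverse-alternating : ∀ x y h → reverse (alternating x y h) ≡ alternating x y h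
  reverse-alternating x y zero = refl
  reverse-alternating x y (suc h) = begin
    reverse (x ∷ y ∷ alternating x y h)             ≡⟨ reverse-++ (x ∷ y ∷ []) (alternating x y h) ⟩
    reverse (alternating x y h) ++ y ∷ x ∷ []       ≡⟨ cong (_++ y ∷ x ∷ []) (reverse-alternating x y h) ⟩
    alternating x y h ++ y ∷ x ∷ []                 ≡⟨ alternating-∷ʳ x y h ⟩
    alternating x y (suc h)                         ∎
    where open ≡-Reasoning

  posᵇ negᵇ : ℤ → Bool
  posᵇ v = + 1 ℤ.≤ᵇ v
  negᵇ v = v ℤ.≤ᵇ (ℤ.- (+ 1))

  #pos #neg : List ℤ → ℕ
  #pos vs = length (filterᵇ posᵇ vs)
  #neg vs = length (filterᵇ negᵇ vs)

  -- Two values of opposite sign and total zero. The offsets by one build the signs into the type,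
  -- and the vanishing total is stated as an equation between natural numbers.
  record Balanced (vs : List ℤ) : Set where
    field
      a b         : ℕ
      values      : All (λ v → v ≡ + suc a ⊎ v ≡ -[1+ b ]) vs
      balance     : suc a * #pos vs ≡ suc b * #neg vs

  -- `halves` excludes two odd sign classes; it is the induction step for counting skew labels. Both
  -- fields fail for `w(2) = (1, -1)`.
  record Palindromic (vs : List ℤ) : Set where
    field
      reversal    : reverse vs ≡ vs
      halves      : ⌊ #pos vs /2⌋ + ⌊ #neg vs /2⌋ ≡ ⌊ length vs /2⌋

  #pos+#neg : ∀ {a b vs} → All (λ v → v ≡ + suc a ⊎ v ≡ -[1+ b ]) vs → #pos vs + #neg vs ≡ length vs
  #pos+#neg [] = refl
  #pos+#neg (inj₁ refl ∷ p) = cong suc (#pos+#neg p)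
  #pos+#neg {vs = _ ∷ vs} (inj₂ refl ∷ p) = trans (+-suc (#pos vs) (#neg vs)) (cong suc (#pos+#neg p))

  length-filterᵇ-double : ∀ (p : ℤ → Bool) vs →
    length (filterᵇ p (vs ++ vs)) ≡ length (filterᵇ p vs) + length (filterᵇ p vs)
  length-filterᵇ-double p vs = trans (cong length (filter-++ _ vs vs)) (length-++ (filterᵇ p vs))

  ⌊m+m/2⌋ : ∀ m → ⌊ m + m /2⌋ ≡ m
  ⌊m+m/2⌋ zero = refl
  ⌊m+m/2⌋ (suc m) rewrite +-suc m m = cong suc (⌊m+m/2⌋ m)

  ⌊1+m+m/2⌋ : ∀ m → ⌊ suc (m + m) /2⌋ ≡ m
  ⌊1+m+m/2⌋ zero = refl
  ⌊1+m+m/2⌋ (suc m) rewrite +-suc m m = cong suc (⌊1+m+m/2⌋ m)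

  balanced-++ : ∀ {vs} → Balanced vs → Balanced (vs ++ vs)
  balanced-++ {vs} bal = record
    { values  = All.++⁺ values values
    ; balance = begin
        suc a * #pos (vs ++ vs)           ≡⟨ cong (suc a *_) (length-filterᵇ-double posᵇ vs) ⟩
        suc a * (#pos vs + #pos vs)       ≡⟨ *-distribˡ-+ (suc a) (#pos vs) (#pos vs) ⟩
        suc a * #pos vs + suc a * #pos vs ≡⟨ cong₂ _+_ balance balance ⟩
        suc b * #neg vs + suc b * #neg vs ≡⟨ *-distribˡ-+ (suc b) (#neg vs) (#neg vs) ⟨
        suc b * (#neg vs + #neg vs)       ≡⟨ cong (suc b *_) (length-filterᵇ-double negᵇ vs) ⟨
        suc b * #neg (vs ++ vs)           ∎
    }
    where open Balanced bal
          open ≡-Reasoning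

  -- Doubling makes both sign counts even, so halving loses nothing; balance is used because it
  -- assigns a sign to every entry.
  palindromic-++ : ∀ {vs} → Balanced vs → reverse vs ≡ vs → Palindromic (vs ++ vs)
  palindromic-++ {vs} bal rev = record
    { reversal = trans (reverse-++ vs vs) (cong₂ _++_ rev rev)
    ; halves   = begin
        ⌊ #pos (vs ++ vs) /2⌋ + ⌊ #neg (vs ++ vs) /2⌋
          ≡⟨ cong₂ (λ x y → ⌊ x /2⌋ + ⌊ y /2⌋) (length-filterᵇ-double posᵇ vs) (length-filterᵇ-double negᵇ vs) ⟩
        ⌊ #pos vs + #pos vs /2⌋ + ⌊ #neg vs + #neg vs /2⌋
          ≡⟨ cong₂ _+_ (⌊m+m/2⌋ (#pos vs)) (⌊m+m/2⌋ (#neg vs)) ⟩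
        #pos vs + #neg vs             ≡⟨ #pos+#neg values ⟩
        length vs                     ≡⟨ ⌊m+m/2⌋ (length vs) ⟨
        ⌊ length vs + length vs /2⌋   ≡⟨ cong ⌊_/2⌋ (length-++ vs) ⟨
        ⌊ length (vs ++ vs) /2⌋       ∎
    }
    where open Balanced bal
          open ≡-Reasoning

  module _ (a b : ℕ) where
    private alt = alternating (+ suc a) -[1+ b ]

    #pos-alternating : ∀ h → #pos (alt h) ≡ suc h
    #pos-alternating zero    = refl
    #pos-alternating (suc h) = cong suc (#pos-alternating h)

    #neg-alternating : ∀ h → #neg (alt h) ≡ h
    #neg-alternating zero    = refl
    #neg-alternating (suc h) = cong suc (#neg-alternating h)

    alternating-values : ∀ h → All (λ v → v ≡ + suc a ⊎ v ≡ -[1+ b ]) (alt h)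
    alternating-values zero    = inj₁ refl ∷ []
    alternating-values (suc h) = inj₁ refl ∷ inj₂ refl ∷ alternating-values h

  -- This list is `w(2h + 3)`. The shift starts the odd case at `r = 3`, because the positive value
  -- `(r − 1)/2` would be 0 at `r = 1`.
  balanced-alternating : ∀ h → Balanced (alternating (+ suc h) -[1+ suc h ] (suc h))
  balanced-alternating h = record
    { values  = alternating-values h (suc h) (suc h)
    ; balance = begin
        suc h * #pos ws    ≡⟨ cong (suc h *_) (#pos-alternating h (suc h) (suc h)) ⟩
        suc h * (2 + h)    ≡⟨ *-comm (suc h) (2 + h) ⟩
        (2 + h) * suc h    ≡⟨ cong ((2 + h) *_) (#neg-alternating h (suc h) (suc h)) ⟨
        (2 + h) * #neg ws  ∎
    }
    where open ≡-Reasoning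
          ws = alternating (+ suc h) -[1+ suc h ] (suc h)

  -- The sign classes have the consecutive sizes `h + 2` and `h + 1`, of which only one is odd.
  -- Since `⌈ m /2⌉` unfolds to `⌊ suc m /2⌋`, their halves are the two halves of `h + 1`.
  palindromic-alternating : ∀ h → Palindromic (alternating (+ suc h) -[1+ suc h ] (suc h))
  palindromic-alternating h = record
    { reversal = reverse-alternating _ _ (suc h)
    ; halves   = begin
        ⌊ #pos ws /2⌋ + ⌊ #neg ws /2⌋
          ≡⟨ cong₂ (λ x y → ⌊ x /2⌋ + ⌊ y /2⌋) (#pos-alternating h (suc h) (suc h))
              (#neg-alternating h (suc h) (suc h)) ⟩
        ⌈ suc h /2⌉ + ⌊ suc h /2⌋           ≡⟨ +-comm ⌈ suc h /2⌉ ⌊ suc h /2⌋ ⟩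
        ⌊ suc h /2⌋ + ⌈ suc h /2⌉           ≡⟨ ⌊n/2⌋+⌈n/2⌉≡n (suc h) ⟩
        suc h                               ≡⟨ ⌊1+m+m/2⌋ (suc h) ⟨
        ⌊ suc (suc h + suc h) /2⌋           ≡⟨ cong ⌊_/2⌋ (+-comm (suc (suc h)) (suc h)) ⟩
        ⌊ suc h + suc (suc h) /2⌋           ≡⟨ cong ⌊_/2⌋ (+-comm (suc h) (suc (suc h))) ⟩
        ⌊ suc (suc h) + suc h /2⌋
          ≡⟨ cong₂ (λ x y → ⌊ x + y /2⌋) (#pos-alternating h (suc h) (suc h))
            (#neg-alternating h (suc h) (suc h)) ⟨
        ⌊ #pos ws + #neg ws /2⌋             ≡⟨ cong ⌊_/2⌋ (#pos+#neg (alternating-values h (suc h) (suc h))) ⟩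
        ⌊ length ws /2⌋                     ∎
    }
    where open ≡-Reasoning
          ws = alternating (+ suc h) -[1+ suc h ] (suc h)

  wAux-alternating : ∀ f h → applyUpTo (wAux (suc f) (suc (h + h))) (suc (h + h)) ≡ alternating (+ h) -[1+ h ] h
  wAux-alternating f h = begin
    applyUpTo (wAux (suc f) r) r  ≡⟨ applyUpTo-cong r (λ {i} _ → wAux-odd f r i 0 (1+m+m%2≡1 h)) ⟩
    applyUpTo entry r
      ≡⟨ applyUpTo-alternating entry h (cong +_ (m+m/2≡m h)) (cong (λ z → ℤ.- (+ z)) half)
                                       (λ i → cong byParity ([2+i]%2 i)) ⟩
    alternating (+ h) -[1+ h ] h  ∎
    where
    open ≡-Reasoning
    r = suc (h + h)
    byParity entry : ℕ → ℤ
    byParity z = if z ℕ.≡ᵇ 0 then + ((r ℕ.∸ 1) ND./ 2) else ℤ.- (+ ((r ℕ.+ 1) ND./ 2))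
    entry i = byParity (i ND.% 2)
    half : (r + 1) ND./ 2 ≡ suc h
    half = trans (cong (ND._/ 2) (trans (cong suc (+-comm (h + h) 1)) (cong suc (sym (+-suc h h)))))
      (m+m/2≡m (suc h))
    [2+i]%2 : ∀ i → (2 + i) ND.% 2 ≡ i ND.% 2
    [2+i]%2 i = trans (cong (ND._% 2) (+-comm 2 i)) (ND.[m+n]%n≡m%n i 2)

  wAux-mod : ∀ f r m i .{{_ : ℕ.NonZero m}} → 3 ≤ m → r ≡ m + m → wAux (suc f) r i ≡ wAux f m (i ND.% m)
  wAux-mod f r m@(suc (suc (suc k))) i (s≤s (s≤s (s≤s z≤n))) r≡ =
    trans (cong (λ z → wAux (suc f) z i) six)
          (wAux-even f (k + k) (2 + k) i (trans (cong (ND._% 2) six′) (m+m%2≡0 m))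
            (trans (cong (ND._/ 2) six′) (m+m/2≡m m)))
    where
    six : r ≡ 6 + (k + k)
    six = trans r≡ (cong (λ z → 3 + z) (+-comm k m))
    six′ : 6 + (k + k) ≡ m + m
    six′ = trans (sym six) r≡

  -- The residue of an index modulo `m` is the index itself on the first half and the index minus
  -- `m` on the second. The bound on `m` is the condition `r > 4` of the doubling rule.
  wAux-double : ∀ f r m → 3 ≤ m → r ≡ m + m →
    applyUpTo (wAux (suc f) r) (m + m) ≡ applyUpTo (wAux f m) m ++ applyUpTo (wAux f m) m
  wAux-double f r m 3≤m r≡ = trans (applyUpTo-+ (wAux (suc f) r) m m) (cong₂ _++_
    (applyUpTo-cong m λ {i} i<m → trans (wAux-mod f r m i 3≤m r≡) (cong (wAux f m) (ND.m<n⇒m%n≡m i<m)))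
    (applyUpTo-cong m λ {i} i<m → trans (wAux-mod f r m (m + i) 3≤m r≡)
      (cong (wAux f m) (trans (cong (ND._% m) (+-comm m i)) (trans (ND.[m+n]%n≡m%n i m) (ND.m<n⇒m%n≡m i<m))))))
    where instance
      m≢0 : ℕ.NonZero m
      m≢0 = ℕ.>-nonZero (≤-trans (s≤s z≤n) 3≤m)

  half≤ : ∀ {m f} → m + m ≤ suc f → 1 ≤ m → m ≤ f
  half≤ {suc m} {f} (s≤s le) _ = ≤-trans (m≤n+m (suc m) m) le

  wAux-shape : ∀ f r → 3 ≤ r → r ≤ f → Balanced (applyUpTo (wAux f r) r) × Palindromic (applyUpTo (wAux f r) r)
  wAux-shape zero r 3≤r r≤f = case ≤-trans 3≤r r≤f of λ ()
  wAux-shape (suc f) r 3≤r r≤f with parity r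
  ... | 0 , inj₁ refl = case 3≤r of λ ()
  ... | 1 , inj₁ refl = case 3≤r of λ { (s≤s (s≤s ())) }
  -- `w(4)` is not `w(2)` repeated: `(1, -1, 1, -1)` would be antisymmetric, while `(1, -1, -1, 1)`
  -- is a palindrome.
  ... | 2 , inj₁ refl =
      record { a = 0 ; b = 0 ; values = inj₁ refl ∷ inj₂ refl ∷ inj₂ refl ∷ inj₁ refl ∷ [] ; balance = refl }
    , record { reversal = refl ; halves = refl }
  ... | m@(suc (suc (suc _))) , inj₁ refl =
    let 3≤m = s≤s (s≤s (s≤s z≤n))
        bal , pal = wAux-shape f m 3≤m (half≤ r≤f (s≤s z≤n))
        eq = wAux-double f (m + m) m 3≤m refl
    in subst Balanced (sym eq) (balanced-++ bal) ,
       subst Palindromic (sym eq) (palindromic-++ bal (Palindromic.reversal pal))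
  ... | 0 , inj₂ refl = case 3≤r of λ { (s≤s ()) }
  ... | suc h , inj₂ refl =
    subst Balanced (sym eq) (balanced-alternating h) ,
    subst Palindromic (sym eq) (palindromic-alternating h)
    where eq = wAux-alternating f (suc h)

  wList≡ : ∀ r → wList r ≡ applyUpTo (wAux r r) r
  wList≡ r = map-upTo (wAux r r) r

  wList-balanced : ∀ {r} → 2 ≤ r → Balanced (wList r)
  wList-balanced {2} _ = record { a = 0 ; b = 0 ; values = inj₁ refl ∷ inj₂ refl ∷ [] ; balance = refl }
  wList-balanced {r@(suc (suc (suc _)))} _ = subst Balanced (sym (wList≡ r))
    (proj₁ (wAux-shape r r (s≤s (s≤s (s≤s z≤n))) ≤-refl))
  wList-balanced {1} (s≤s ())

  wList-palindromic : ∀ {r} → 3 ≤ r → Palindromic (wList r)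
  wList-palindromic {r} 3≤r = subst Palindromic (sym (wList≡ r)) (proj₂ (wAux-shape r r 3≤r ≤-refl))

  length-wList : ∀ r → length (wList r) ≡ r
  length-wList r = trans (length-map (wAux r r) (upTo r)) (length-upTo r)

-- Rational arithmetic and finite sums.

module Sums where
  open import Data.Rational using (_+_; _*_; -_)
  open +-*-Solver

  -- Normalisation in `ℚ` blocks a direct computation; among unnormalised fractions with denominator
  -- 1 the identity is immediate.
  ℤ→ℚ-* : ∀ x y → ℤ→ℚ (x ℤ.* y) ≡ ℤ→ℚ x * ℤ→ℚ y
  ℤ→ℚ-* x y = ℚ.toℚᵘ-injective (begin
    ℚ.toℚᵘ (ℤ→ℚ (x ℤ.* y))                 ≈⟨ ℚ.toℚᵘ-fromℚᵘ (mkℚᵘ (x ℤ.* y) 0) ⟩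
    mkℚᵘ x 0 ℚᵘ.* mkℚᵘ y 0                 ≈⟨ ℚᵘ.*-cong (ℚ.toℚᵘ-fromℚᵘ (mkℚᵘ x 0)) (ℚ.toℚᵘ-fromℚᵘ (mkℚᵘ y 0)) ⟨
    ℚ.toℚᵘ (ℤ→ℚ x) ℚᵘ.* ℚ.toℚᵘ (ℤ→ℚ y)     ≈⟨ ℚ.toℚᵘ-homo-* (ℤ→ℚ x) (ℤ→ℚ y) ⟨
    ℚ.toℚᵘ (ℤ→ℚ x * ℤ→ℚ y)                 ∎)
    where open ℚᵘ.≃-Reasoning

  ℤ→ℚ-+ : ∀ x y → ℤ→ℚ (x ℤ.+ y) ≡ ℤ→ℚ x + ℤ→ℚ y
  ℤ→ℚ-+ x y = ℚ.toℚᵘ-injective (begin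
    ℚ.toℚᵘ (ℤ→ℚ (x ℤ.+ y))                 ≈⟨ ℚ.toℚᵘ-fromℚᵘ (mkℚᵘ (x ℤ.+ y) 0) ⟩
    mkℚᵘ (x ℤ.+ y) 0
      ≡⟨ cong₂ (λ x y → mkℚᵘ (x ℤ.+ y) 0) (ℤ.*-identityʳ x) (ℤ.*-identityʳ y) ⟨
    mkℚᵘ x 0 ℚᵘ.+ mkℚᵘ y 0                 ≈⟨ ℚᵘ.+-cong (ℚ.toℚᵘ-fromℚᵘ (mkℚᵘ x 0)) (ℚ.toℚᵘ-fromℚᵘ (mkℚᵘ y 0)) ⟨
    ℚ.toℚᵘ (ℤ→ℚ x) ℚᵘ.+ ℚ.toℚᵘ (ℤ→ℚ y)     ≈⟨ ℚ.toℚᵘ-homo-+ (ℤ→ℚ x) (ℤ→ℚ y) ⟨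
    ℚ.toℚᵘ (ℤ→ℚ x + ℤ→ℚ y)                 ∎)
    where open ℚᵘ.≃-Reasoning

  ℤ→ℚ-injective : ∀ x y → ℤ→ℚ x ≡ ℤ→ℚ y → x ≡ y
  ℤ→ℚ-injective x y eq with ℚ.fromℚᵘ-injective {mkℚᵘ x 0} {mkℚᵘ y 0} eq
  ... | ℚᵘ.*≡* eq′ = trans (sym (ℤ.*-identityʳ x)) (trans eq′ (ℤ.*-identityʳ y))

  ℤ→ℚ-neg : ∀ x → ℤ→ℚ (ℤ.- x) ≡ - ℤ→ℚ x
  ℤ→ℚ-neg (ℤ.+ 0) = refl
  ℤ→ℚ-neg (ℤ.+ suc n) = refl
  ℤ→ℚ-neg ℤ.-[1+ n ] = sym (solve 1 (λ p → :- (:- p) := p) refl (ℤ→ℚ (ℤ.+ suc n)))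

  -- Opaque, like ∑ below, so that unification never unfolds the normalising arithmetic of ℚ.
  opaque
    ℕ→ℚ : ℕ → ℚ
    ℕ→ℚ m = ℤ→ℚ (ℤ.+ m)

    ℤ→ℚ-pos : ∀ m → ℤ→ℚ (ℤ.+ m) ≡ ℕ→ℚ m
    ℤ→ℚ-pos m = refl

    ℕ→ℚ-0 : ℕ→ℚ 0 ≡ 0ℚ
    ℕ→ℚ-0 = refl

    ℕ→ℚ-1 : ℕ→ℚ 1 ≡ 1ℚ
    ℕ→ℚ-1 = refl

    ℕ→ℚ-+ : ∀ m n → ℕ→ℚ (m ℕ.+ n) ≡ ℕ→ℚ m + ℕ→ℚ n
    ℕ→ℚ-+ m n = ℤ→ℚ-+ (ℤ.+ m) (ℤ.+ n)

    ℕ→ℚ-* : ∀ m n → ℕ→ℚ (m ℕ.* n) ≡ ℕ→ℚ m * ℕ→ℚ n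
    ℕ→ℚ-* m n = trans (cong ℤ→ℚ (ℤ.pos-* m n)) (ℤ→ℚ-* (ℤ.+ m) (ℤ.+ n))

    ℕ→ℚ≡0 : ∀ {m} → ℕ→ℚ m ≡ 0ℚ → m ≡ 0
    ℕ→ℚ≡0 {m} eq = ℤ.+-injective (ℤ→ℚ-injective (ℤ.+ m) (ℤ.+ 0) eq)

  *-cancel-zero : ∀ {x y} → x ≢ 0ℚ → x * y ≡ 0ℚ → y ≡ 0ℚ
  *-cancel-zero {x} {y} x≢0 xy≡0 = begin
    y                  ≡⟨ ℚ.*-identityˡ y ⟨
    1ℚ * y             ≡⟨ cong (_* y) (ℚ.*-inverseˡ x) ⟨
    (ℚ.1/ x) * x * y   ≡⟨ ℚ.*-assoc (ℚ.1/ x) x y ⟩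
    (ℚ.1/ x) * (x * y) ≡⟨ cong ((ℚ.1/ x) *_) xy≡0 ⟩
    (ℚ.1/ x) * 0ℚ      ≡⟨ ℚ.*-zeroʳ (ℚ.1/ x) ⟩
    0ℚ                 ∎
    where open ≡-Reasoning
          instance _ = ℚ.≢-nonZero x≢0

  *-nonzero : ∀ {x y} → x ≢ 0ℚ → y ≢ 0ℚ → x * y ≢ 0ℚ
  *-nonzero x≢0 y≢0 xy≡0 = y≢0 (*-cancel-zero x≢0 xy≡0)

  opaque
    ∑ : List A → (A → ℚ) → ℚ
    ∑ xs f = foldr (λ x s → f x + s) 0ℚ xs

    ∑-foldr : ∀ (f : A → ℚ) xs → foldr (λ x s → f x + s) 0ℚ xs ≡ ∑ xs f
    ∑-foldr f xs = refl

    ∑-[] : ∀ (f : A → ℚ) → ∑ [] f ≡ 0ℚ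
    ∑-[] f = refl

    ∑-∷ : ∀ (f : A → ℚ) x xs → ∑ (x ∷ xs) f ≡ f x + ∑ xs f
    ∑-∷ f x xs = refl

    ∑-cong : ∀ {f g : A → ℚ} xs → (∀ {x} → x ∈ xs → f x ≡ g x) → ∑ xs f ≡ ∑ xs g
    ∑-cong [] eq = refl
    ∑-cong (x ∷ xs) eq = cong₂ _+_ (eq (here refl)) (∑-cong xs (λ x∈ → eq (there x∈)))

    ∑-zero : ∀ {f : A → ℚ} xs → (∀ {x} → x ∈ xs → f x ≡ 0ℚ) → ∑ xs f ≡ 0ℚ
    ∑-zero [] eq = refl
    ∑-zero (x ∷ xs) eq = cong₂ _+_ (eq (here refl)) (∑-zero xs (λ x∈ → eq (there x∈)))

    ∑-*ˡ : ∀ c (f : A → ℚ) xs → ∑ xs (λ x → c * f x) ≡ c * ∑ xs f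
    ∑-*ˡ c f [] = sym (ℚ.*-zeroʳ c)
    ∑-*ˡ c f (x ∷ xs) = trans (cong (c * f x +_) (∑-*ˡ c f xs)) (sym (ℚ.*-distribˡ-+ c (f x) (∑ xs f)))

    ∑-*ʳ : ∀ c (f : A → ℚ) xs → ∑ xs (λ x → f x * c) ≡ ∑ xs f * c
    ∑-*ʳ c f [] = sym (ℚ.*-zeroˡ c)
    ∑-*ʳ c f (x ∷ xs) = trans (cong (f x * c +_) (∑-*ʳ c f xs)) (sym (ℚ.*-distribʳ-+ c (f x) (∑ xs f)))

    ∑-+ : ∀ (f g : A → ℚ) xs → ∑ xs (λ x → f x + g x) ≡ ∑ xs f + ∑ xs g
    ∑-+ f g [] = refl
    ∑-+ f g (x ∷ xs) = trans (cong (f x + g x +_) (∑-+ f g xs))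
      (solve 4 (λ a b c d → (a :+ b) :+ (c :+ d) := (a :+ c) :+ (b :+ d)) refl (f x) (g x) (∑ xs f) (∑ xs g))

    ∑-neg : ∀ (f : A → ℚ) xs → ∑ xs (λ x → - f x) ≡ - ∑ xs f
    ∑-neg f [] = refl
    ∑-neg f (x ∷ xs) = trans (cong (- f x +_) (∑-neg f xs)) (sym (ℚ.neg-distrib-+ (f x) (∑ xs f)))

    ∑-swap : ∀ (f : A → B → ℚ) xs ys → ∑ xs (λ x → ∑ ys (λ y → f x y)) ≡ ∑ ys (λ y → ∑ xs (λ x → f x y))
    ∑-swap f [] ys = sym (∑-zero ys (λ _ → refl))
    ∑-swap f (x ∷ xs) ys = trans (cong (∑ ys (f x) +_) (∑-swap f xs ys))
      (sym (∑-+ (f x) (λ y → ∑ xs (λ x → f x y)) ys))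

    ∑-map : ∀ (h : A → B) (f : B → ℚ) xs → ∑ (map h xs) f ≡ ∑ xs (λ x → f (h x))
    ∑-map h f [] = refl
    ∑-map h f (x ∷ xs) = cong (f (h x) +_) (∑-map h f xs)

    ∑-const : ∀ c (xs : List A) → ∑ xs (λ _ → c) ≡ c * ℕ→ℚ (length xs)
    ∑-const c [] = sym (trans (cong (c *_) ℕ→ℚ-0) (ℚ.*-zeroʳ c))
    ∑-const c (x ∷ xs) = begin
      c + ∑ xs (λ _ → c)                    ≡⟨ cong (c +_) (∑-const c xs) ⟩
      c + c * ℕ→ℚ (length xs)
        ≡⟨ solve 2 (λ c l → c :+ c :* l := c :* (con 1ℚ :+ l)) refl c (ℕ→ℚ (length xs)) ⟩
      c * (1ℚ + ℕ→ℚ (length xs))            ≡⟨ cong (λ z → c * (z + ℕ→ℚ (length xs))) ℕ→ℚ-1 ⟨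
      c * (ℕ→ℚ 1 + ℕ→ℚ (length xs))         ≡⟨ cong (c *_) (ℕ→ℚ-+ 1 (length xs)) ⟨
      c * ℕ→ℚ (suc (length xs))             ∎
      where open ≡-Reasoning

    ∑-single : ∀ {f : A → ℚ} {xs x} → AllPairs _≢_ xs → x ∈ xs → (∀ {y} → y ∈ xs → x ≢ y → f y ≡ 0ℚ) →
      ∑ xs f ≡ f x
    ∑-single {f = f} {x ∷ xs} (x∉ ∷ _) (here refl) off =
      trans (cong (f x +_) (∑-zero xs (λ y∈ → off (there y∈) (All.lookup x∉ y∈)))) (ℚ.+-identityʳ (f x))
    ∑-single {f = f} {y ∷ xs} {x} (y∉ ∷ uniq) (there x∈) off =
      trans (cong₂ _+_ (off (here refl) (λ x≡y → All.lookup y∉ x∈ (sym x≡y)))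
        (∑-single uniq x∈ (λ y∈ → off (there y∈)))) (ℚ.+-identityˡ (f x))

  ∑-* : ∀ (f : A → ℚ) (g : B → ℚ) xs ys → ∑ xs (λ x → ∑ ys (λ y → f x * g y)) ≡ ∑ xs f * ∑ ys g
  ∑-* f g xs ys = trans (∑-cong xs (λ {x} _ → ∑-*ˡ (f x) g ys)) (∑-*ʳ (∑ ys g) f xs)

  *-zeroʳ′ : ∀ x y → y ≡ 0ℚ → x * y ≡ 0ℚ
  *-zeroʳ′ x y refl = ℚ.*-zeroʳ x

  *-zeroˡ′ : ∀ x y → x ≡ 0ℚ → x * y ≡ 0ℚ
  *-zeroˡ′ x y refl = ℚ.*-zeroˡ y

  -- Orthogonality and completeness for trees of sign splits.

  _vanishesOff_ : (A → ℚ) → List A → Set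
  v vanishesOff ps = ∀ p → p ∉ ps → v p ≡ 0ℚ

  -- What the linear algebra retains of a label. Quantified over all `g`, the field `∑-split` says
  -- that `ps` is the union of `pos` and `neg` with multiplicity, without naming a permutation.
  record Split (u : A → ℚ) (ps pos neg : List A) : Set where
    field
      a b      : ℕ
      on-pos   : ∀ {p} → p ∈ pos → u p ≡ ℕ→ℚ (suc a)
      on-neg   : ∀ {p} → p ∈ neg → u p ≡ - ℕ→ℚ (suc b)
      off      : u vanishesOff ps
      ∑-split  : ∀ g → ∑ ps g ≡ ∑ pos g + ∑ neg g
      balance  : suc a ℕ.* length pos ≡ suc b ℕ.* length neg
      pos⊆     : ∀ {p} → p ∈ pos → p ∈ ps
      neg⊆     : ∀ {p} → p ∈ neg → p ∈ ps
      cover    : ∀ {p} → p ∈ ps → p ∈ pos ⊎ p ∈ neg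

    1+a+1+b≢0 : ℕ→ℚ (suc a) + ℕ→ℚ (suc b) ≢ 0ℚ
    1+a+1+b≢0 eq with ℕ→ℚ≡0 {suc a ℕ.+ suc b} (trans (ℕ→ℚ-+ (suc a) (suc b)) eq)
    ... | ()

    -- Forced by the values: a common position would make `a + 1` equal to `−(b + 1)`.
    disjoint : ∀ {p} → p ∈ pos → p ∉ neg
    disjoint {p} p∈pos p∈neg = 1+a+1+b≢0 (begin
      ℕ→ℚ (suc a) + ℕ→ℚ (suc b)      ≡⟨ cong (_+ ℕ→ℚ (suc b)) (trans (sym (on-pos p∈pos)) (on-neg p∈neg)) ⟩
      - ℕ→ℚ (suc b) + ℕ→ℚ (suc b)    ≡⟨ ℚ.+-inverseˡ (ℕ→ℚ (suc b)) ⟩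
      0ℚ                             ∎)
      where open ≡-Reasoning

    ∑-restrict-pos : ∀ g → g vanishesOff pos → ∑ ps g ≡ ∑ pos g
    ∑-restrict-pos g off = trans (∑-split g)
      (trans (cong (∑ pos g +_) (∑-zero neg (λ {p} p∈neg → off p (λ p∈pos → disjoint p∈pos p∈neg))))
        (ℚ.+-identityʳ (∑ pos g)))

    ∑-restrict-neg : ∀ g → g vanishesOff neg → ∑ ps g ≡ ∑ neg g
    ∑-restrict-neg g off = trans (∑-split g)
      (trans (cong (_+ ∑ neg g) (∑-zero pos (λ {p} p∈pos → off p (disjoint p∈pos)))) (ℚ.+-identityˡ (∑ neg g)))

    ∑-restrict-pos-* : ∀ (v w : A → ℚ) → v vanishesOff pos → ∑ ps (λ p → v p * w p) ≡ ∑ pos (λ p → v p * w p)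
    ∑-restrict-pos-* v w van = ∑-restrict-pos (λ p → v p * w p) (λ p p∉ → *-zeroˡ′ (v p) (w p) (van p p∉))

    ∑-restrict-neg-* : ∀ (v w : A → ℚ) → v vanishesOff neg → ∑ ps (λ p → v p * w p) ≡ ∑ neg (λ p → v p * w p)
    ∑-restrict-neg-* v w van = ∑-restrict-neg (λ p → v p * w p) (λ p p∉ → *-zeroˡ′ (v p) (w p) (van p p∉))

    ∑-weighted : ∀ g → ∑ ps (λ p → u p * g p) ≡ ℕ→ℚ (suc a) * ∑ pos g + - ℕ→ℚ (suc b) * ∑ neg g
    ∑-weighted g = trans (∑-split (λ p → u p * g p)) (cong₂ _+_
      (trans (∑-cong pos (λ {p} p∈ → cong (_* g p) (on-pos p∈))) (∑-*ˡ (ℕ→ℚ (suc a)) g pos))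
      (trans (∑-cong neg (λ {p} p∈ → cong (_* g p) (on-neg p∈))) (∑-*ˡ (- ℕ→ℚ (suc b)) g neg)))

    balanceℚ : ℕ→ℚ (suc a) * ℕ→ℚ (length pos) ≡ ℕ→ℚ (suc b) * ℕ→ℚ (length neg)
    balanceℚ = trans (sym (ℕ→ℚ-* (suc a) (length pos))) (trans (cong ℕ→ℚ balance) (ℕ→ℚ-* (suc b) (length neg)))

    ∑≡0 : ∑ ps u ≡ 0ℚ
    ∑≡0 = begin
      ∑ ps u                                                ≡⟨ ∑-split u ⟩
      ∑ pos u + ∑ neg u
        ≡⟨ cong₂ _+_ (trans (∑-cong pos on-pos) (∑-const (ℕ→ℚ (suc a)) pos))
          (trans (∑-cong neg on-neg) (∑-const (- ℕ→ℚ (suc b)) neg)) ⟩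
      ℕ→ℚ (suc a) * ℕ→ℚ (length pos) + - ℕ→ℚ (suc b) * ℕ→ℚ (length neg)
                                                            ≡⟨ cong (_+ - ℕ→ℚ (suc b) * ℕ→ℚ (length neg))
                                                              balanceℚ ⟩
      ℕ→ℚ (suc b) * ℕ→ℚ (length neg) + - ℕ→ℚ (suc b) * ℕ→ℚ (length neg)
                                                            ≡⟨ solve 2 (λ b l → b :* l :+ (:- b) :* l :=
                                                              con 0ℚ) refl (ℕ→ℚ (suc b)) (ℕ→ℚ (length neg)) ⟩
      0ℚ                                                    ∎
      where open ≡-Reasoning

    -- The square norm is the image of the natural number `(a+1)²|pos| + (b+1)²|neg|`, since
    -- squaring removes the sign of `−(b+1)`. Positivity is then read off in `ℕ` from the first
    -- summand.
    ∑-square≢0 : 1 ℕ.≤ length pos → ∑ ps (λ p → u p * u p) ≢ 0ℚ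
    ∑-square≢0 1≤ eq = contradiction (ℕ.m+n≡0⇒m≡0 (suc a ℕ.* (suc a ℕ.* length pos)) (ℕ→ℚ≡0 total≡0))
      (ℕ.m<n⇒n≢0 (ℕ.*-mono-≤ {1} {suc a} (ℕ.s≤s ℕ.z≤n) (ℕ.*-mono-≤ {1} {suc a} (ℕ.s≤s ℕ.z≤n) 1≤)))
      where
      open ≡-Reasoning
      total = suc a ℕ.* (suc a ℕ.* length pos) ℕ.+ suc b ℕ.* (suc b ℕ.* length neg)
      α = ℕ→ℚ (suc a)
      β = ℕ→ℚ (suc b)
      total≡0 : ℕ→ℚ total ≡ 0ℚ
      total≡0 = begin
        ℕ→ℚ total  ≡⟨ ℕ→ℚ-+ (suc a ℕ.* (suc a ℕ.* length pos)) (suc b ℕ.* (suc b ℕ.* length neg)) ⟩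
        ℕ→ℚ (suc a ℕ.* (suc a ℕ.* length pos)) + ℕ→ℚ (suc b ℕ.* (suc b ℕ.* length neg))
          ≡⟨ cong₂ _+_ (trans (ℕ→ℚ-* (suc a) (suc a ℕ.* length pos))
              (cong (α *_) (ℕ→ℚ-* (suc a) (length pos)))) (trans (ℕ→ℚ-* (suc b) (suc b ℕ.* length neg))
              (cong (β *_) (ℕ→ℚ-* (suc b) (length neg)))) ⟩
        α * (α * ℕ→ℚ (length pos)) + β * (β * ℕ→ℚ (length neg))
          ≡⟨ solve 4 (λ α β x y → α :* (α :* x) :+ β :* (β :* y) := α :* (α :* x) :+ (:- β) :* ((:- β) :* y))
              refl α β (ℕ→ℚ (length pos)) (ℕ→ℚ (length neg)) ⟩
        α * (α * ℕ→ℚ (length pos)) + (- β) * ((- β) * ℕ→ℚ (length neg))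
          ≡⟨ cong₂ (λ x y → α * x + (- β) * y) (trans (∑-cong pos on-pos) (∑-const α pos))
              (trans (∑-cong neg on-neg) (∑-const (- β) neg)) ⟨
        α * ∑ pos u + (- β) * ∑ neg u  ≡⟨ ∑-weighted u ⟨
        ∑ ps (λ p → u p * u p)  ≡⟨ eq ⟩
        0ℚ ∎

    -- With `P` and `Q` the two class sums, the hypotheses are `P + Q = 0` and `αP − βQ = 0`.
    -- Eliminating `P` leaves `(α + β)Q = 0`, and `α + β` is a positive integer.
    ∑-both≡0 : ∀ f → ∑ ps f ≡ 0ℚ → ∑ ps (λ p → u p * f p) ≡ 0ℚ → ∑ pos f ≡ 0ℚ × ∑ neg f ≡ 0ℚ
    ∑-both≡0 f sum≡0 weighted≡0 = pos≡0 , neg≡0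
      where
      open ≡-Reasoning
      α = ℕ→ℚ (suc a)
      β = ℕ→ℚ (suc b)
      P = ∑ pos f
      Q = ∑ neg f
      neg≡0 : Q ≡ 0ℚ
      neg≡0 = *-cancel-zero 1+a+1+b≢0 (begin
        (α + β) * Q
          ≡⟨ solve 4 (λ α β P Q → (α :+ β) :* Q := α :* (P :+ Q) :+ (:- (α :* P :+ (:- β) :* Q))) refl α β P Q ⟩
        α * (P + Q) + (- (α * P + (- β) * Q))
          ≡⟨ cong₂ (λ x y → α * x + (- y)) (trans (sym (∑-split f)) sum≡0)
            (trans (sym (∑-weighted f)) weighted≡0) ⟩
        α * 0ℚ + 0ℚ                          ≡⟨ cong (_+ 0ℚ) (ℚ.*-zeroʳ α) ⟩
        0ℚ                                   ∎)
      pos≡0 : P ≡ 0ℚ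
      pos≡0 = begin
        P       ≡⟨ ℚ.+-identityʳ P ⟨
        P + 0ℚ  ≡⟨ cong (P +_) neg≡0 ⟨
        P + Q   ≡⟨ trans (sym (∑-split f)) sum≡0 ⟩
        0ℚ      ∎

  -- Indexed by the positions under a vertex and the labels in preorder. A single position carries
  -- no label, so a leaf of `T_N`, whose label is `(1, -1)`, appears here as a `node` over two
  -- singletons.
  data SplitTree {A : Set} : List A → List (A → ℚ) → Set where
    leaf : ∀ p → SplitTree (p ∷ []) []
    node : ∀ {u ps pos neg us vs} → 1 ℕ.≤ length pos → Split u ps pos neg →
           SplitTree pos us → SplitTree neg vs → SplitTree ps (u ∷ us ++ vs)

  tree-vanishesOff : ∀ {ps : List A} {us} → SplitTree ps us → All (_vanishesOff ps) us
  tree-vanishesOff (leaf p) = []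
  tree-vanishesOff (node _ s l r) = off ∷ All.++⁺
    (All.map (λ van p p∉ → van p (p∉ ∘ pos⊆)) (tree-vanishesOff l))
    (All.map (λ van p p∉ → van p (p∉ ∘ neg⊆)) (tree-vanishesOff r))
    where open Split s

  tree-∑≡0 : ∀ {ps : List A} {us} → SplitTree ps us → All (λ u → ∑ ps u ≡ 0ℚ) us
  tree-∑≡0 (leaf p) = []
  tree-∑≡0 (node _ s l r) = ∑≡0 ∷ All.++⁺
    (All.zipWith (λ {v} (van , eq) → trans (∑-restrict-pos v van) eq) (tree-vanishesOff l , tree-∑≡0 l))
    (All.zipWith (λ {v} (van , eq) → trans (∑-restrict-neg v van) eq) (tree-vanishesOff r , tree-∑≡0 r))
    where open Split s

  tree-square≢0 : ∀ {ps : List A} {us} → SplitTree ps us → All (λ u → ∑ ps (λ p → u p * u p) ≢ 0ℚ) us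
  tree-square≢0 (leaf p) = []
  tree-square≢0 (node 1≤ s l r) = ∑-square≢0 1≤ ∷ All.++⁺
    (All.zipWith (λ {v} (van , ne) eq → ne (trans (sym (∑-restrict-pos-* v v van)) eq)) (tree-vanishesOff l ,
      tree-square≢0 l))
    (All.zipWith (λ {v} (van , ne) eq → ne (trans (sym (∑-restrict-neg-* v v van)) eq)) (tree-vanishesOff r ,
      tree-square≢0 r))
    where open Split s

  -- A root label is constant on each sign class, where the labels below it sum to zero; labels from
  -- different subtrees have disjoint supports. The vanishing of `v` is carried along because it is
  -- what permits passing from a sum over `ps` to one over a sign class.
  tree-orthogonal : ∀ {ps : List A} {us} → SplitTree ps us →
    AllPairs (λ v w → v vanishesOff ps × ∑ ps (λ p → v p * w p) ≡ 0ℚ) us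
  tree-orthogonal (leaf p) = []
  tree-orthogonal {ps = ps} (node {u} {pos = pos} {neg} {us} {vs} _ s l r) =
    All.map (off ,_) (All.++⁺
      (All.zipWith (λ {v} (van , eq) → trans (∑-weighted v) (cong₂ _+_ (*-zeroʳ′ α (∑ pos v) eq)
        (*-zeroʳ′ (- β) (∑ neg v) (∑-zero neg (λ {p} p∈neg → van p (λ p∈pos → disjoint p∈pos p∈neg))))))
        (tree-vanishesOff l , tree-∑≡0 l))
      (All.zipWith (λ {v} (van , eq) → trans (∑-weighted v) (cong₂ _+_
        (*-zeroʳ′ α (∑ pos v) (∑-zero pos (λ {p} p∈pos → van p (disjoint p∈pos))))
          (*-zeroʳ′ (- β) (∑ neg v) eq)))
        (tree-vanishesOff r , tree-∑≡0 r)))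
    ∷ AllPairs.++⁺
      (AllPairs.map (λ {v} {w} (van , eq) → pos-off v van , trans (∑-restrict-pos-* v w van) eq)
        (tree-orthogonal l))
      (AllPairs.map (λ {v} {w} (van , eq) → neg-off v van , trans (∑-restrict-neg-* v w van) eq)
        (tree-orthogonal r))
      (All.map (λ {v} van → All.map (λ {w} van′ → pos-off v van , trans (∑-restrict-pos-* v w van)
          (∑-zero pos (λ {p} p∈pos → *-zeroʳ′ (v p) (w p) (van′ p (disjoint p∈pos)))))
        (tree-vanishesOff r)) (tree-vanishesOff l))
    where
    open Split s
    α = ℕ→ℚ (suc a)
    β = ℕ→ℚ (suc b)
    pos-off : ∀ v → v vanishesOff pos → v vanishesOff ps
    pos-off v van p p∉ = van p (λ p∈ → p∉ (pos⊆ p∈))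
    neg-off : ∀ v → v vanishesOff neg → v vanishesOff ps
    neg-off v van p p∉ = van p (λ p∈ → p∉ (neg⊆ p∈))

  tree-complete : ∀ {ps : List A} {us} → SplitTree ps us → ∀ f → ∑ ps f ≡ 0ℚ →
    All (λ u → ∑ ps (λ p → u p * f p) ≡ 0ℚ) us → ∀ {p} → p ∈ ps → f p ≡ 0ℚ
  tree-complete (leaf p) f sum≡0 [] (here refl) = begin
    f p           ≡⟨ ℚ.+-identityʳ (f p) ⟨
    f p + 0ℚ      ≡⟨ cong (f p +_) (∑-[] f) ⟨
    f p + ∑ [] f  ≡⟨ ∑-∷ f p [] ⟨
    ∑ (p ∷ []) f  ≡⟨ sum≡0 ⟩
    0ℚ            ∎
    where open ≡-Reasoning
  tree-complete (node {us = us} _ s l r) f sum≡0 (eq ∷ eqs) {p} p∈ = [ in-pos , in-neg ]′ (cover p∈)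
    where
    open Split s
    sums = ∑-both≡0 f sum≡0 eq
    in-pos : p ∈ _ → f p ≡ 0ℚ
    in-pos = tree-complete l f (proj₁ sums) (All.zipWith
      (λ {v} (van , eq) → trans (sym (∑-restrict-pos-* v f van)) eq) (tree-vanishesOff l , All.++⁻ˡ us eqs))
    in-neg : p ∈ _ → f p ≡ 0ℚ
    in-neg = tree-complete r f (proj₂ sums) (All.zipWith
      (λ {v} (van , eq) → trans (sym (∑-restrict-neg-* v f van)) eq) (tree-vanishesOff r , All.++⁻ʳ us eqs))

open Weights
open Sums

-- Labels as sparse vectors, and the tree they form.

module Labels where
  open import Data.Nat using (_+_; _*_; _∸_; _≤ᵇ_; ⌊_/2⌋)
  open import Data.Nat.Properties

  positions : Label → List ℕ
  positions = map proj₁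

  entries : Label → List ℤ
  entries = map proj₂

  positions-zip : ∀ {xs : List ℕ} {vs} → length xs ≡ length vs → positions (zip xs vs) ≡ xs
  positions-zip {[]} {[]} eq = refl
  positions-zip {x ∷ xs} {v ∷ vs} eq = cong (x ∷_) (positions-zip (suc-injective eq))

  entries-zip : ∀ {xs : List ℕ} {vs} → length xs ≡ length vs → entries (zip xs vs) ≡ vs
  entries-zip {[]} {[]} eq = refl
  entries-zip {x ∷ xs} {v ∷ vs} eq = cong (v ∷_) (entries-zip (suc-injective eq))

  zip-∷ʳ : ∀ (xs : List A) (ys : List B) {x y} → length xs ≡ length ys →
    zip (xs ∷ʳ x) (ys ∷ʳ y) ≡ zip xs ys ∷ʳ (x , y)
  zip-∷ʳ [] [] eq = refl
  zip-∷ʳ (x ∷ xs) (y ∷ ys) eq = cong ((x , y) ∷_) (zip-∷ʳ xs ys (suc-injective eq))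

  zip-reverse : ∀ (xs : List A) (ys : List B) → length xs ≡ length ys →
    zip (reverse xs) (reverse ys) ≡ reverse (zip xs ys)
  zip-reverse [] [] eq = refl
  zip-reverse (x ∷ xs) (y ∷ ys) eq = begin
    zip (reverse (x ∷ xs)) (reverse (y ∷ ys))   ≡⟨ cong₂ zip (unfold-reverse x xs) (unfold-reverse y ys) ⟩
    zip (reverse xs ∷ʳ x) (reverse ys ∷ʳ y)
      ≡⟨ zip-∷ʳ (reverse xs) (reverse ys)
        (trans (length-reverse xs) (trans (suc-injective eq) (sym (length-reverse ys)))) ⟩
    zip (reverse xs) (reverse ys) ∷ʳ (x , y)    ≡⟨ cong (_∷ʳ (x , y)) (zip-reverse xs ys (suc-injective eq)) ⟩
    reverse (zip xs ys) ∷ʳ (x , y)              ≡⟨ unfold-reverse (x , y) (zip xs ys) ⟨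
    reverse (zip (x ∷ xs) (y ∷ ys))             ∎
    where open ≡-Reasoning

  filterᵇ-map : ∀ (p : B → Bool) (f : A → B) xs → filterᵇ p (map f xs) ≡ map f (filterᵇ (p ∘ f) xs)
  filterᵇ-map p f [] = refl
  filterᵇ-map p f (x ∷ xs) with p (f x)
  ... | true  = cong (f x ∷_) (filterᵇ-map p f xs)
  ... | false = filterᵇ-map p f xs

  filterᵇ-reverse : ∀ (p : A → Bool) xs → filterᵇ p (reverse xs) ≡ reverse (filterᵇ p xs)
  filterᵇ-reverse p [] = refl
  filterᵇ-reverse p (x ∷ xs) = trans (cong (filterᵇ p) (unfold-reverse x xs))
    (trans (filter-++ (T? ∘ p) (reverse xs) (x ∷ []))
      (trans (cong (_++ filterᵇ p (x ∷ [])) (filterᵇ-reverse p xs)) final))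
    where
    final : reverse (filterᵇ p xs) ++ filterᵇ p (x ∷ []) ≡ reverse (filterᵇ p (x ∷ xs))
    final with p x
    ... | true  = sym (unfold-reverse x (filterᵇ p xs))
    ... | false = ++-identityʳ (reverse (filterᵇ p xs))

  ≡ᵇ-refl : ∀ m → (m ℕ.≡ᵇ m) ≡ true
  ≡ᵇ-refl zero    = refl
  ≡ᵇ-refl (suc m) = ≡ᵇ-refl m

  ≢⇒≡ᵇ-false : ∀ m n → m ≢ n → (m ℕ.≡ᵇ n) ≡ false
  ≢⇒≡ᵇ-false m n m≢n with m ℕ.≡ᵇ n in eq
  ... | false = refl
  ... | true  = contradiction (≡ᵇ⇒≡ m n (subst T (sym eq) _)) m≢n

  labelAt-here : ∀ p v l → labelAt ((p , v) ∷ l) p ≡ v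
  labelAt-here p v l rewrite ≡ᵇ-refl p = refl

  labelAt-there : ∀ {q p} v l → q ≢ p → labelAt ((q , v) ∷ l) p ≡ labelAt l p
  labelAt-there {q} {p} v l q≢p rewrite ≢⇒≡ᵇ-false q p q≢p = refl

  labelAt-off : ∀ l {p} → p ∉ positions l → labelAt l p ≡ ℤ.+ 0
  labelAt-off [] p∉ = refl
  labelAt-off ((q , v) ∷ l) {p} p∉ = trans (labelAt-there v l (λ q≡p → p∉ (here (sym q≡p))))
    (labelAt-off l (p∉ ∘ there))

  Sorted : List ℕ → Set
  Sorted = AllPairs _<_

  labelAt-∈ : ∀ {l p v} → Sorted (positions l) → (p , v) ∈ l → labelAt l p ≡ v
  labelAt-∈ {(p , v) ∷ l} _ (here refl) = labelAt-here p v l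
  labelAt-∈ {(q , w) ∷ l} (q< ∷ sorted) (there p∈) =
    trans (labelAt-there w l (<⇒≢ (All.lookup q< (∈-map⁺ proj₁ p∈)))) (labelAt-∈ sorted p∈)

  entry : Label → ℕ → ℚ
  entry l p = ℤ→ℚ (labelAt l p)

  positives-sorted : ∀ {l} → Sorted (positions l) → Sorted (positives l)
  positives-sorted sorted = AllPairs.map⁺ (AllPairs.filter⁺ (T? ∘ posᵇ ∘ proj₂) (AllPairs.map⁻ sorted))

  negatives-sorted : ∀ {l} → Sorted (positions l) → Sorted (negatives l)
  negatives-sorted sorted = AllPairs.map⁺ (AllPairs.filter⁺ (T? ∘ negᵇ ∘ proj₂) (AllPairs.map⁻ sorted))

  #pos-entries : ∀ l → #pos (entries l) ≡ length (positives l)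
  #pos-entries l = trans (cong length (filterᵇ-map posᵇ proj₂ l))
    (trans (length-map proj₂ (filterᵇ (posᵇ ∘ proj₂) l)) (sym (length-map proj₁ (filterᵇ (posᵇ ∘ proj₂) l))))

  #neg-entries : ∀ l → #neg (entries l) ≡ length (negatives l)
  #neg-entries l = trans (cong length (filterᵇ-map negᵇ proj₂ l))
    (trans (length-map proj₂ (filterᵇ (negᵇ ∘ proj₂) l)) (sym (length-map proj₁ (filterᵇ (negᵇ ∘ proj₂) l))))

  module _ {l : Label} (sorted : Sorted (positions l)) (bal : Balanced (entries l)) where
    open Balanced bal

    private
      value : ∀ {p v} → (p , v) ∈ l → v ≡ ℤ.+ suc a ⊎ v ≡ ℤ.-[1+ b ]
      value pv∈ = All.lookup values (∈-map⁺ proj₂ pv∈)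

      on-positives : ∀ {p} → p ∈ positives l → ∃ λ v → (p , v) ∈ l × v ≡ ℤ.+ suc a
      on-positives p∈ with ∈-map⁻ proj₁ p∈
      ... | (p , v) , pv∈ , refl with ∈-filter⁻ (T? ∘ posᵇ ∘ proj₂) {xs = l} pv∈
      ... | pv∈l , isPos with value pv∈l
      ... | inj₂ refl = ⊥-elim isPos
      ... | inj₁ refl = v , pv∈l , refl

      on-negatives : ∀ {p} → p ∈ negatives l → ∃ λ v → (p , v) ∈ l × v ≡ ℤ.-[1+ b ]
      on-negatives p∈ with ∈-map⁻ proj₁ p∈
      ... | (p , v) , pv∈ , refl with ∈-filter⁻ (T? ∘ negᵇ ∘ proj₂) {xs = l} pv∈
      ... | pv∈l , isNeg with value pv∈l
      ... | inj₁ refl = ⊥-elim isNeg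
      ... | inj₂ refl = v , pv∈l , refl

      cover-label : ∀ {p} → p ∈ positions l → p ∈ positives l ⊎ p ∈ negatives l
      cover-label p∈ with ∈-map⁻ proj₁ p∈
      ... | (p , v) , pv∈ , refl with value pv∈
      ... | inj₁ refl = inj₁ (∈-map⁺ proj₁ (∈-filter⁺ (T? ∘ posᵇ ∘ proj₂) pv∈ _))
      ... | inj₂ refl = inj₂ (∈-map⁺ proj₁ (∈-filter⁺ (T? ∘ negᵇ ∘ proj₂) pv∈ _))

    -- Stated for any `k` with the two values of `l`, because a tail of a balanced label need not be
    -- balanced and the induction runs over tails.
    ∑-positives-negatives : ∀ g (k : Label) → All (λ v → v ≡ ℤ.+ suc a ⊎ v ≡ ℤ.-[1+ b ]) (entries k) →
      ∑ (positions k) g ≡ ∑ (positives k) g ℚ.+ ∑ (negatives k) g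
    ∑-positives-negatives g [] [] = trans (∑-[] g) (sym (cong₂ ℚ._+_ (∑-[] g) (∑-[] g)))
    ∑-positives-negatives g ((p , _) ∷ k) (inj₁ refl ∷ vs) = begin
      ∑ (p ∷ positions k) g                                  ≡⟨ ∑-∷ g p (positions k) ⟩
      g p ℚ.+ ∑ (positions k) g
        ≡⟨ cong (λ z → g p ℚ.+ z) (∑-positives-negatives g k vs) ⟩
      g p ℚ.+ (∑ (positives k) g ℚ.+ ∑ (negatives k) g)
        ≡⟨ ℚ.+-assoc (g p) (∑ (positives k) g) (∑ (negatives k) g) ⟨
      g p ℚ.+ ∑ (positives k) g ℚ.+ ∑ (negatives k) g
        ≡⟨ cong (ℚ._+ ∑ (negatives k) g) (∑-∷ g p (positives k)) ⟨
      ∑ (p ∷ positives k) g ℚ.+ ∑ (negatives k) g            ∎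
      where open ≡-Reasoning
    ∑-positives-negatives g ((p , _) ∷ k) (inj₂ refl ∷ vs) = begin
      ∑ (p ∷ positions k) g                                  ≡⟨ ∑-∷ g p (positions k) ⟩
      g p ℚ.+ ∑ (positions k) g
        ≡⟨ cong (λ z → g p ℚ.+ z) (∑-positives-negatives g k vs) ⟩
      g p ℚ.+ (∑ (positives k) g ℚ.+ ∑ (negatives k) g)
        ≡⟨ cong (λ z → g p ℚ.+ z) (ℚ.+-comm (∑ (positives k) g) (∑ (negatives k) g)) ⟩
      g p ℚ.+ (∑ (negatives k) g ℚ.+ ∑ (positives k) g)
        ≡⟨ ℚ.+-assoc (g p) (∑ (negatives k) g) (∑ (positives k) g) ⟨
      g p ℚ.+ ∑ (negatives k) g ℚ.+ ∑ (positives k) g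
        ≡⟨ cong (ℚ._+ ∑ (positives k) g) (∑-∷ g p (negatives k)) ⟨
      ∑ (p ∷ negatives k) g ℚ.+ ∑ (positives k) g
        ≡⟨ ℚ.+-comm (∑ (p ∷ negatives k) g) (∑ (positives k) g) ⟩
      ∑ (positives k) g ℚ.+ ∑ (p ∷ negatives k) g            ∎
      where open ≡-Reasoning

    label-split : Split (entry l) (positions l) (positives l) (negatives l)
    label-split = record
      { a = a ; b = b
      ; on-pos  = λ p∈ → let v , pv∈ , v≡ = on-positives p∈ in
                    trans (cong ℤ→ℚ (trans (labelAt-∈ sorted pv∈) v≡)) (ℤ→ℚ-pos (suc a))
      ; on-neg  = λ p∈ → let v , pv∈ , v≡ = on-negatives p∈ in
                    trans (cong ℤ→ℚ (trans (labelAt-∈ sorted pv∈) v≡)) (cong ℚ.-_ (ℤ→ℚ-pos (suc b)))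
      ; off     = λ p p∉ → cong ℤ→ℚ (labelAt-off l p∉)
      ; ∑-split = λ g → ∑-positives-negatives g l values
      ; balance = trans (cong (suc a *_) (sym (#pos-entries l)))
        (trans balance (cong (suc b *_) (#neg-entries l)))
      ; pos⊆    = λ p∈ → let v , pv∈ , _ = on-positives p∈ in ∈-map⁺ proj₁ pv∈
      ; neg⊆    = λ p∈ → let v , pv∈ , _ = on-negatives p∈ in ∈-map⁺ proj₁ pv∈
      ; cover   = cover-label
      }

  -- By `balance` one sign class is empty only if the other is, and then no entry is left.
  -- Consequently supports shrink strictly down the tree.
  both-signs : ∀ {vs} → Balanced vs → 1 ≤ length vs → 1 ≤ #pos vs × 1 ≤ #neg vs
  both-signs {vs} bal 1≤ = n≢0⇒n>0 pos≢0 , n≢0⇒n>0 neg≢0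
    where
    open Balanced bal
    total : #pos vs ≡ 0 → #neg vs ≡ 0 → 1 ≤ 0
    total p≡0 n≡0 = subst (1 ≤_) (trans (sym (#pos+#neg values)) (cong₂ _+_ p≡0 n≡0)) 1≤
    neg-zero : #pos vs ≡ 0 → #neg vs ≡ 0
    neg-zero p≡0 = m*n≡0⇒n≡0′ (suc b) (trans (sym balance) (trans (cong (suc a *_) p≡0) (*-zeroʳ (suc a))))
      where m*n≡0⇒n≡0′ : ∀ m {n} .{{_ : ℕ.NonZero m}} → m * n ≡ 0 → n ≡ 0
            m*n≡0⇒n≡0′ (suc m) {n} eq = m+n≡0⇒m≡0 n eq
    pos-zero : #neg vs ≡ 0 → #pos vs ≡ 0
    pos-zero n≡0 = m+n≡0⇒m≡0 (#pos vs) (trans balance (trans (cong (suc b *_) n≡0) (*-zeroʳ (suc b))))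
    pos≢0 : #pos vs ≢ 0
    pos≢0 p≡0 = case total p≡0 (neg-zero p≡0) of λ ()
    neg≢0 : #neg vs ≢ 0
    neg≢0 n≡0 = case total (pos-zero n≡0) n≡0 of λ ()

  module _ (ps : List ℕ) where
    private len : length ps ≡ length (wList (length ps))
            len = sym (length-wList (length ps))

    positions-childLabel : positions (childLabel ps) ≡ ps
    positions-childLabel = positions-zip len

    entries-childLabel : entries (childLabel ps) ≡ wList (length ps)
    entries-childLabel = entries-zip len

    balanced-childLabel : 2 ≤ length ps → Balanced (entries (childLabel ps))
    balanced-childLabel 2≤ = subst Balanced (sym entries-childLabel) (wList-balanced 2≤)

    childLabel-children : 2 ≤ length ps →
      (1 ≤ length (positives (childLabel ps)) × 1 ≤ length (negatives (childLabel ps)))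
      × length (positives (childLabel ps)) + length (negatives (childLabel ps)) ≡ length ps
    childLabel-children 2≤ =
      ( subst (1 ≤_) (#pos-entries (childLabel ps)) (proj₁ signs)
      , subst (1 ≤_) (#neg-entries (childLabel ps)) (proj₂ signs))
      , trans (sym (cong₂ _+_ (#pos-entries (childLabel ps)) (#neg-entries (childLabel ps))))
        (trans (#pos+#neg (Balanced.values (balanced-childLabel 2≤)))
        (trans (cong length entries-childLabel) (length-wList (length ps))))
      where
      signs = both-signs (balanced-childLabel 2≤)
        (subst (1 ≤_) (sym (trans (cong length entries-childLabel) (length-wList (length ps))))
        (≤-trans (n≤1+n 1) 2≤))

  -- `preorder` without fuel. A label is determined by its list of positions, and a list of one
  -- position yields no vertex, in agreement with the tests `a' ≥ 2` and `a'' ≥ 2`.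
  data LabelTree : List ℕ → List Label → Set where
    leaf : ∀ p → LabelTree (p ∷ []) []
    node : ∀ {ps ls rs} → 2 ≤ length ps → LabelTree (positives (childLabel ps)) ls →
           LabelTree (negatives (childLabel ps)) rs → LabelTree ps (childLabel ps ∷ ls ++ rs)

  -- Both sign classes are nonempty, so each is strictly shorter than `ps` and one unit of fuel less
  -- is enough for it.
  preorder-tree : ∀ f ps → 2 ≤ length ps → length ps ≤ f → LabelTree ps (preorder f (childLabel ps))
  preorder-tree zero ps 2≤ ps≤ = case ≤-trans 2≤ ps≤ of λ ()
  preorder-tree (suc f) ps 2≤ ps≤ with childLabel-children ps 2≤
  ... | (1≤pos , 1≤neg) , total = node 2≤
    (branch (positives (childLabel ps)) 1≤pos (≤-pred (≤-trans (<-of-sum 1≤neg total) ps≤)))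
    (branch (negatives (childLabel ps)) 1≤neg
      (≤-pred (≤-trans (<-of-sum 1≤pos
      (trans (+-comm (length (negatives (childLabel ps))) (length (positives (childLabel ps)))) total)) ps≤)))
    where
    <-of-sum : ∀ {i j s} → 1 ≤ j → i + j ≡ s → i < s
    <-of-sum {i} {j} 1≤j refl = ≤-trans (≤-reflexive (+-comm 1 i)) (+-monoʳ-≤ i 1≤j)
    branch : ∀ qs → 1 ≤ length qs → length qs ≤ f →
      LabelTree qs (if 2 ≤ᵇ length qs then preorder f (childLabel qs) else [])
    branch (q ∷ []) _ _ = leaf q
    branch (q ∷ q′ ∷ qs) _ qs≤ = preorder-tree f (q ∷ q′ ∷ qs) (s≤s (s≤s z≤n)) qs≤

  -- The root label is the child label of the full list of positions, once `length (upTo N)` is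
  -- rewritten to `N`.
  ULabels-tree : ∀ {N} → 2 ≤ N → LabelTree (upTo N) (ULabels N)
  ULabels-tree {N} 2≤N = subst (λ m → LabelTree (upTo N) (preorder N (zip (upTo N) (wList m)))) (length-upTo N)
    (preorder-tree N (upTo N) (subst (2 ≤_) (sym (length-upTo N)) 2≤N) (≤-reflexive (length-upTo N)))

  childLabel-sorted : ∀ {ps} → Sorted ps → Sorted (positions (childLabel ps))
  childLabel-sorted {ps} sorted = subst Sorted (sym (positions-childLabel ps)) sorted

  childLabel-split : ∀ {ps} → 2 ≤ length ps → Sorted ps →
    Split (entry (childLabel ps)) ps (positives (childLabel ps)) (negatives (childLabel ps))
  childLabel-split {ps} 2≤ sorted = subst
    (λ qs → Split (entry (childLabel ps)) qs (positives (childLabel ps)) (negatives (childLabel ps)))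
      (positions-childLabel ps)
    (label-split (childLabel-sorted sorted) (balanced-childLabel ps 2≤))

  labelTree-splitTree : ∀ {ps ls} → Sorted ps → LabelTree ps ls → SplitTree ps (map entry ls)
  labelTree-splitTree sorted (leaf p) = leaf p
  labelTree-splitTree {ps} sorted (node {ls = ls} {rs} 2≤ l r) =
    subst (λ us → SplitTree ps (entry (childLabel ps) ∷ us)) (sym (map-++ entry ls rs))
      (node (proj₁ (proj₁ (childLabel-children ps 2≤)))
        (childLabel-split 2≤ sorted)
        (labelTree-splitTree (positives-sorted {childLabel ps} (childLabel-sorted sorted)) l)
        (labelTree-splitTree (negatives-sorted {childLabel ps} (childLabel-sorted sorted)) r))

  -- A binary tree in which every internal vertex has two children has one internal vertex fewer
  -- than leaves; here the leaves are the single positions.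
  labelTree-length : ∀ {ps ls} → LabelTree ps ls → suc (length ls) ≡ length ps
  labelTree-length (leaf p) = refl
  labelTree-length {ps} (node {ls = ls} {rs} 2≤ l r) = begin
    suc (suc (length (ls ++ rs)))          ≡⟨ cong (2 +_) (length-++ ls) ⟩
    suc (suc (length ls + length rs))      ≡⟨ cong suc (+-suc (length ls) (length rs)) ⟨
    suc (length ls) + suc (length rs)      ≡⟨ cong₂ _+_ (labelTree-length l) (labelTree-length r) ⟩
    length (positives (childLabel ps)) + length (negatives (childLabel ps))
      ≡⟨ proj₂ (childLabel-children ps 2≤) ⟩
    length ps                              ∎
    where open ≡-Reasoning

  isSkewLabel : Label → Bool
  isSkewLabel l = isSkewᵇ (entries l)

  long-not-skew : ∀ vs → 3 ≤ length vs → isSkewᵇ vs ≡ false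
  long-not-skew (_ ∷ _ ∷ _ ∷ _) _ = refl
  long-not-skew [] ()
  long-not-skew (_ ∷ []) (s≤s ())
  long-not-skew (_ ∷ _ ∷ []) (s≤s (s≤s ()))

  data Size : ∀ (ps : List ℕ) → Set where
    two  : ∀ p q → Size (p ∷ q ∷ [])
    more : ∀ {ps} → 3 ≤ length ps → Size ps

  size : ∀ {ps} → 2 ≤ length ps → Size ps
  size {p ∷ q ∷ []} _ = two p q
  size {p ∷ q ∷ r ∷ ps} _ = more (s≤s (s≤s (s≤s z≤n)))
  size {p ∷ []} (s≤s ())

  labelTree-singleton : ∀ {p ls} → LabelTree (p ∷ []) ls → ls ≡ []
  labelTree-singleton (leaf p) = refl
  labelTree-singleton (node (s≤s ()) _ _)

  -- Labels on two positions are skew and have nothing below them; labels on three or more are not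
  -- skew, and `halves` adds up the counts of the two subtrees.
  labelTree-#skew : ∀ {ps ls} → LabelTree ps ls → length (filterᵇ isSkewLabel ls) ≡ ⌊ length ps /2⌋
  labelTree-#skew (leaf p) = refl
  labelTree-#skew {ps} (node {ls = ls} {rs} 2≤ l r) with size {ps} 2≤
  ... | two p q rewrite labelTree-singleton l | labelTree-singleton r = refl
  ... | more 3≤ = begin
    length (filterᵇ isSkewLabel (childLabel ps ∷ ls ++ rs))
      ≡⟨ cong length (filter-reject (T? ∘ isSkewLabel) {childLabel ps} {ls ++ rs} (subst T not-skew)) ⟩
    length (filterᵇ isSkewLabel (ls ++ rs))
      ≡⟨ cong length (filter-++ (T? ∘ isSkewLabel) ls rs) ⟩
    length (filterᵇ isSkewLabel ls ++ filterᵇ isSkewLabel rs)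
      ≡⟨ length-++ (filterᵇ isSkewLabel ls) ⟩
    length (filterᵇ isSkewLabel ls) + length (filterᵇ isSkewLabel rs)
      ≡⟨ cong₂ _+_ (labelTree-#skew l) (labelTree-#skew r) ⟩
    ⌊ length (positives (childLabel ps)) /2⌋ + ⌊ length (negatives (childLabel ps)) /2⌋
      ≡⟨ cong₂ (λ i j → ⌊ i /2⌋ + ⌊ j /2⌋) (#pos-entries (childLabel ps)) (#neg-entries (childLabel ps)) ⟨
    ⌊ #pos (entries (childLabel ps)) /2⌋ + ⌊ #neg (entries (childLabel ps)) /2⌋
      ≡⟨ cong (λ vs → ⌊ #pos vs /2⌋ + ⌊ #neg vs /2⌋) (entries-childLabel ps) ⟩
    ⌊ #pos (wList (length ps)) /2⌋ + ⌊ #neg (wList (length ps)) /2⌋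
      ≡⟨ Palindromic.halves (wList-palindromic 3≤) ⟩
    ⌊ length (wList (length ps)) /2⌋
      ≡⟨ cong ⌊_/2⌋ (length-wList (length ps)) ⟩
    ⌊ length ps /2⌋ ∎
    where
    open ≡-Reasoning
    not-skew : isSkewLabel (childLabel ps) ≡ false
    not-skew = long-not-skew (entries (childLabel ps))
      (subst (3 ≤_) (sym (trans (cong length (entries-childLabel ps)) (length-wList (length ps)))) 3≤)

  nonzeroᵇ : ℤ → Bool
  nonzeroᵇ z = not (z ≡ℤᵇ ℤ.+ 0)

  filterᵇ-none : ∀ (p : A → Bool) xs → All (λ x → p x ≡ false) xs → filterᵇ p xs ≡ []
  filterᵇ-none p xs none = filter-none (T? ∘ p) (All.map (λ eq t → subst T eq t) none)

  nonzero-entries : ∀ {vs} → Balanced vs → All (λ v → nonzeroᵇ v ≡ true) vs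
  nonzero-entries bal = All.map (λ { (inj₁ refl) → refl ; (inj₂ refl) → refl }) (Balanced.values bal)

  -- The window `[o, N + o)` carries the induction: dropping the first vector entry moves it to the
  -- right, and the label loses its head exactly when that head sits at `o`.
  nonzeros-window : ∀ N o l → Sorted (positions l) → All (λ q → o ≤ q × q < N + o) (positions l) →
    All (λ v → nonzeroᵇ v ≡ true) (entries l) → filterᵇ nonzeroᵇ
      (tabulate {n = N} (λ p → labelAt l (toℕ p + o))) ≡ entries l
  nonzeros-window N o [] _ _ _ = filterᵇ-none nonzeroᵇ (tabulate {n = N} (λ _ → ℤ.+ 0))
    (All.tabulate⁺ (λ _ → refl))
  nonzeros-window zero o ((q , v) ∷ l) _ ((o≤q , q<o) ∷ _) _ = contradiction o≤q (<⇒≱ q<o)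
  nonzeros-window (suc N) o ((q , v) ∷ l) (q< ∷ sorted) ((o≤q , q<o+N) ∷ bounds) (v≢0 ∷ vs≢0) with o ≟ q
  ... | yes refl rewrite labelAt-here o v l | v≢0 =
    cong (v ∷_) (trans (cong (filterᵇ nonzeroᵇ) (tabulate-cong shift))
      (nonzeros-window N (suc o) l sorted
        (All.zipWith (λ {q′} (o<q , _ , q<N) → o<q , subst (q′ <_) (sym (+-suc N o)) q<N) (q< , bounds)) vs≢0))
    where
    shift : ∀ (p : Fin N) → labelAt ((o , v) ∷ l) (suc (toℕ p) + o) ≡ labelAt l (toℕ p + suc o)
    shift p = trans (labelAt-there v l (<⇒≢ (s≤s (m≤n+m o (toℕ p))))) (cong (labelAt l) (sym (+-suc (toℕ p) o)))
  ... | no o≢q rewrite labelAt-off ((q , v) ∷ l) {o}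
          (λ { (here eq) → o≢q eq ; (there o∈) → <-asym (All.lookup q< o∈) (≤∧≢⇒< o≤q o≢q) }) =
    trans (cong (filterᵇ nonzeroᵇ)
      (tabulate-cong (λ (p : Fin N) → cong (labelAt ((q , v) ∷ l)) (sym (+-suc (toℕ p) o)))))
      (nonzeros-window N (suc o) ((q , v) ∷ l) (q< ∷ sorted)
        ((≤∧≢⇒< o≤q o≢q , subst (q <_) (sym (+-suc N o)) q<o+N) ∷
         All.zipWith (λ {q′} (q<q′ , _ , q′<N) → ≤-trans (s≤s o≤q) q<q′ ,
           subst (q′ <_) (sym (+-suc N o)) q′<N) (q< , bounds))
        (v≢0 ∷ vs≢0))

  labelVec : (N : ℕ) → Label → Fin N → ℤ
  labelVec N l p = labelAt l (toℕ p)

  nonzeros-labelVec : ∀ N l → Sorted (positions l) → All (_< N) (positions l) → Balanced (entries l) →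
    nonzeros (labelVec N l) ≡ entries l
  nonzeros-labelVec N l sorted bound bal =
    trans (cong (filterᵇ nonzeroᵇ)
    (tabulate-cong (λ (p : Fin N) → cong (labelAt l) (sym (+-identityʳ (toℕ p))))))
    (nonzeros-window N 0 l sorted (All.map (λ {q} q<N → z≤n , subst (q <_) (sym (+-identityʳ N)) q<N) bound)
      (nonzero-entries bal))

  -- Reflection of positions and the parity of labels.

  module Mirror (N : ℕ) where

    mirror : ℕ → ℕ
    mirror p = N ∸ suc p

    mirror-involutive : ∀ {p} → p < N → mirror (mirror p) ≡ p
    mirror-involutive {p} p<N = begin
      N ∸ suc (N ∸ suc p)   ≡⟨ cong (N ∸_) (+-∸-assoc 1 p<N) ⟨
      N ∸ (N ∸ p)           ≡⟨ m∸[m∸n]≡n (<⇒≤ p<N) ⟩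
      p                     ∎
      where open ≡-Reasoning

    mirrored : Label → Label
    mirrored = map (map₁ mirror)

    labelAt-mirrored : ∀ l {p} → All (_< N) (positions l) → p < N →
      labelAt (mirrored l) p ≡ labelAt l (mirror p)
    labelAt-mirrored [] _ _ = refl
    labelAt-mirrored ((q , v) ∷ l) {p} (q<N ∷ bound) p<N with q ≟ mirror p
    ... | yes refl = trans (cong (λ z → labelAt ((z , v) ∷ mirrored l) p) (mirror-involutive p<N))
                       (trans (labelAt-here p v (mirrored l)) (sym (labelAt-here (mirror p) v l)))
    ... | no q≢ = trans (labelAt-there v (mirrored l)
      (λ eq → q≢ (trans (sym (mirror-involutive q<N)) (cong mirror eq))))
                    (trans (labelAt-mirrored l bound p<N) (sym (labelAt-there v l q≢)))

    -- Reflection reverses the order, so for an increasing list this expresses invariance of the set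
    -- of positions.
    Symmetric : List ℕ → Set
    Symmetric ps = map mirror ps ≡ reverse ps

    symmetric-upTo : Symmetric (upTo N)
    symmetric-upTo = begin
      map mirror (upTo N)    ≡⟨ map-upTo mirror N ⟩
      applyUpTo mirror N     ≡⟨ applyUpTo-∸ N ⟩
      downFrom N             ≡⟨ reverse-upTo N ⟨
      reverse (upTo N)       ∎
      where
      open ≡-Reasoning
      applyUpTo-∸ : ∀ M → applyUpTo (λ i → M ∸ suc i) M ≡ downFrom M
      applyUpTo-∸ zero = refl
      applyUpTo-∸ (suc M) = cong (M ∷_) (applyUpTo-∸ M)

    mirrored-zip : ∀ {ps} vs → Symmetric ps → length ps ≡ length vs →
      mirrored (zip ps vs) ≡ reverse (zip ps (reverse vs))
    mirrored-zip {ps} vs symm len = begin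
      mirrored (zip ps vs)                 ≡⟨ map₁-zip ps vs ⟩
      zip (map mirror ps) vs               ≡⟨ cong₂ zip symm (sym (reverse-involutive vs)) ⟩
      zip (reverse ps) (reverse (reverse vs))
        ≡⟨ zip-reverse ps (reverse vs) (trans len (sym (length-reverse vs))) ⟩
      reverse (zip ps (reverse vs))        ∎
      where
      open ≡-Reasoning
      map₁-zip : ∀ ps vs → mirrored (zip ps vs) ≡ zip (map mirror ps) vs
      map₁-zip [] vs = refl
      map₁-zip (p ∷ ps) [] = refl
      map₁-zip (p ∷ ps) (v ∷ vs) = cong ((mirror p , v) ∷_) (map₁-zip ps vs)

    -- On a symmetric support, reflecting the argument amounts to reversing the values; the parity
    -- of a label thereby becomes a property of its value list alone.
    labelAt-mirror : ∀ {ps} vs {p} → Sorted ps → All (_< N) ps → Symmetric ps → length ps ≡ length vs → p < N →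
      labelAt (zip ps vs) (mirror p) ≡ labelAt (zip ps (reverse vs)) p
    labelAt-mirror {ps} vs {p} sorted bound symm len p<N = begin
      labelAt (zip ps vs) (mirror p)
        ≡⟨ labelAt-mirrored (zip ps vs) (subst (All (_< N)) (sym (positions-zip len)) bound) p<N ⟨
      labelAt (mirrored (zip ps vs)) p             ≡⟨ cong (λ l → labelAt l p) (mirrored-zip vs symm len) ⟩
      labelAt (reverse (zip ps (reverse vs))) p
        ≡⟨ labelAt-reverse (zip ps (reverse vs)) p
          (subst Sorted (sym (positions-zip (trans len (sym (length-reverse vs))))) sorted) ⟩
      labelAt (zip ps (reverse vs)) p              ∎
      where
      open ≡-Reasoning
      labelAt-∈′ : ∀ l p → p ∈ positions l → (p , labelAt l p) ∈ l
      labelAt-∈′ ((q , v) ∷ l) p p∈ with q ≟ p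
      ... | yes refl = here (cong (q ,_) (labelAt-here q v l))
      labelAt-∈′ ((q , v) ∷ l) p (here refl) | no q≢p = contradiction refl q≢p
      labelAt-∈′ ((q , v) ∷ l) p (there p∈) | no q≢p =
        there (subst (λ w → (p , w) ∈ l) (sym (labelAt-there v l q≢p)) (labelAt-∈′ l p p∈))
      labelAt-reverse : ∀ l p → Sorted (positions l) → labelAt (reverse l) p ≡ labelAt l p
      labelAt-reverse l p sorted with p ∈? positions l
      ... | no p∉ = trans (labelAt-off (reverse l)
        (λ p∈ → p∉ (Any.reverse⁻ (subst (p ∈_) (reverse-map proj₁ l) p∈)))) (sym (labelAt-off l p∉))
      ... | yes p∈ = sym (labelAt-∈ sorted
        (Any.reverse⁻ (labelAt-∈′ (reverse l) p (subst (p ∈_) (sym (reverse-map proj₁ l)) (Any.reverse⁺ p∈)))))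

    -- Equal values sit at mirror positions, so any class selected by value is again symmetric. This
    -- passes the symmetry of the support on to both children.
    symmetric-filter : ∀ (Q : ℤ → Bool) {ps vs} → Symmetric ps → length ps ≡ length vs → reverse vs ≡ vs →
      Symmetric (map proj₁ (filterᵇ (Q ∘ proj₂) (zip ps vs)))
    symmetric-filter Q {ps} {vs} symm len rev = begin
      map mirror (map proj₁ (filterᵇ (Q ∘ proj₂) l))         ≡⟨ map-∘ (filterᵇ (Q ∘ proj₂) l) ⟨
      map (mirror ∘ proj₁) (filterᵇ (Q ∘ proj₂) l)           ≡⟨ map-∘ (filterᵇ (Q ∘ proj₂) l) ⟩
      map proj₁ (mirrored (filterᵇ (Q ∘ proj₂) l))
        ≡⟨ cong positions (filterᵇ-map (Q ∘ proj₂) (map₁ mirror) l) ⟨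
      map proj₁ (filterᵇ (Q ∘ proj₂) (mirrored l))
        ≡⟨ cong (λ k → positions (filterᵇ (Q ∘ proj₂) k))
          (trans (mirrored-zip vs symm len) (cong (λ us → reverse (zip ps us)) rev)) ⟩
      map proj₁ (filterᵇ (Q ∘ proj₂) (reverse l))            ≡⟨ cong positions (filterᵇ-reverse (Q ∘ proj₂) l) ⟩
      map proj₁ (reverse (filterᵇ (Q ∘ proj₂) l))            ≡⟨ reverse-map proj₁ (filterᵇ (Q ∘ proj₂) l) ⟩
      reverse (map proj₁ (filterᵇ (Q ∘ proj₂) l))            ∎
      where
      open ≡-Reasoning
      l = zip ps vs

    -- Each case also records data on the entries, which tie it to the Boolean test `skew`: the
    -- exact list in one case, length at least 3 in the other.
    data Parity (l : Label) : Set where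
      antisymmetric : entries l ≡ ℤ.+ 1 ∷ ℤ.-[1+ 0 ] ∷ [] →
        (∀ {p} → p < N → labelAt l (mirror p) ≡ ℤ.- labelAt l p) → Parity l
      symmetric : 3 ≤ length (entries l) → (∀ {p} → p < N → labelAt l (mirror p) ≡ labelAt l p) → Parity l

    record LabelShape (l : Label) : Set where
      field
        sorted   : Sorted (positions l)
        bound    : All (_< N) (positions l)
        balanced : Balanced (entries l)
        reflection : Parity l

    positives-bound : ∀ {l} → All (_< N) (positions l) → All (_< N) (positives l)
    positives-bound bound = All.map⁺ (All.filter⁺ (T? ∘ posᵇ ∘ proj₂) (All.map⁻ bound))

    negatives-bound : ∀ {l} → All (_< N) (positions l) → All (_< N) (negatives l)
    negatives-bound bound = All.map⁺ (All.filter⁺ (T? ∘ negᵇ ∘ proj₂) (All.map⁻ bound))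

    labelTree-shape : ∀ {ps ls} → LabelTree ps ls → Sorted ps → All (_< N) ps → Symmetric ps → All LabelShape ls
    labelTree-shape (leaf p) _ _ _ = []
    labelTree-shape {ps} (node {ls = ls} {rs} 2≤ l r) sorted bound sym-ps = shape (size {ps} 2≤) ∷ children
      (size {ps} 2≤)
      where
      lab = childLabel ps
      len : length ps ≡ length (wList (length ps))
      len = sym (length-wList (length ps))
      bound′ : All (_< N) (positions lab)
      bound′ = subst (All (_< N)) (sym (positions-childLabel ps)) bound
      par′ : Size ps → Parity lab
      par′ (two p q) = antisymmetric refl λ {i} i<N →
        trans (labelAt-mirror (ℤ.+ 1 ∷ ℤ.-[1+ 0 ] ∷ []) {i} sorted bound sym-ps refl i<N) (labelAt-neg p q i)
        where
        labelAt-neg : ∀ p q i → labelAt ((p , ℤ.-[1+ 0 ]) ∷ (q , ℤ.+ 1) ∷ []) i ≡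
          ℤ.- labelAt ((p , ℤ.+ 1) ∷ (q , ℤ.-[1+ 0 ]) ∷ []) i
        labelAt-neg p q i with p ℕ.≡ᵇ i | q ℕ.≡ᵇ i
        ... | true  | _     = refl
        ... | false | true  = refl
        ... | false | false = refl
      par′ (more 3≤) = symmetric (subst (3 ≤_) (sym (trans (cong length (entries-childLabel ps)) (sym len))) 3≤)
        λ {i} i<N → trans (labelAt-mirror (wList (length ps)) {i} sorted bound sym-ps len i<N)
          (cong (λ vs → labelAt (zip ps vs) i) (Palindromic.reversal (wList-palindromic 3≤)))
      shape : Size ps → LabelShape lab
      shape sz = record { sorted = childLabel-sorted sorted ; bound = bound′ ; balanced =
        balanced-childLabel ps 2≤ ; reflection = par′ sz }
      children : Size ps → All LabelShape (ls ++ rs)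
      -- The sign classes of `(1, -1)` are in general not symmetric, so symmetry cannot be passed
      -- down here; but there are no labels below.
      children (two p q) = subst (All LabelShape)
        (sym (cong₂ _++_ (labelTree-singleton l) (labelTree-singleton r))) []
      children (more 3≤) = All.++⁺
        (labelTree-shape l (positives-sorted {lab} (childLabel-sorted sorted)) (positives-bound {lab} bound′)
          (symmetric-filter posᵇ sym-ps len rev))
        (labelTree-shape r (negatives-sorted {lab} (childLabel-sorted sorted)) (negatives-bound {lab} bound′)
          (symmetric-filter negᵇ sym-ps len rev))
        where rev = Palindromic.reversal (wList-palindromic 3≤)

  -- The elements of U(N) by number, and the counts of skew and symmetric ones.

  oneTo-unique : ∀ m → AllPairs _≢_ (oneTo m)
  oneTo-unique m = AllPairs.map⁺ (AllPairs.applyUpTo⁺₁ id m (λ i<j _ eq → <⇒≢ i<j (suc-injective eq)))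

  -- Numbering starts at 1, so the indices `1, …, length xs` never meet the default `d`. Properties
  -- of the list of labels reach the numbered labels through this equation.
  map-nth1 : ∀ (d : A) xs → map (nth1 d xs) (oneTo (length xs)) ≡ xs
  map-nth1 d xs = trans (sym (map-∘ (upTo (length xs)))) (trans (map-upTo (nth1 d xs ∘ suc) (length xs))
    (go xs))
    where
    go : ∀ xs → applyUpTo (nth1 d xs ∘ suc) (length xs) ≡ xs
    go []       = refl
    go (x ∷ xs) = cong (x ∷_) (go xs)

  all-nth1 : ∀ {P : A → Set} d {xs} → All P xs → ∀ {i} → i ∈ oneTo (length xs) → P (nth1 d xs i)
  all-nth1 {P = P} d {xs} all i∈ = All.lookup (All.map⁻ (subst (All P) (sym (map-nth1 d xs)) all)) i∈

  allPairs-∈ : ∀ {R : A → A → Set} {xs} → (∀ {x y} → R x y → R y x) → AllPairs R xs →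
    ∀ {x y} → x ∈ xs → y ∈ xs → x ≢ y → R x y
  allPairs-∈ sym-R (r ∷ rs) (here refl) (here refl) x≢y = contradiction refl x≢y
  allPairs-∈ sym-R (r ∷ rs) (here refl) (there y∈) x≢y = All.lookup r y∈
  allPairs-∈ sym-R (r ∷ rs) (there x∈) (here refl) x≢y = sym-R (All.lookup r x∈)
  allPairs-∈ sym-R (r ∷ rs) (there x∈) (there y∈) x≢y = allPairs-∈ sym-R rs x∈ y∈ x≢y

  allPairs-nth1 : ∀ {R : A → A → Set} d {xs} → (∀ {x y} → R x y → R y x) → AllPairs R xs →
    ∀ {i j} → i ∈ oneTo (length xs) → j ∈ oneTo (length xs) → i ≢ j → R (nth1 d xs i) (nth1 d xs j)
  allPairs-nth1 {R = R} d {xs} sym-R pairs =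
    allPairs-∈ sym-R (AllPairs.map⁻ (subst (AllPairs R) (sym (map-nth1 d xs)) pairs))

  upTo-sorted : ∀ N → Sorted (upTo N)
  upTo-sorted N = AllPairs.applyUpTo⁺₁ id N (λ i<j _ → i<j)

  label : ℕ → ℕ → Label
  label N i = nth1 [] (ULabels N) i

  u : ℕ → ℕ → ℕ → ℚ
  u N i = entry (label N i)

  index⇒2≤ : ∀ {N i} → i ∈ oneTo (N ∸ 1) → 2 ≤ N
  index⇒2≤ {suc (suc N)} _ = s≤s (s≤s z≤n)

  length-ULabels : ∀ {N} → 2 ≤ N → length (ULabels N) ≡ N ∸ 1
  length-ULabels {N} 2≤N = cong (_∸ 1) (trans (labelTree-length (ULabels-tree 2≤N)) (length-upTo N))

  module _ {N : ℕ} (2≤N : 2 ≤ N) where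
    private
      T-labels = ULabels-tree 2≤N
      T-split  = labelTree-splitTree (upTo-sorted N) T-labels
      index : ∀ {i} → i ∈ oneTo (N ∸ 1) → i ∈ oneTo (length (ULabels N))
      index {i} = subst (λ m → i ∈ oneTo m) (sym (length-ULabels 2≤N))

    label-all : ∀ {P : Label → Set} → All P (ULabels N) → ∀ {i} → i ∈ oneTo (N ∸ 1) → P (label N i)
    label-all all i∈ = all-nth1 [] all (index i∈)

    label-∑≡0 : ∀ {i} → i ∈ oneTo (N ∸ 1) → ∑ (upTo N) (u N i) ≡ 0ℚ
    label-∑≡0 = label-all (All.map⁻ (tree-∑≡0 T-split))

    label-square≢0 : ∀ {i} → i ∈ oneTo (N ∸ 1) → ∑ (upTo N) (λ p → u N i p ℚ.* u N i p) ≢ 0ℚ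
    label-square≢0 = label-all (All.map⁻ (tree-square≢0 T-split))

    label-orthogonal : ∀ {i j} → i ∈ oneTo (N ∸ 1) → j ∈ oneTo (N ∸ 1) → i ≢ j →
      ∑ (upTo N) (λ p → u N i p ℚ.* u N j p) ≡ 0ℚ
    label-orthogonal i∈ j∈ = allPairs-nth1 []
      (λ {l} {m} eq → trans (∑-cong (upTo N) (λ {p} _ → ℚ.*-comm (entry m p) (entry l p))) eq)
      (AllPairs.map proj₂ (AllPairs.map⁻ (tree-orthogonal T-split))) (index i∈) (index j∈)

    label-complete : ∀ f → ∑ (upTo N) f ≡ 0ℚ →
      (∀ {i} → i ∈ oneTo (N ∸ 1) → ∑ (upTo N) (λ p → u N i p ℚ.* f p) ≡ 0ℚ) →
      ∀ {p} → p < N → f p ≡ 0ℚ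
    label-complete f sum≡0 orth p<N = tree-complete T-split f sum≡0
      (All.map⁺ (subst (All P) (map-nth1 [] (ULabels N))
        (All.map⁺ (All.tabulate λ {i} i∈ → orth (subst (λ m → i ∈ oneTo m) (length-ULabels 2≤N) i∈)))))
          (∈-upTo⁺ p<N)
      where
      P : Label → Set
      P l = ∑ (upTo N) (λ p → entry l p ℚ.* f p) ≡ 0ℚ

    label-shape : ∀ {i} → i ∈ oneTo (N ∸ 1) → Mirror.LabelShape N (label N i)
    label-shape = label-all (Mirror.labelTree-shape N T-labels (upTo-sorted N) (All.applyUpTo⁺₁ id N id)
      (Mirror.symmetric-upTo N))

  -- Reduces the square norm of a skew label to its two nonzero entries.
  labelTree-support : ∀ {ps ls} → Sorted ps → LabelTree ps ls →
    All (λ l → ∀ g → g vanishesOff positions l → ∑ ps g ≡ ∑ (positions l) g) ls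
  labelTree-support sorted (leaf p) = []
  labelTree-support {ps} sorted (node {ls = ls} {rs} 2≤ l r) =
    (λ g _ → cong (λ qs → ∑ qs g) (sym (positions-childLabel ps))) ∷ All.++⁺
      (All.zipWith (λ {m} (⊆pos , eq) g van → trans (∑-restrict-pos g (λ p p∉ → van p (λ p∈ → p∉ (⊆pos p∈))))
        (eq g van))
        (labelTree-⊆ l , labelTree-support (positives-sorted {childLabel ps} (childLabel-sorted sorted)) l))
      (All.zipWith (λ {m} (⊆neg , eq) g van → trans (∑-restrict-neg g (λ p p∉ → van p (λ p∈ → p∉ (⊆neg p∈))))
        (eq g van))
        (labelTree-⊆ r , labelTree-support (negatives-sorted {childLabel ps} (childLabel-sorted sorted)) r))
    where
    open Split (childLabel-split 2≤ sorted)
    labelTree-⊆ : ∀ {qs ks} → LabelTree qs ks → All (λ k → ∀ {p} → p ∈ positions k → p ∈ qs) ks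
    labelTree-⊆ (leaf p) = []
    labelTree-⊆ {qs} (node 2≤ l r) = (λ {p} p∈ → subst (p ∈_) (positions-childLabel qs) p∈) ∷ All.++⁺
      (All.map (λ ⊆pos {p} p∈ → filter-⊆ posᵇ (⊆pos p∈)) (labelTree-⊆ l))
      (All.map (λ ⊆neg {p} p∈ → filter-⊆ negᵇ (⊆neg p∈)) (labelTree-⊆ r))
      where
      filter-⊆ : ∀ Q {p} → p ∈ map proj₁ (filterᵇ (Q ∘ proj₂) (childLabel qs)) → p ∈ qs
      filter-⊆ Q p∈ with ∈-map⁻ proj₁ p∈
      ... | (p , v) , pv∈ , refl = subst (p ∈_) (positions-childLabel qs)
        (∈-map⁺ proj₁ (proj₁ (∈-filter⁻ (T? ∘ Q ∘ proj₂) {xs = childLabel qs} pv∈)))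

  module _ {N : ℕ} (2≤N : 2 ≤ N) where
    open Mirror N

    -- `skew` inspects the nonzero entries of the dense vector; for a sorted label without zero
    -- values inside the range these are its stored entries.
    skew-label : ∀ {i} → i ∈ oneTo (N ∸ 1) → skew N i ≡ isSkewLabel (label N i)
    skew-label {i} i∈ = cong isSkewᵇ (nonzeros-labelVec N (label N i) sorted bound balanced)
      where open LabelShape (label-shape 2≤N i∈)

    skew⇒short : ∀ {i} → i ∈ oneTo (N ∸ 1) → skew N i ≡ true → ¬ 3 ≤ length (entries (label N i))
    skew⇒short {i} i∈ isSkew 3≤ =
      case trans (trans (sym isSkew) (skew-label i∈)) (long-not-skew (entries (label N i)) 3≤) of λ ()

    skew-square : ∀ {i} → i ∈ oneTo (N ∸ 1) → skew N i ≡ true →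
      ∑ (upTo N) (λ p → u N i p ℚ.* u N i p) ≡ ℤ→ℚ (ℤ.+ 2)
    skew-square {i} i∈ isSkew with LabelShape.reflection (label-shape 2≤N i∈)
    ... | symmetric 3≤ _ = contradiction 3≤ (skew⇒short i∈ isSkew)
    ... | antisymmetric entries≡ _ = trans
      (label-all 2≤N (labelTree-support (upTo-sorted N) (ULabels-tree 2≤N)) i∈ (square (label N i))
        (λ p p∉ → cong (λ z → ℤ→ℚ z ℚ.* ℤ→ℚ z) (labelAt-off (label N i) p∉)))
      (go (label N i) entries≡ (LabelShape.sorted (label-shape 2≤N i∈)))
      where
      square : Label → ℕ → ℚ
      square l p = entry l p ℚ.* entry l p
      go : ∀ l → entries l ≡ ℤ.+ 1 ∷ ℤ.-[1+ 0 ] ∷ [] → Sorted (positions l) →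
        ∑ (positions l) (square l) ≡ ℤ→ℚ (ℤ.+ 2)
      go ((p , _) ∷ (q , _) ∷ []) refl sorted = begin
        ∑ (p ∷ q ∷ []) (square l)                   ≡⟨ ∑-∷ (square l) p (q ∷ []) ⟩
        square l p ℚ.+ ∑ (q ∷ []) (square l)        ≡⟨ cong (λ z → square l p ℚ.+ z) (∑-∷ (square l) q []) ⟩
        square l p ℚ.+ (square l q ℚ.+ ∑ [] (square l))
          ≡⟨ cong (λ z → square l p ℚ.+ (square l q ℚ.+ z)) (∑-[] (square l)) ⟩
        square l p ℚ.+ (square l q ℚ.+ 0ℚ)
          ≡⟨ cong₂ (λ x y → ℤ→ℚ x ℚ.* ℤ→ℚ x ℚ.+ (ℤ→ℚ y ℚ.* ℤ→ℚ y ℚ.+ 0ℚ)) (labelAt-∈ {l} sorted (here refl))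
            (labelAt-∈ {l} sorted (there (here refl))) ⟩
        ℤ→ℚ (ℤ.+ 2)                                 ∎
        where open ≡-Reasoning
              l = (p , ℤ.+ 1) ∷ (q , ℤ.-[1+ 0 ]) ∷ []

    skew-mirror : ∀ {i p} → i ∈ oneTo (N ∸ 1) → skew N i ≡ true → p < N → u N i (mirror p) ≡ ℚ.- u N i p
    skew-mirror {i} {p} i∈ isSkew p<N with LabelShape.reflection (label-shape 2≤N i∈)
    ... | symmetric 3≤ _ = contradiction 3≤ (skew⇒short i∈ isSkew)
    ... | antisymmetric _ anti = trans (cong ℤ→ℚ (anti p<N)) (ℤ→ℚ-neg (labelAt (label N i) p))

    sym-mirror : ∀ {i p} → i ∈ oneTo (N ∸ 1) → skew N i ≡ false → p < N → u N i (mirror p) ≡ u N i p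
    sym-mirror {i} {p} i∈ notSkew p<N with LabelShape.reflection (label-shape 2≤N i∈)
    ... | symmetric _ symm = cong ℤ→ℚ (symm p<N)
    ... | antisymmetric entries≡ _ = case trans (sym notSkew) (trans (skew-label i∈) (cong isSkewᵇ entries≡))
      of λ ()

    private
      filterᵇ-cong : ∀ {P Q : A → Bool} xs → (∀ {x} → x ∈ xs → P x ≡ Q x) → filterᵇ P xs ≡ filterᵇ Q xs
      filterᵇ-cong [] eq = refl
      filterᵇ-cong {P = P} {Q} (x ∷ xs) eq with P x | Q x | eq (here refl)
      ... | true  | _ | refl = cong (x ∷_) (filterᵇ-cong xs (λ x∈ → eq (there x∈)))
      ... | false | _ | refl = filterᵇ-cong xs (λ x∈ → eq (there x∈))

      n/2≡⌊n/2⌋ : ∀ m → m ND./ 2 ≡ ⌊ m /2⌋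
      n/2≡⌊n/2⌋ zero = refl
      n/2≡⌊n/2⌋ (suc zero) = refl
      n/2≡⌊n/2⌋ (suc (suc m)) = trans (ND.m/n≡1+[m∸n]/n {2 + m} {2} (s≤s (s≤s z≤n))) (cong suc (n/2≡⌊n/2⌋ m))

      filterᵇ-complement : ∀ (P : A → Bool) xs → length (filterᵇ P xs) + length (filterᵇ (not ∘ P) xs) ≡
        length xs
      filterᵇ-complement P [] = refl
      filterᵇ-complement P (x ∷ xs) with P x
      ... | true  = cong suc (filterᵇ-complement P xs)
      ... | false = trans (+-suc (length (filterᵇ P xs)) (length (filterᵇ (not ∘ P) xs)))
        (cong suc (filterᵇ-complement P xs))

      ⌊n/2⌋-skew : length (skewIdx N) ≡ ⌊ N /2⌋
      ⌊n/2⌋-skew = begin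
        length (filterᵇ (skew N) (oneTo (N ∸ 1)))
          ≡⟨ cong length (filterᵇ-cong (oneTo (N ∸ 1)) skew-label) ⟩
        length (filterᵇ (isSkewLabel ∘ label N) (oneTo (N ∸ 1)))
          ≡⟨ length-map (label N) (filterᵇ (isSkewLabel ∘ label N) (oneTo (N ∸ 1))) ⟨
        length (map (label N) (filterᵇ (isSkewLabel ∘ label N) (oneTo (N ∸ 1))))
          ≡⟨ cong length (filterᵇ-map isSkewLabel (label N) (oneTo (N ∸ 1))) ⟨
        length (filterᵇ isSkewLabel (map (label N) (oneTo (N ∸ 1))))
          ≡⟨ cong (λ m → length (filterᵇ isSkewLabel (map (label N) (oneTo m)))) (length-ULabels 2≤N) ⟨
        length (filterᵇ isSkewLabel (map (label N) (oneTo (length (ULabels N)))))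
          ≡⟨ cong (λ ls → length (filterᵇ isSkewLabel ls)) (map-nth1 [] (ULabels N)) ⟩
        length (filterᵇ isSkewLabel (ULabels N))                     ≡⟨ labelTree-#skew (ULabels-tree 2≤N) ⟩
        ⌊ length (upTo N) /2⌋                                        ≡⟨ cong ⌊_/2⌋ (length-upTo N) ⟩
        ⌊ N /2⌋ ∎
        where open ≡-Reasoning

    length-skewIdx : length (skewIdx N) ≡ k N
    length-skewIdx = trans ⌊n/2⌋-skew (sym (n/2≡⌊n/2⌋ N))

    length-symIdx : length (symIdx N) ≡ k' N
    length-symIdx = go N ⌊n/2⌋-skew (trans (filterᵇ-complement (skew N) (oneTo (N ∸ 1)))
      (trans (length-map suc (upTo (N ∸ 1))) (length-upTo (N ∸ 1)))) 2≤N
      where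
      go : ∀ M {s t} → s ≡ ⌊ M /2⌋ → s + t ≡ M ∸ 1 → 2 ≤ M → t ≡ k' M
      -- With `m = N − 1`, what remains of `m` after removing `⌊ suc m /2⌋`, which is `⌈ m /2⌉` by
      -- definition, is `⌊ m /2⌋`.
      go (suc m) {t = t} refl total _ = trans (+-cancelˡ-≡ ⌊ suc m /2⌋ t ⌊ m /2⌋
        (trans total (trans (sym (⌊n/2⌋+⌈n/2⌉≡n m)) (+-comm ⌊ m /2⌋ ⌊ suc m /2⌋)))) (sym (n/2≡⌊n/2⌋ m))

open Labels

-- Matrices, the dot product, and a criterion for orthogonal bases.

module Matrices where
  open import Data.Rational using (_+_; _*_; -_)
  open +-*-Solver

  sumFin-∑ : ∀ {m} (f : Fin m → ℚ) → sumFin f ≡ ∑ (allFin m) f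
  sumFin-∑ {zero} f = sym (∑-[] f)
  sumFin-∑ {suc m} f = begin
    f Fin.zero + sumFin (f ∘ Fin.suc)               ≡⟨ cong (f Fin.zero +_) (sumFin-∑ (f ∘ Fin.suc)) ⟩
    f Fin.zero + ∑ (allFin m) (f ∘ Fin.suc)         ≡⟨ cong (f Fin.zero +_) (∑-map Fin.suc f (allFin m)) ⟨
    f Fin.zero + ∑ (map Fin.suc (allFin m)) f
      ≡⟨ cong (λ is → f Fin.zero + ∑ is f) (map-tabulate id Fin.suc) ⟩
    f Fin.zero + ∑ (tabulate Fin.suc) f             ≡⟨ ∑-∷ f Fin.zero (tabulate Fin.suc) ⟨
    ∑ (allFin (suc m)) f                            ∎
    where open ≡-Reasoning

  allFin-unique : ∀ m → AllPairs _≢_ (allFin m)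
  allFin-unique m = AllPairs.tabulate⁺ id

  allPairs-lookup : ∀ {R : A → A → Set} {xs} → (∀ {x y} → R x y → R y x) → AllPairs R xs →
    ∀ s t → s ≢ t → R (lookup xs s) (lookup xs t)
  allPairs-lookup sym-R (r ∷ rs) Fin.zero Fin.zero s≢t = contradiction refl s≢t
  allPairs-lookup sym-R (r ∷ rs) Fin.zero (Fin.suc t) s≢t = All.lookup r (∈-lookup t)
  allPairs-lookup sym-R (r ∷ rs) (Fin.suc s) Fin.zero s≢t = sym-R (All.lookup r (∈-lookup s))
  allPairs-lookup sym-R (r ∷ rs) (Fin.suc s) (Fin.suc t) s≢t = allPairs-lookup sym-R rs s t (s≢t ∘ cong Fin.suc)

  -- Extended by 0 at 0, so that coefficients can be written down before a norm is known to be
  -- nonzero.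
  recip : ℚ → ℚ
  recip x with x ℚ.≟ 0ℚ
  ... | yes _   = 0ℚ
  ... | no  x≢0 = ℚ.1/_ x {{ℚ.≢-nonZero x≢0}}

  recip-inverse : ∀ {x} → x ≢ 0ℚ → recip x * x ≡ 1ℚ
  recip-inverse {x} x≢0 with x ℚ.≟ 0ℚ
  ... | yes x≡0  = contradiction x≡0 x≢0
  ... | no  x≢0′ = ℚ.*-inverseˡ x {{ℚ.≢-nonZero x≢0′}}

  x-y≡0 : ∀ {x y} → x ≡ y → x + - y ≡ 0ℚ
  x-y≡0 {x} refl = ℚ.+-inverseʳ x

  module _ {n : ℕ} where
    private F = allFin n

    infix 8 _∙_
    _∙_ : Mat n → Mat n → ℚ
    x ∙ y = ∑ F (λ a → ∑ F (λ b → x a b * y a b))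

    dot-∙ : ∀ x y → dot x y ≡ x ∙ y
    dot-∙ x y = trans (sumFin-∑ (λ a → sumFin (λ b → x a b * y a b)))
      (∑-cong F (λ {a} _ → sumFin-∑ (λ b → x a b * y a b)))

    ∙-cong : ∀ {x x′ y y′} → (∀ a b → x a b ≡ x′ a b) → (∀ a b → y a b ≡ y′ a b) → x ∙ y ≡ x′ ∙ y′
    ∙-cong eq eq′ = ∑-cong F (λ {a} _ → ∑-cong F (λ {b} _ → cong₂ _*_ (eq a b) (eq′ a b)))

    ∙-comm : ∀ x y → x ∙ y ≡ y ∙ x
    ∙-comm x y = ∑-cong F (λ {a} _ → ∑-cong F (λ {b} _ → ℚ.*-comm (x a b) (y a b)))

    comb : List A → (A → ℚ) → (A → Mat n) → Mat n
    comb ts c m a b = ∑ ts (λ t → c t * m t a b)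

    lincomb-comb : ∀ bs (c : Fin (length bs) → ℚ) a b →
      lincomb bs c a b ≡ comb (allFin (length bs)) c (lookup bs) a b
    lincomb-comb bs c a b = sumFin-∑ (λ t → c t * lookup bs t a b)

    comb-∙ : ∀ (ts : List A) c m y → comb ts c m ∙ y ≡ ∑ ts (λ t → c t * (m t ∙ y))
    comb-∙ ts c m y = begin
      ∑ F (λ a → ∑ F (λ b → ∑ ts (λ t → c t * m t a b) * y a b))
        ≡⟨ ∑-cong F (λ {a} _ → ∑-cong F (λ {b} _ → trans (sym (∑-*ʳ (y a b) (λ t → c t * m t a b) ts))
             (∑-cong ts (λ {t} _ → ℚ.*-assoc (c t) (m t a b) (y a b))))) ⟩
      ∑ F (λ a → ∑ F (λ b → ∑ ts (λ t → c t * (m t a b * y a b))))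
        ≡⟨ ∑-cong F (λ {a} _ → ∑-swap (λ b t → c t * (m t a b * y a b)) F ts) ⟩
      ∑ F (λ a → ∑ ts (λ t → ∑ F (λ b → c t * (m t a b * y a b))))
        ≡⟨ ∑-swap (λ a t → ∑ F (λ b → c t * (m t a b * y a b))) F ts ⟩
      ∑ ts (λ t → ∑ F (λ a → ∑ F (λ b → c t * (m t a b * y a b))))
        ≡⟨ ∑-cong ts (λ {t} _ → trans (∑-cong F (λ {a} _ → ∑-*ˡ (c t) (λ b → m t a b * y a b) F))
             (∑-*ˡ (c t) (λ a → ∑ F (λ b → m t a b * y a b)) F)) ⟩
      ∑ ts (λ t → c t * (m t ∙ y)) ∎
      where open ≡-Reasoning

    -- All the conditions defining V̄ₙ are sums of entries along a path a ↦ (f a , g a).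
    line : (f g : Fin n → Fin n) → Mat n → ℚ
    line f g x = ∑ F (λ t → x (f t) (g t))

    line-comb : ∀ f g (ts : List A) c m → line f g (comb ts c m) ≡ ∑ ts (λ t → c t * line f g (m t))
    line-comb f g ts c m = trans (∑-swap (λ p t → c t * m t (f p) (g p)) F ts)
      (∑-cong ts (λ {t} _ → ∑-*ˡ (c t) (λ p → m t (f p) (g p)) F))

    _⊝_ : Mat n → Mat n → Mat n
    (x ⊝ y) a b = x a b + - y a b

    line-⊝ : ∀ f g x y → line f g (x ⊝ y) ≡ line f g x + - line f g y
    line-⊝ f g x y = trans (∑-+ (λ t → x (f t) (g t)) (λ t → - y (f t) (g t)) F)
      (cong (line f g x +_) (∑-neg (λ t → y (f t) (g t)) F))

    ⊝-∙ : ∀ x y z → (x ⊝ y) ∙ z ≡ x ∙ z + - (y ∙ z)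
    ⊝-∙ x y z = begin
      ∑ F (λ a → ∑ F (λ b → (x a b + - y a b) * z a b))
        ≡⟨ ∑-cong F (λ {a} _ → trans (∑-cong F (λ {b} _ → trans (ℚ.*-distribʳ-+ (z a b) (x a b) (- y a b))
             (cong (x a b * z a b +_) (sym (ℚ.neg-distribˡ-* (y a b) (z a b))))))
             (trans (∑-+ (λ b → x a b * z a b) (λ b → - (y a b * z a b)) F)
               (cong (∑ F (λ b → x a b * z a b) +_) (∑-neg (λ b → y a b * z a b) F)))) ⟩
      ∑ F (λ a → ∑ F (λ b → x a b * z a b) + - ∑ F (λ b → y a b * z a b))
        ≡⟨ ∑-+ (λ a → ∑ F (λ b → x a b * z a b)) (λ a → - ∑ F (λ b → y a b * z a b)) F ⟩
      x ∙ z + ∑ F (λ a → - ∑ F (λ b → y a b * z a b))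
        ≡⟨ cong (x ∙ z +_) (∑-neg (λ a → ∑ F (λ b → y a b * z a b)) F) ⟩
      x ∙ z + - (y ∙ z) ∎
      where open ≡-Reasoning

    ⊝≡0⇒≡ : ∀ x y a b → (x ⊝ y) a b ≡ 0ℚ → x a b ≡ y a b
    ⊝≡0⇒≡ x y a b eq = trans (solve 2 (λ p q → p := (p :+ :- q) :+ q) refl (x a b) (y a b))
      (trans (cong (_+ y a b) eq) (ℚ.+-identityˡ (y a b)))

    data VbarLine : (f g : Fin n → Fin n) → Set where
      row  : ∀ a → VbarLine (const a) id
      col  : ∀ b → VbarLine id (const b)
      diag : VbarLine id id
      anti : VbarLine id opposite

    InVbar⇒line : ∀ {x} → InVbar n x → ∀ {f g} → VbarLine f g → line f g x ≡ 0ℚ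
    InVbar⇒line {x} x∈ (row a) = trans (sym (sumFin-∑ (λ b → x a b))) (InVbar.rowSums x∈ a)
    InVbar⇒line {x} x∈ (col b) = trans (sym (sumFin-∑ (λ a → x a b))) (InVbar.colSums x∈ b)
    InVbar⇒line {x} x∈ diag    = trans (sym (sumFin-∑ (λ a → x a a))) (InVbar.diagSum x∈)
    InVbar⇒line {x} x∈ anti    = trans (sym (sumFin-∑ (λ a → x a (opposite a)))) (InVbar.antiDiagSum x∈)

    line⇒InVbar : ∀ {x} → (∀ {f g} → VbarLine f g → line f g x ≡ 0ℚ) → InVbar n x
    line⇒InVbar {x} eq = record
      { rowSums     = λ a → trans (sumFin-∑ (λ b → x a b)) (eq (row a))
      ; colSums     = λ b → trans (sumFin-∑ (λ a → x a b)) (eq (col b))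
      ; diagSum     = trans (sumFin-∑ (λ a → x a a)) (eq diag)
      ; antiDiagSum = trans (sumFin-∑ (λ a → x a (opposite a))) (eq anti)
      }

    -- The coefficients of x are c t = (x ∙ bₜ) / (bₜ ∙ bₜ); the remainder is orthogonal to every bₜ.
    orthogonal-complete⇒basis : ∀ bs → All (InVbar n) bs → AllPairs (λ x y → x ∙ y ≡ 0ℚ) bs →
      All (λ x → x ∙ x ≢ 0ℚ) bs →
      (∀ x → InVbar n x → All (λ y → x ∙ y ≡ 0ℚ) bs → ∀ a b → x a b ≡ 0ℚ) → IsOrthogonalBasisVbar n bs
    orthogonal-complete⇒basis bs mem orth nz compl = record
      { members     = members
      ; orthogonal  = λ s t s≢t → trans (dot-∙ (b s) (b t)) (b-orth s t s≢t)
      ; independent = λ c c≡0 t → *-cancel-zero (b≢0 t) (begin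
          b t ∙ b t * c t             ≡⟨ ℚ.*-comm (b t ∙ b t) (c t) ⟩
          c t * (b t ∙ b t)           ≡⟨ comb-b c t ⟨
          comb ts c b ∙ b t           ≡⟨ ∑-zero F (λ {p} _ → ∑-zero F (λ {q} _ →
                                           *-zeroˡ′ (comb ts c b p q) (b t p q)
                                             (trans (sym (lincomb-comb bs c p q)) (c≡0 p q)))) ⟩
          0ℚ                          ∎)
      ; spanning    = λ x x∈ → coeff x ,
        λ p q → trans (⊝≡0⇒≡ x (comb ts (coeff x) b) p q (remainder≡0 x x∈ p q))
        (sym (lincomb-comb bs (coeff x) p q))
      }
      where
      open ≡-Reasoning
      ts = allFin (length bs)
      b : Fin (length bs) → Mat n
      b = lookup bs
      members : ∀ t → InVbar n (b t)
      members t = All.lookup mem (∈-lookup t)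
      b≢0 : ∀ t → b t ∙ b t ≢ 0ℚ
      b≢0 t = All.lookup nz (∈-lookup t)
      b-orth : ∀ s t → s ≢ t → b s ∙ b t ≡ 0ℚ
      b-orth = allPairs-lookup (λ {x} {y} eq → trans (∙-comm y x) eq) orth
      comb-b : ∀ c t → comb ts c b ∙ b t ≡ c t * (b t ∙ b t)
      comb-b c t = trans (comb-∙ ts c b (b t))
        (∑-single {f = λ s → c s * (b s ∙ b t)} (allFin-unique (length bs)) (∈-allFin t)
        (λ {s} _ t≢s → *-zeroʳ′ (c s) (b s ∙ b t) (b-orth s t (t≢s ∘ sym))))
      coeff : Mat n → Fin (length bs) → ℚ
      coeff x t = (x ∙ b t) * recip (b t ∙ b t)
      remainder≡0 : ∀ x → InVbar n x → ∀ p q → (x ⊝ comb ts (coeff x) b) p q ≡ 0ℚ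
      remainder≡0 x x∈ = compl (x ⊝ comb ts (coeff x) b)
        (line⇒InVbar (λ {f} {g} l → trans (line-⊝ f g x (comb ts (coeff x) b)) (x-y≡0 (trans (InVbar⇒line x∈ l)
          (sym (trans (line-comb f g ts (coeff x) b)
            (∑-zero ts (λ {t} _ → *-zeroʳ′ (coeff x t) (line f g (b t)) (InVbar⇒line (members t) l)))))))))
        (subst (All (λ y → (x ⊝ comb ts (coeff x) b) ∙ y ≡ 0ℚ)) (tabulate-lookup bs) (All.tabulate⁺ (λ t →
          trans (⊝-∙ x (comb ts (coeff x) b) (b t)) (x-y≡0 (sym (begin
            comb ts (coeff x) b ∙ b t                          ≡⟨ comb-b (coeff x) t ⟩
            (x ∙ b t) * recip (b t ∙ b t) * (b t ∙ b t)
              ≡⟨ ℚ.*-assoc (x ∙ b t) (recip (b t ∙ b t)) (b t ∙ b t) ⟩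
            (x ∙ b t) * (recip (b t ∙ b t) * (b t ∙ b t))      ≡⟨ cong ((x ∙ b t) *_) (recip-inverse (b≢0 t)) ⟩
            (x ∙ b t) * 1ℚ                                     ≡⟨ ℚ.*-identityʳ (x ∙ b t) ⟩
            x ∙ b t                                            ∎))))))

  ∑-upTo-allFin : ∀ N (g : ℕ → ℚ) → ∑ (upTo N) g ≡ ∑ (allFin N) (λ p → g (toℕ p))
  ∑-upTo-allFin N g = trans (cong (λ is → ∑ is g) (trans (upTo-tabulate id N) (sym (map-tabulate id toℕ))))
    (∑-map toℕ g (allFin N))
    where
    upTo-tabulate : ∀ (f : ℕ → ℕ) N → applyUpTo f N ≡ tabulate {n = N} (f ∘ toℕ)
    upTo-tabulate f zero    = refl
    upTo-tabulate f (suc N) = cong (f 0 ∷_) (upTo-tabulate (f ∘ suc) N)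

  -- Trees live on natural positions and matrices on `Fin n`; the padding by 0 lies outside
  -- `upTo N`.
  extend : ∀ {N} → (Fin N → ℚ) → ℕ → ℚ
  extend {zero} f p = 0ℚ
  extend {suc N} f zero = f Fin.zero
  extend {suc N} f (suc p) = extend (f ∘ Fin.suc) p

  extend-toℕ : ∀ {N} (f : Fin N → ℚ) p → extend f (toℕ p) ≡ f p
  extend-toℕ f Fin.zero = refl
  extend-toℕ f (Fin.suc p) = extend-toℕ (f ∘ Fin.suc) p

  -- The coefficients u^{K;i}_{(j)} in x̄ⁱ and ȳⁱ are numbered from j = 1, the positions of a label from 0.
  e : ℕ → ℕ → ℕ → ℚ
  e K i j = u K i (j ℕ.∸ 1)

  ∑-oneTo : ∀ K (g : ℕ → ℚ) → ∑ (oneTo K) g ≡ ∑ (upTo K) (λ p → g (suc p))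
  ∑-oneTo K g = ∑-map suc g (upTo K)

  e-∑≡0 : ∀ {K i} → i ∈ oneTo (K ℕ.∸ 1) → ∑ (oneTo K) (e K i) ≡ 0ℚ
  e-∑≡0 {K} {i} i∈ = trans (∑-oneTo K (e K i)) (label-∑≡0 (index⇒2≤ i∈) i∈)

  e-square≢0 : ∀ {K i} → i ∈ oneTo (K ℕ.∸ 1) → ∑ (oneTo K) (λ j → e K i j * e K i j) ≢ 0ℚ
  e-square≢0 {K} {i} i∈ eq = label-square≢0 (index⇒2≤ i∈) i∈
    (trans (sym (∑-oneTo K (λ j → e K i j * e K i j))) eq)

  e-orthogonal : ∀ {K i i′} → i ∈ oneTo (K ℕ.∸ 1) → i′ ∈ oneTo (K ℕ.∸ 1) → i ≢ i′ →
    ∑ (oneTo K) (λ j → e K i j * e K i′ j) ≡ 0ℚ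
  e-orthogonal {K} {i} {i′} i∈ i′∈ i≢i′ = trans (∑-oneTo K (λ j → e K i j * e K i′ j))
    (label-orthogonal (index⇒2≤ i∈) i∈ i′∈ i≢i′)

  e-complete : ∀ K f → ∑ (oneTo K) f ≡ 0ℚ →
    (∀ {i} → i ∈ oneTo (K ℕ.∸ 1) → ∑ (oneTo K) (λ j → e K i j * f j) ≡ 0ℚ) →
    ∀ {j} → j ∈ oneTo K → f j ≡ 0ℚ
  -- For `K = 1` there are no vectors to test against, and the vanishing sum is itself the claim.
  e-complete (suc zero) f sum≡0 orth (here refl) =
    trans (sym (trans (∑-∷ f 1 []) (trans (cong (f 1 +_) (∑-[] f)) (ℚ.+-identityʳ (f 1))))) sum≡0
  e-complete K@(suc (suc _)) f sum≡0 orth j∈ with ∈-map⁻ suc j∈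
  ... | p , p∈ , refl = label-complete (ℕ.s≤s (ℕ.s≤s ℕ.z≤n)) (λ p → f (suc p)) (trans (sym (∑-oneTo K f)) sum≡0)
        (λ {i} i∈ → trans (sym (∑-oneTo K (λ j → e K i j * f j))) (orth i∈)) (∈-upTo⁻ p∈)

  -- Outer products of the tree vectors, and the matrices orthogonal to the mixed ones.

  module Construction {n : ℕ} (2≤n : 2 ℕ.≤ n) where
    open Mirror n using (mirror)
    F = allFin n
    I = oneTo (n ℕ.∸ 1)

    v : ℕ → Fin n → ℚ
    v i p = u n i (toℕ p)

    ⟪_,_⟫ : (Fin n → ℚ) → (Fin n → ℚ) → ℚ
    ⟪ f , g ⟫ = ∑ F (λ p → f p * g p)

    -- The eigenvalue of `v i` under reflection of positions. It is the factor between antidiagonal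
    -- sum and trace.
    ε : ℕ → ℚ
    ε i = if skew n i then - 1ℚ else 1ℚ

    v-∑≡0 : ∀ {i} → i ∈ I → ∑ F (v i) ≡ 0ℚ
    v-∑≡0 {i} i∈ = trans (sym (∑-upTo-allFin n (u n i))) (label-∑≡0 2≤n i∈)

    v-square≢0 : ∀ {i} → i ∈ I → ⟪ v i , v i ⟫ ≢ 0ℚ
    v-square≢0 {i} i∈ eq = label-square≢0 2≤n i∈ (trans (∑-upTo-allFin n (λ p → u n i p * u n i p)) eq)

    v-orthogonal : ∀ {i j} → i ∈ I → j ∈ I → i ≢ j → ⟪ v i , v j ⟫ ≡ 0ℚ
    v-orthogonal {i} {j} i∈ j∈ i≢j = trans (sym (∑-upTo-allFin n (λ p → u n i p * u n j p)))
      (label-orthogonal 2≤n i∈ j∈ i≢j)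

    v-complete : ∀ f → ∑ F f ≡ 0ℚ → (∀ {i} → i ∈ I → ⟪ v i , f ⟫ ≡ 0ℚ) → ∀ p → f p ≡ 0ℚ
    v-complete f sum≡0 orth p = trans (sym (extend-toℕ f p)) (label-complete 2≤n (extend f)
      (trans (∑-upTo-allFin n (extend f)) (trans (∑-cong F (λ {q} _ → extend-toℕ f q)) sum≡0))
      (λ {i} i∈ → trans (∑-upTo-allFin n (λ q → u n i q * extend f q))
        (trans (∑-cong F (λ {q} _ → cong (v i q *_) (extend-toℕ f q))) (orth i∈)))
      (Fin.toℕ<n p))

    v-opposite : ∀ {i} → i ∈ I → ∀ p → v i (opposite p) ≡ ε i * v i p
    v-opposite {i} i∈ p = trans (cong (u n i) (Fin.opposite-prop p)) (go (skew n i) refl)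
      where
      go : ∀ s → skew n i ≡ s → u n i (mirror (toℕ p)) ≡ (if s then - 1ℚ else 1ℚ) * v i p
      go true  eq = trans (skew-mirror 2≤n i∈ eq (Fin.toℕ<n p))
        (solve 1 (λ x → :- x := (:- con 1ℚ) :* x) refl (v i p))
      go false eq = trans (sym-mirror 2≤n i∈ eq (Fin.toℕ<n p)) (sym (ℚ.*-identityˡ (v i p)))

    infix 9 _⊗_
    _⊗_ : ℕ → ℕ → Mat n
    (i ⊗ j) a b = v i a * v j b

    ⊗-∙ : ∀ i j i′ j′ → (i ⊗ j) ∙ (i′ ⊗ j′) ≡ ⟪ v i , v i′ ⟫ * ⟪ v j , v j′ ⟫
    ⊗-∙ i j i′ j′ = trans
      (∑-cong F (λ {a} _ → ∑-cong F (λ {b} _ → solve 4 (λ x y z w → (x :* y) :* (z :* w) :=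
        (x :* z) :* (y :* w)) refl (v i a) (v j b) (v i′ a) (v j′ b))))
      (∑-* (λ a → v i a * v i′ a) (λ b → v j b * v j′ b) F F)

    ⊗-row : ∀ {i j} → j ∈ I → ∀ a → line (const a) id (i ⊗ j) ≡ 0ℚ
    ⊗-row {i} {j} j∈ a = trans (∑-*ˡ (v i a) (v j) F) (*-zeroʳ′ (v i a) (∑ F (v j)) (v-∑≡0 j∈))

    ⊗-col : ∀ {i j} → i ∈ I → ∀ b → line id (const b) (i ⊗ j) ≡ 0ℚ
    ⊗-col {i} {j} i∈ b = trans (∑-*ʳ (v j b) (v i) F) (*-zeroˡ′ (∑ F (v i)) (v j b) (v-∑≡0 i∈))

    ⊗-anti : ∀ {i j} → j ∈ I → line id opposite (i ⊗ j) ≡ ε j * ⟪ v i , v j ⟫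
    ⊗-anti {i} {j} j∈ = trans (∑-cong F (λ {a} _ → trans (cong (v i a *_) (v-opposite j∈ a))
      (solve 3 (λ x y z → x :* (y :* z) := y :* (x :* z)) refl (v i a) (ε j) (v j a))))
      (∑-*ˡ (ε j) (λ a → v i a * v j a) F)

    ⊗-InVbar : ∀ {i j} → i ∈ I → j ∈ I → i ≢ j → InVbar n (i ⊗ j)
    ⊗-InVbar {i} {j} i∈ j∈ i≢j = line⇒InVbar go
      where
      go : ∀ {f g} → VbarLine f g → line f g (i ⊗ j) ≡ 0ℚ
      go (row a) = ⊗-row {i} j∈ a
      go (col b) = ⊗-col {j = j} i∈ b
      go diag    = v-orthogonal i∈ j∈ i≢j
      go anti    = trans (⊗-anti {i} j∈) (*-zeroʳ′ (ε j) ⟪ v i , v j ⟫ (v-orthogonal i∈ j∈ i≢j))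

    -- One factor is removed at a time. For fixed `j` the function `a ↦ ⟨xₐ, vʲ⟩` has sum zero by
    -- the column sums and is orthogonal to every `vⁱ`, so it vanishes; then each row `xₐ` has sum
    -- zero and is orthogonal to every `vʲ`.
    ⊗-complete : ∀ x → (∀ a → line (const a) id x ≡ 0ℚ) → (∀ b → line id (const b) x ≡ 0ℚ) →
      (∀ {i j} → i ∈ I → j ∈ I → x ∙ (i ⊗ j) ≡ 0ℚ) → ∀ a b → x a b ≡ 0ℚ
    ⊗-complete x rows cols orth a = v-complete (x a) (rows a) λ {j} j∈ →
      trans (∑-cong F (λ {b} _ → ℚ.*-comm (v j b) (x a b))) (contracted j j∈ a)
      where
      w : ℕ → Fin n → ℚ
      w j a = ∑ F (λ b → x a b * v j b)
      contracted : ∀ j → j ∈ I → ∀ a → w j a ≡ 0ℚ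
      contracted j j∈ = v-complete (w j)
        (trans (∑-swap (λ a b → x a b * v j b) F F)
          (∑-zero F (λ {b} _ → trans (∑-*ʳ (v j b) (λ a → x a b) F)
          (*-zeroˡ′ (line id (const b) x) (v j b) (cols b)))))
        (λ {i} i∈ → trans (∑-cong F (λ {a} _ → trans (sym (∑-*ˡ (v i a) (λ b → x a b * v j b) F))
            (∑-cong F (λ {b} _ → solve 3 (λ p q r → p :* (q :* r) := q :* (p :* r)) refl (v i a) (x a b)
              (v j b)))))
          (orth i∈ j∈))

    module _ (x : Mat n) (x∈ : InVbar n x) (off-diagonal : ∀ {i j} → i ∈ I → j ∈ I → i ≢ j →
      x ∙ (i ⊗ j) ≡ 0ℚ) where

      -- x = Σᵢ dᵢ (vⁱ ⊗ vⁱ) forces dᵢ = x ∙ (vⁱ ⊗ vⁱ) / |vⁱ|⁴.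
      weight : ℕ → ℚ
      weight i = x ∙ (i ⊗ i) * (recip ⟪ v i , v i ⟫ * recip ⟪ v i , v i ⟫)

      weight-square : ∀ {i} → i ∈ I → weight i * (⟪ v i , v i ⟫ * ⟪ v i , v i ⟫) ≡ x ∙ (i ⊗ i)
      weight-square {i} i∈ = begin
        m * (r * r) * (s * s)
          ≡⟨ solve 3 (λ m r s → m :* (r :* r) :* (s :* s) := m :* ((r :* s) :* (r :* s))) refl m r s ⟩
        m * ((r * s) * (r * s))   ≡⟨ cong (λ z → m * (z * z)) (recip-inverse (v-square≢0 i∈)) ⟩
        m * (1ℚ * 1ℚ)             ≡⟨ ℚ.*-identityʳ m ⟩
        m                         ∎
        where
        open ≡-Reasoning
        m = x ∙ (i ⊗ i)
        r = recip ⟪ v i , v i ⟫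
        s = ⟪ v i , v i ⟫

      diagonal : Mat n
      diagonal = comb I weight (λ i → i ⊗ i)

      -- Of the sum only the term at `i` survives. For `i = j` the normalisation of `weight` gives
      -- the value; for `i ≢ j` both sides are zero, the right one by `off-diagonal`.
      diagonal-∙ : ∀ {i j} → i ∈ I → j ∈ I → diagonal ∙ (i ⊗ j) ≡ x ∙ (i ⊗ j)
      diagonal-∙ {i} {j} i∈ j∈ = trans (comb-∙ I weight (λ t → t ⊗ t) (i ⊗ j)) (trans
        (∑-single {f = λ t → weight t * ((t ⊗ t) ∙ (i ⊗ j))} (oneTo-unique (n ℕ.∸ 1)) i∈
          (λ {t} t∈ i≢t → *-zeroʳ′ (weight t) ((t ⊗ t) ∙ (i ⊗ j))
          (trans (⊗-∙ t t i j) (*-zeroˡ′ ⟪ v t , v i ⟫ ⟪ v t , v j ⟫ (v-orthogonal t∈ i∈ (i≢t ∘ sym))))))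
        (go (i ℕ.≟ j)))
        where
        go : Dec (i ≡ j) → weight i * ((i ⊗ i) ∙ (i ⊗ j)) ≡ x ∙ (i ⊗ j)
        go (yes refl) = trans (cong (weight i *_) (⊗-∙ i i i i)) (weight-square i∈)
        go (no i≢j)   = trans (*-zeroʳ′ (weight i) ((i ⊗ i) ∙ (i ⊗ j))
          (trans (⊗-∙ i i i j) (*-zeroʳ′ ⟪ v i , v i ⟫ ⟪ v i , v j ⟫ (v-orthogonal i∈ j∈ i≢j))))
                          (sym (off-diagonal i∈ j∈ i≢j))

      -- The difference has vanishing row and column sums and is orthogonal to every `i ⊗ j`. The
      -- two diagonal conditions on `x` are saved for the equations on the weights.
      x≡diagonal : ∀ a b → x a b ≡ diagonal a b
      x≡diagonal a b = ⊝≡0⇒≡ x diagonal a b (⊗-complete (x ⊝ diagonal)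
        (λ a → trans (line-⊝ (const a) id x diagonal)
          (x-y≡0 (trans (InVbar⇒line x∈ (row a)) (sym (trans (line-comb (const a) id I weight (λ i → i ⊗ i))
          (∑-zero I (λ {i} i∈ → *-zeroʳ′ (weight i) (line (const a) id (i ⊗ i)) (⊗-row {i} i∈ a))))))))
        (λ b → trans (line-⊝ id (const b) x diagonal)
          (x-y≡0 (trans (InVbar⇒line x∈ (col b)) (sym (trans (line-comb id (const b) I weight (λ i → i ⊗ i))
          (∑-zero I (λ {i} i∈ → *-zeroʳ′ (weight i) (line id (const b) (i ⊗ i)) (⊗-col {j = i} i∈ b))))))))
        (λ {i} {j} i∈ j∈ → trans (⊝-∙ x diagonal (i ⊗ j)) (x-y≡0 (sym (diagonal-∙ i∈ j∈)))) a b)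

      trace≡0 : ∑ I (λ i → weight i * ⟪ v i , v i ⟫) ≡ 0ℚ
      trace≡0 = begin
        ∑ I (λ i → weight i * line id id (i ⊗ i))  ≡⟨ line-comb id id I weight (λ i → i ⊗ i) ⟨
        line id id diagonal                        ≡⟨ ∑-cong F (λ {a} _ → x≡diagonal a a) ⟨
        line id id x                               ≡⟨ InVbar⇒line x∈ diag ⟩
        0ℚ                                         ∎
        where open ≡-Reasoning

      antitrace≡0 : ∑ I (λ i → ε i * (weight i * ⟪ v i , v i ⟫)) ≡ 0ℚ
      antitrace≡0 = begin
        ∑ I (λ i → ε i * (weight i * ⟪ v i , v i ⟫))
          ≡⟨ ∑-cong I (λ {i} i∈ → trans (solve 3 (λ x y z → x :* (y :* z) := y :* (x :* z)) refl (ε i)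
            (weight i) ⟪ v i , v i ⟫) (cong (weight i *_) (sym (⊗-anti {i} i∈)))) ⟩
        ∑ I (λ i → weight i * line id opposite (i ⊗ i)) ≡⟨ line-comb id opposite I weight (λ i → i ⊗ i) ⟨
        line id opposite diagonal                  ≡⟨ ∑-cong F (λ {a} _ → x≡diagonal a (opposite a)) ⟨
        line id opposite x                         ≡⟨ InVbar⇒line x∈ anti ⟩
        0ℚ                                         ∎
        where open ≡-Reasoning

      -- With `s` and `t` the two sums, the trace gives `s + t = 0` and the antitrace `−s + t = 0`;
      -- subtracting, `2s = 0`.
      skew-weights : ∑ (skewIdx n) (λ i → weight i * ⟪ v i , v i ⟫) ≡ 0ℚ × ∑ (symIdx n) (λ i →
        weight i * ⟪ v i , v i ⟫) ≡ 0ℚ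
      skew-weights = both (trans (sym (∑-filter g I)) trace≡0) (trans (sym (∑-filter-ε I)) antitrace≡0)
        where
        g : ℕ → ℚ
        g i = weight i * ⟪ v i , v i ⟫
        P N′ : List ℕ → List ℕ
        P  = filterᵇ (skew n)
        N′ = filterᵇ (λ i → not (skew n i))
        ∑-filter : ∀ g is → ∑ is g ≡ ∑ (P is) g + ∑ (N′ is) g
        ∑-filter g [] = trans (∑-[] g) (sym (cong₂ _+_ (∑-[] g) (∑-[] g)))
        ∑-filter g (i ∷ is) with skew n i
        ... | true  = trans (∑-∷ g i is)
          (trans (cong (g i +_) (∑-filter g is)) (trans (sym (ℚ.+-assoc (g i) (∑ (P is) g) (∑ (N′ is) g)))
          (cong (_+ ∑ (N′ is) g) (sym (∑-∷ g i (P is))))))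
        ... | false = trans (∑-∷ g i is)
          (trans (cong (g i +_) (∑-filter g is))
          (trans (solve 3 (λ a b c → a :+ (b :+ c) := b :+ (a :+ c)) refl (g i) (∑ (P is) g) (∑ (N′ is) g))
          (cong (∑ (P is) g +_) (sym (∑-∷ g i (N′ is))))))
        ε-skew : ∀ is → ∑ (P is) (λ i → ε i * g i) ≡ - ∑ (P is) g
        ε-skew [] = trans (∑-[] (λ i → ε i * g i)) (sym (cong -_ (∑-[] g)))
        ε-skew (i ∷ is) with skew n i in eq
        ... | true  = trans (∑-∷ (λ i → ε i * g i) i (P is))
          (trans (cong₂ _+_ (cong (λ s → (if s then - 1ℚ else 1ℚ) * g i) eq) (ε-skew is))
                        (trans (solve 2 (λ a b → (:- con 1ℚ) :* a :+ :- b := :- (a :+ b)) refl (g i)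
                          (∑ (P is) g)) (cong -_ (sym (∑-∷ g i (P is))))))
        ... | false = ε-skew is
        ε-sym : ∀ is → ∑ (N′ is) (λ i → ε i * g i) ≡ ∑ (N′ is) g
        ε-sym [] = trans (∑-[] (λ i → ε i * g i)) (sym (∑-[] g))
        ε-sym (i ∷ is) with skew n i in eq
        ... | false = trans (∑-∷ (λ i → ε i * g i) i (N′ is))
          (trans (cong₂ _+_ (trans (cong (λ s → (if s then - 1ℚ else 1ℚ) * g i) eq) (ℚ.*-identityˡ (g i)))
          (ε-sym is)) (sym (∑-∷ g i (N′ is))))
        ... | true  = ε-sym is
        ∑-filter-ε : ∀ is → ∑ is (λ i → ε i * g i) ≡ - ∑ (P is) g + ∑ (N′ is) g
        ∑-filter-ε is = trans (∑-filter (λ i → ε i * g i) is) (cong₂ _+_ (ε-skew is) (ε-sym is))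
        both : ∀ {s t} → s + t ≡ 0ℚ → - s + t ≡ 0ℚ → s ≡ 0ℚ × t ≡ 0ℚ
        both {s} {t} sum≡0 diff≡0 = s≡0 , trans (solve 2 (λ s t → t := (s :+ t) :+ :- s) refl s t)
          (cong₂ (λ y z → y + - z) sum≡0 s≡0)
          where
          s≡0 : s ≡ 0ℚ
          s≡0 = *-cancel-zero {1ℚ + 1ℚ}
            (λ ()) (trans (solve 2 (λ s t → (con 1ℚ :+ con 1ℚ) :* s := (s :+ t) :+ :- (:- s :+ t)) refl s t)
            (cong₂ (λ y z → y + - z) sum≡0 diff≡0))

    -- The common form of x̄ (c = 1, κ = 2, ε₀ = −1) and ȳ (c j = ℓ / ℓⱼ, κ = ℓ, ε₀ = 1).
    module Block (S : List ℕ) (S⊆I : ∀ {i} → i ∈ S → i ∈ I) (S-unique : AllPairs _≢_ S) {K : ℕ}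
      (length-S : length S ≡ K)
      (ε₀ : ℚ) (ε-S : ∀ {i} → i ∈ S → ε i ≡ ε₀)
      (c : ℕ → ℚ) (κ : ℚ) (κ≢0 : κ ≢ 0ℚ) (scale : ∀ {j} → j ∈ oneTo K →
        c j * ⟪ v (nth1 0 S j) , v (nth1 0 S j) ⟫ ≡ κ) where

      s : ℕ → ℕ
      s = nth1 0 S

      private
        map-s : map s (oneTo K) ≡ S
        map-s = subst (λ m → map s (oneTo m) ≡ S) length-S (map-nth1 0 S)

      s∈S : ∀ {j} → j ∈ oneTo K → s j ∈ S
      s∈S {j} j∈ = subst (s j ∈_) map-s (∈-map⁺ s j∈)

      s∈I : ∀ {j} → j ∈ oneTo K → s j ∈ I
      s∈I j∈ = S⊆I (s∈S j∈)

      s-injective : ∀ {j j′} → j ∈ oneTo K → j′ ∈ oneTo K → j ≢ j′ → s j ≢ s j′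
      s-injective = allPairs-∈ (λ ne eq → ne (sym eq))
        (AllPairs.map⁻ (subst (AllPairs _≢_) (sym map-s) S-unique))

      ∑-s : ∀ g → ∑ (oneTo K) (λ j → g (s j)) ≡ ∑ S g
      ∑-s g = trans (sym (∑-map s g (oneTo K))) (cong (λ is → ∑ is g) map-s)

      q : ℕ → ℚ
      q j = ⟪ v (s j) , v (s j) ⟫

      bar : ℕ → Mat n
      bar i = comb (oneTo K) (λ j → c j * e K i j) (λ j → s j ⊗ s j)

      bar-∙ : ∀ i y → bar i ∙ y ≡ ∑ (oneTo K) (λ j → c j * e K i j * ((s j ⊗ s j) ∙ y))
      bar-∙ i y = comb-∙ (oneTo K) (λ j → c j * e K i j) (λ j → s j ⊗ s j) y

      bar-off-diagonal : ∀ i {p r} → p ∈ I → r ∈ I → p ≢ r → bar i ∙ (p ⊗ r) ≡ 0ℚ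
      bar-off-diagonal i {p} {r} p∈ r∈ p≢r = trans (bar-∙ i (p ⊗ r)) (∑-zero (oneTo K) λ {j} j∈ →
        *-zeroʳ′ (c j * e K i j) ((s j ⊗ s j) ∙ (p ⊗ r)) (trans (⊗-∙ (s j) (s j) p r) (go j j∈ (s j ℕ.≟ p))))
        where
        go : ∀ j → j ∈ oneTo K → Dec (s j ≡ p) → ⟪ v (s j) , v p ⟫ * ⟪ v (s j) , v r ⟫ ≡ 0ℚ
        go j j∈ (yes sj≡p) = *-zeroʳ′ ⟪ v (s j) , v p ⟫ ⟪ v (s j) , v r ⟫
          (v-orthogonal (s∈I j∈) r∈ (λ sj≡r → p≢r (trans (sym sj≡p) sj≡r)))
        go j j∈ (no sj≢p)  = *-zeroˡ′ ⟪ v (s j) , v p ⟫ ⟪ v (s j) , v r ⟫ (v-orthogonal (s∈I j∈) p∈ sj≢p)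

      bar-outside : ∀ i {p} → p ∈ I → p ∉ S → bar i ∙ (p ⊗ p) ≡ 0ℚ
      bar-outside i {p} p∈ p∉ = trans (bar-∙ i (p ⊗ p)) (∑-zero (oneTo K) λ {j} j∈ →
        *-zeroʳ′ (c j * e K i j) ((s j ⊗ s j) ∙ (p ⊗ p)) (trans (⊗-∙ (s j) (s j) p p)
          (*-zeroˡ′ ⟪ v (s j) , v p ⟫ ⟪ v (s j) , v p ⟫
            (v-orthogonal (s∈I j∈) p∈ (λ sj≡p → p∉ (subst (_∈ S) sj≡p (s∈S j∈)))))))

      bar-diagonal : ∀ i {j} → j ∈ oneTo K → bar i ∙ (s j ⊗ s j) ≡ κ * (e K i j * q j)
      bar-diagonal i {j} j∈ = begin
        bar i ∙ (s j ⊗ s j)                          ≡⟨ bar-∙ i (s j ⊗ s j) ⟩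
        ∑ (oneTo K) (λ t → c t * e K i t * ((s t ⊗ s t) ∙ (s j ⊗ s j)))
          ≡⟨ ∑-single {f = λ t → c t * e K i t * ((s t ⊗ s t) ∙ (s j ⊗ s j))} (oneTo-unique K) j∈
              (λ {t} t∈ j≢t → *-zeroʳ′ (c t * e K i t) ((s t ⊗ s t) ∙ (s j ⊗ s j))
               (trans (⊗-∙ (s t) (s t) (s j) (s j)) (*-zeroˡ′ ⟪ v (s t) , v (s j) ⟫ ⟪ v (s t) , v (s j) ⟫
                 (v-orthogonal (s∈I t∈) (s∈I j∈) (s-injective t∈ j∈ (j≢t ∘ sym)))))) ⟩
        c j * e K i j * ((s j ⊗ s j) ∙ (s j ⊗ s j))  ≡⟨ cong (c j * e K i j *_) (⊗-∙ (s j) (s j) (s j) (s j)) ⟩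
        c j * e K i j * (q j * q j)
          ≡⟨ solve 3 (λ c e q → c :* e :* (q :* q) := (c :* q) :* (e :* q)) refl (c j) (e K i j) (q j) ⟩
        c j * q j * (e K i j * q j)                  ≡⟨ cong (_* (e K i j * q j)) (scale j∈) ⟩
        κ * (e K i j * q j)                          ∎
        where open ≡-Reasoning

      ∙-bar : ∀ x i → x ∙ bar i ≡ ∑ (oneTo K) (λ j → c j * e K i j * (x ∙ (s j ⊗ s j)))
      ∙-bar x i = trans (∙-comm x (bar i))
        (trans (bar-∙ i x) (∑-cong (oneTo K) (λ {j} _ → cong (c j * e K i j *_) (∙-comm (s j ⊗ s j) x))))

      -- The index `j` contributes `cⱼ² qⱼ² eⱼ e′ⱼ`, and `cⱼ qⱼ = κ`. Up to the factor `κ²` the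
      -- passage from coefficient vectors to matrices is thus isometric, which transfers
      -- orthogonality and nonvanishing from `U(K)`.
      bar-∙-bar : ∀ i i′ → bar i ∙ bar i′ ≡ κ * κ * ∑ (oneTo K) (λ j → e K i j * e K i′ j)
      bar-∙-bar i i′ = begin
        bar i ∙ bar i′                                             ≡⟨ ∙-bar (bar i) i′ ⟩
        ∑ (oneTo K) (λ j → c j * e K i′ j * (bar i ∙ (s j ⊗ s j))) ≡⟨ ∑-cong (oneTo K) (λ {j} j∈ → begin
          c j * e K i′ j * (bar i ∙ (s j ⊗ s j))   ≡⟨ cong (c j * e K i′ j *_) (bar-diagonal i j∈) ⟩
          c j * e K i′ j * (κ * (e K i j * q j))
            ≡⟨ solve 5 (λ c e′ k e q → c :* e′ :* (k :* (e :* q)) := k :* (c :* q) :* (e :* e′)) refl (c j)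
              (e K i′ j) κ (e K i j) (q j) ⟩
          κ * (c j * q j) * (e K i j * e K i′ j)   ≡⟨ cong (λ z → κ * z * (e K i j * e K i′ j)) (scale j∈) ⟩
          κ * κ * (e K i j * e K i′ j)             ∎) ⟩
        ∑ (oneTo K) (λ j → κ * κ * (e K i j * e K i′ j))
          ≡⟨ ∑-*ˡ (κ * κ) (λ j → e K i j * e K i′ j) (oneTo K) ⟩
        κ * κ * ∑ (oneTo K) (λ j → e K i j * e K i′ j)             ∎
        where open ≡-Reasoning

      bar-orthogonal : ∀ {i i′} → i ∈ oneTo (K ℕ.∸ 1) → i′ ∈ oneTo (K ℕ.∸ 1) → i ≢ i′ → bar i ∙ bar i′ ≡ 0ℚ
      bar-orthogonal {i} {i′} i∈ i′∈ i≢i′ = trans (bar-∙-bar i i′)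
        (*-zeroʳ′ (κ * κ) (∑ (oneTo K) (λ j → e K i j * e K i′ j)) (e-orthogonal i∈ i′∈ i≢i′))

      bar-square≢0 : ∀ {i} → i ∈ oneTo (K ℕ.∸ 1) → bar i ∙ bar i ≢ 0ℚ
      bar-square≢0 {i} i∈ eq = *-nonzero {κ * κ} {∑ (oneTo K) (λ j → e K i j * e K i j)} (*-nonzero κ≢0 κ≢0)
        (e-square≢0 i∈) (trans (sym (bar-∙-bar i i)) eq)

      -- Rows and columns vanish term by term. The trace is `Σ cⱼ eⱼ qⱼ = κ Σ eⱼ = 0`, and since all
      -- of `S` has the same reflection sign, the antidiagonal sum is `ε₀` times the trace.
      bar-InVbar : ∀ {i} → i ∈ oneTo (K ℕ.∸ 1) → InVbar n (bar i)
      bar-InVbar {i} i∈ = line⇒InVbar λ {f} {g} l → trans (line-comb f g (oneTo K) (λ j → c j * e K i j)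
        (λ j → s j ⊗ s j)) (go l)
        where
        diag-sum : ∑ (oneTo K) (λ j → c j * e K i j * q j) ≡ 0ℚ
        diag-sum = begin
          ∑ (oneTo K) (λ j → c j * e K i j * q j)
            ≡⟨ ∑-cong (oneTo K)
              (λ {j} j∈ → trans (solve 3 (λ c e q → c :* e :* q := (c :* q) :* e) refl (c j) (e K i j) (q j))
              (cong (_* e K i j) (scale j∈))) ⟩
          ∑ (oneTo K) (λ j → κ * e K i j)          ≡⟨ ∑-*ˡ κ (e K i) (oneTo K) ⟩
          κ * ∑ (oneTo K) (e K i)                  ≡⟨ *-zeroʳ′ κ (∑ (oneTo K) (e K i)) (e-∑≡0 i∈) ⟩
          0ℚ                                       ∎
          where open ≡-Reasoning
        go : ∀ {f g} → VbarLine f g → ∑ (oneTo K) (λ j → c j * e K i j * line f g (s j ⊗ s j)) ≡ 0ℚ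
        go (row a) = ∑-zero (oneTo K) λ {j} j∈ → *-zeroʳ′ (c j * e K i j) (line (const a) id (s j ⊗ s j))
          (⊗-row {s j} (s∈I j∈) a)
        go (col b) = ∑-zero (oneTo K) λ {j} j∈ → *-zeroʳ′ (c j * e K i j) (line id (const b) (s j ⊗ s j))
          (⊗-col {j = s j} (s∈I j∈) b)
        go diag    = diag-sum
        go anti    = begin
          ∑ (oneTo K) (λ j → c j * e K i j * line id opposite (s j ⊗ s j))
            ≡⟨ ∑-cong (oneTo K) (λ {j} j∈ → begin
            c j * e K i j * line id opposite (s j ⊗ s j)
              ≡⟨ cong (c j * e K i j *_) (trans (⊗-anti {s j} (s∈I j∈)) (cong (_* q j) (ε-S (s∈S j∈)))) ⟩
            c j * e K i j * (ε₀ * q j)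
              ≡⟨ solve 4 (λ c e z q → c :* e :* (z :* q) := z :* (c :* e :* q)) refl (c j) (e K i j) ε₀ (q j) ⟩
            ε₀ * (c j * e K i j * q j)                    ∎) ⟩
          ∑ (oneTo K) (λ j → ε₀ * (c j * e K i j * q j))
            ≡⟨ ∑-*ˡ ε₀ (λ j → c j * e K i j * q j) (oneTo K) ⟩
          ε₀ * ∑ (oneTo K) (λ j → c j * e K i j * q j)
            ≡⟨ *-zeroʳ′ ε₀ (∑ (oneTo K) (λ j → c j * e K i j * q j)) diag-sum ⟩
          0ℚ                                                                ∎
          where open ≡-Reasoning

      -- Completeness of `U(K)` is applied to `fⱼ = cⱼ (x ∙ (sⱼ ⊗ sⱼ)) = κ wⱼ qⱼ`. Its sum vanishes
      -- by the condition on the weights, and its orthogonality to the `i`-th vector is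
      -- `x ∙ bar i = 0`.
      bar-complete : ∀ x x∈ (off : ∀ {i j} → i ∈ I → j ∈ I → i ≢ j → x ∙ (i ⊗ j) ≡ 0ℚ) →
        ∑ S (λ i → weight x x∈ off i * ⟪ v i , v i ⟫) ≡ 0ℚ → (∀ {i} → i ∈ oneTo (K ℕ.∸ 1) → x ∙ bar i ≡ 0ℚ) →
        ∀ {i} → i ∈ S → x ∙ (i ⊗ i) ≡ 0ℚ
      bar-complete x x∈ off weights≡0 orth {i} i∈ with ∈-map⁻ s (subst (i ∈_) (sym map-s) i∈)
      -- The factor `c j` can be cancelled because `c j` times the square norm is `κ`, which is
      -- nonzero.
      ... | j , j∈ , refl = *-cancel-zero {c j}
        (λ cj≡0 → κ≢0 (trans (sym (scale j∈)) (*-zeroˡ′ (c j) (q j) cj≡0)))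
        (e-complete K (λ j → c j * (x ∙ (s j ⊗ s j))) sum≡0
          (λ {i} i∈ → trans (∑-cong (oneTo K)
            (λ {j} _ → solve 3 (λ e c m → e :* (c :* m) := c :* e :* m) refl (e K i j) (c j) (x ∙ (s j ⊗ s j))))
            (trans (sym (∙-bar x i)) (orth i∈))) j∈)
        where
        open ≡-Reasoning
        w = weight x x∈ off
        sum≡0 : ∑ (oneTo K) (λ j → c j * (x ∙ (s j ⊗ s j))) ≡ 0ℚ
        sum≡0 = begin
          ∑ (oneTo K) (λ j → c j * (x ∙ (s j ⊗ s j)))  ≡⟨ ∑-cong (oneTo K) (λ {j} j∈ → begin
            c j * (x ∙ (s j ⊗ s j))        ≡⟨ cong (c j *_) (weight-square x x∈ off (s∈I j∈)) ⟨
            c j * (w (s j) * (q j * q j))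
              ≡⟨ solve 3 (λ c w q → c :* (w :* (q :* q)) := (c :* q) :* (w :* q)) refl (c j) (w (s j)) (q j) ⟩
            (c j * q j) * (w (s j) * q j)  ≡⟨ cong (_* (w (s j) * q j)) (scale j∈) ⟩
            κ * (w (s j) * q j)            ∎) ⟩
          ∑ (oneTo K) (λ j → κ * (w (s j) * q j))      ≡⟨ ∑-*ˡ κ (λ j → w (s j) * q j) (oneTo K) ⟩
          κ * ∑ (oneTo K) (λ j → w (s j) * q j)
            ≡⟨ cong (κ *_) (trans (∑-s (λ i → w i * ⟪ v i , v i ⟫)) weights≡0) ⟩
          κ * 0ℚ                                       ≡⟨ ℚ.*-zeroʳ κ ⟩
          0ℚ                                           ∎

  -- Arithmetic of the traces and their least common multiple.

  ∣lcm-foldr : ∀ (f : ℕ → ℕ) js {j} → j ∈ js → f j ∣ foldr (λ j acc → lcm (f j) acc) 1 js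
  ∣lcm-foldr f (j ∷ js) (here refl) = m∣lcm[m,n] (f j) (foldr (λ j acc → lcm (f j) acc) 1 js)
  ∣lcm-foldr f (j ∷ js) (there j∈) = ∣-trans (∣lcm-foldr f js j∈)
    (n∣lcm[m,n] (f j) (foldr (λ j acc → lcm (f j) acc) 1 js))

  -- Since `gcd * lcm` is the product, a vanishing lcm would make one of the two arguments vanish.
  lcm-foldr≢0 : ∀ (f : ℕ → ℕ) js → (∀ {j} → j ∈ js → f j ≢ 0) → foldr (λ j acc → lcm (f j) acc) 1 js ≢ 0
  lcm-foldr≢0 f [] _ ()
  lcm-foldr≢0 f (j ∷ js) f≢0 eq = [ f≢0 (here refl) , lcm-foldr≢0 f js (λ j∈ → f≢0 (there j∈)) ]′
    (ℕ.m*n≡0⇒m≡0∨n≡0 (f j) (begin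
      f j ℕ.* acc                   ≡⟨ gcd*lcm (f j) acc ⟨
      gcd (f j) acc ℕ.* lcm (f j) acc ≡⟨ cong (gcd (f j) acc ℕ.*_) eq ⟩
      gcd (f j) acc ℕ.* 0           ≡⟨ ℕ.*-zeroʳ (gcd (f j) acc) ⟩
      0                             ∎))
    where
    open ≡-Reasoning
    acc = foldr (λ j acc → lcm (f j) acc) 1 js

  divℕ-* : ∀ {m d} → d ≢ 0 → d ∣ m → divℕ m d ℕ.* d ≡ m
  divℕ-* {m} {zero} d≢0 _ = contradiction refl d≢0
  divℕ-* {m} {suc d} _ d∣m = ND.m/n*n≡m d∣m

  -- The absolute value in `ℓi` only serves to land in `ℕ`: a sum of squares is already nonnegative.
  +∣∑-squares∣ : ∀ {m} (h : Fin m → ℤ) →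
    let total = foldr ℤ._+_ (ℤ.+ 0) (tabulate (λ a → h a ℤ.* h a)) in ℤ.+ ℤ.∣ total ∣ ≡ total
  +∣∑-squares∣ h = ℤ.0≤i⇒+∣i∣≡i (nonneg h)
    where
    square-nonneg : ∀ z → ℤ.+ 0 ℤ.≤ z ℤ.* z
    square-nonneg (ℤ.+ n) = subst (ℤ.+ 0 ℤ.≤_) (ℤ.pos-* n n) (ℤ.+≤+ ℕ.z≤n)
    square-nonneg ℤ.-[1+ n ] = ℤ.+≤+ ℕ.z≤n
    nonneg : ∀ {m} (h : Fin m → ℤ) → ℤ.+ 0 ℤ.≤ foldr ℤ._+_ (ℤ.+ 0) (tabulate (λ a → h a ℤ.* h a))
    nonneg {zero} h = ℤ.≤-refl
    nonneg {suc m} h = ℤ.+-mono-≤ (square-nonneg (h Fin.zero)) (nonneg (h ∘ Fin.suc))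

  ℤ→ℚ-foldr : ∀ {A : Set} (h : A → ℤ) xs → ℤ→ℚ (foldr ℤ._+_ (ℤ.+ 0) (map h xs)) ≡ ∑ xs (λ x → ℤ→ℚ (h x))
  ℤ→ℚ-foldr h [] = sym (∑-[] (λ x → ℤ→ℚ (h x)))
  ℤ→ℚ-foldr h (x ∷ xs) = trans (ℤ→ℚ-+ (h x) (foldr ℤ._+_ (ℤ.+ 0) (map h xs)))
    (trans (cong (ℤ→ℚ (h x) +_) (ℤ→ℚ-foldr h xs)) (sym (∑-∷ (λ x → ℤ→ℚ (h x)) x xs)))

  pairs-tabulate : ∀ {Q : ℕ → ℕ → Set} is → AllPairs _≢_ is → (∀ {i j} → i ∈ is → j ∈ is → i ≢ j → Q i j) →
    AllPairs Q is
  pairs-tabulate [] [] q = []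
  pairs-tabulate (i ∷ is) (i≢ ∷ uniq) q =
    All.tabulate (λ j∈ → q (here refl) (there j∈) (All.lookup i≢ j∈)) ∷ pairs-tabulate is uniq
      (λ i∈ j∈ → q (there i∈) (there j∈))

  AllPairs-concatMap : ∀ {R : A → A → Set} {f : ℕ → List A} is → AllPairs _≢_ is →
    (∀ {i} → i ∈ is → AllPairs R (f i)) →
    (∀ {i j} → i ∈ is → j ∈ is → i ≢ j → All (λ x → All (R x) (f j)) (f i)) → AllPairs R (concatMap f is)
  AllPairs-concatMap is uniq within across = AllPairs.concat⁺ (All.map⁺ (All.tabulate within))
    (AllPairs.map⁺ (pairs-tabulate is uniq across))

  -- The family of the theorem and its completeness.

  module Family {n : ℕ} (2≤n : 2 ℕ.≤ n) where
    open Construction 2≤n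

    -- The innermost list of `pairMats`, empty on the diagonal, under a name that lemmas can refer
    -- to.
    inner : ℕ → ℕ → List (Mat n)
    inner i j = if i ℕ.≡ᵇ j then [] else outer (uvec n i) (uvec n j) ∷ []

    outer-⊗ : ∀ i j a b → outer (uvec n i) (uvec n j) a b ≡ (i ⊗ j) a b
    outer-⊗ i j a b = ℤ→ℚ-* (uvec n i a) (uvec n j b)

    InVbar-cong : ∀ {x y : Mat n} → (∀ a b → x a b ≡ y a b) → InVbar n y → InVbar n x
    InVbar-cong eq y∈ = line⇒InVbar λ {f} {g} l → trans (∑-cong F (λ {t} _ → eq (f t) (g t))) (InVbar⇒line y∈ l)

    inner-all : ∀ {P : Mat n → Set} i j → (i ≢ j → P (outer (uvec n i) (uvec n j))) → All P (inner i j)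
    inner-all i j p with i ℕ.≟ j
    ... | yes refl rewrite ≡ᵇ-refl i = []
    ... | no  i≢j  rewrite ≢⇒≡ᵇ-false i j i≢j = p i≢j ∷ []

    inner-all⁻ : ∀ {P : Mat n → Set} {i j} → i ≢ j → All P (inner i j) → P (outer (uvec n i) (uvec n j))
    inner-all⁻ {i = i} {j} i≢j ps rewrite ≢⇒≡ᵇ-false i j i≢j with ps
    ... | p ∷ [] = p

    row-all : ∀ {P : Mat n → Set} i → (∀ {j} → j ∈ I → i ≢ j → P (outer (uvec n i) (uvec n j))) →
      All P (concatMap (inner i) I)
    row-all i p = All.concat⁺ (All.map⁺ (All.tabulate λ {j} j∈ → inner-all i j (p j∈)))

    pairs-all : ∀ {P : Mat n → Set} → (∀ {i j} → i ∈ I → j ∈ I → i ≢ j → P (outer (uvec n i) (uvec n j))) →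
      All P (pairMats n)
    pairs-all p = All.concat⁺ (All.map⁺ (All.tabulate λ {i} i∈ → row-all i (p i∈)))

    pairs-all⁻ : ∀ {P : Mat n → Set} → All P (pairMats n) → ∀ {i j} → i ∈ I → j ∈ I → i ≢ j →
      P (outer (uvec n i) (uvec n j))
    pairs-all⁻ {P} ps {i} {j} i∈ j∈ i≢j =
      inner-all⁻ {P} i≢j (All.lookup (All.map⁻ {f = inner i} (All.concat⁻ {xss = map (inner i) I}
      (All.lookup (All.map⁻ {f = λ i → concatMap (inner i) I}
        (All.concat⁻ {xss = map (λ i → concatMap (inner i) I) I} ps)) i∈))) j∈)

    outer-∙-outer : ∀ {i j i′ j′} → i ∈ I → j ∈ I → i′ ∈ I → j′ ∈ I → (i ≢ i′) ⊎ (j ≢ j′) →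
      outer (uvec n i) (uvec n j) ∙ outer (uvec n i′) (uvec n j′) ≡ 0ℚ
    outer-∙-outer {i} {j} {i′} {j′} i∈ j∈ i′∈ j′∈ ne =
      trans (∙-cong (outer-⊗ i j) (outer-⊗ i′ j′)) (trans (⊗-∙ i j i′ j′) (go ne))
      where
      go : (i ≢ i′) ⊎ (j ≢ j′) → ⟪ v i , v i′ ⟫ * ⟪ v j , v j′ ⟫ ≡ 0ℚ
      go (inj₁ i≢) = *-zeroˡ′ ⟪ v i , v i′ ⟫ ⟪ v j , v j′ ⟫ (v-orthogonal i∈ i′∈ i≢)
      go (inj₂ j≢) = *-zeroʳ′ ⟪ v i , v i′ ⟫ ⟪ v j , v j′ ⟫ (v-orthogonal j∈ j′∈ j≢)

    pairs-orthogonal : AllPairs (λ x y → x ∙ y ≡ 0ℚ) (pairMats n)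
    pairs-orthogonal = AllPairs-concatMap I (oneTo-unique (n ℕ.∸ 1))
      (λ {i} i∈ → AllPairs-concatMap I (oneTo-unique (n ℕ.∸ 1)) (λ {j} _ → inner-pairs i j)
        (λ {j} {j′} j∈ j′∈ j≢j′ → inner-all i j
          (λ _ → inner-all i j′ (λ _ → outer-∙-outer i∈ j∈ i∈ j′∈ (inj₂ j≢j′)))))
      (λ {i} {i′} i∈ i′∈ i≢i′ →
        row-all i (λ j∈ _ → row-all i′ (λ j′∈ _ → outer-∙-outer i∈ j∈ i′∈ j′∈ (inj₁ i≢i′))))
      where
      inner-pairs : ∀ i j → AllPairs (λ x y → x ∙ y ≡ 0ℚ) (inner i j)
      inner-pairs i j with i ℕ.≡ᵇ j
      ... | true  = []
      ... | false = [] ∷ []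

    ∈skewIdx : ∀ {i} → i ∈ skewIdx n → i ∈ I × skew n i ≡ true
    ∈skewIdx i∈ = let i∈I , t = ∈-filter⁻ (T? ∘ skew n) {xs = I} i∈ in i∈I , Equivalence.to T-≡ t

    ∈symIdx : ∀ {i} → i ∈ symIdx n → i ∈ I × skew n i ≡ false
    ∈symIdx i∈ =
      let i∈I , t = ∈-filter⁻ (T? ∘ λ i → not (skew n i)) {xs = I} i∈ in i∈I , Equivalence.to T-not-≡ t

    skew-or-sym : ∀ {i} → i ∈ I → i ∈ skewIdx n ⊎ i ∈ symIdx n
    skew-or-sym {i} i∈ with skew n i in eq
    ... | true  = inj₁ (∈-filter⁺ (T? ∘ skew n) i∈ (Equivalence.from T-≡ eq))
    ... | false = inj₂ (∈-filter⁺ (T? ∘ λ i → not (skew n i)) i∈ (Equivalence.from T-not-≡ eq))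

    sym∉skewIdx : ∀ {i} → i ∈ symIdx n → i ∉ skewIdx n
    sym∉skewIdx i∈ i∈′ = case trans (sym (proj₂ (∈skewIdx i∈′))) (proj₂ (∈symIdx i∈)) of λ ()

    index-unique : ∀ (Q : ℕ → Bool) → AllPairs _≢_ (filterᵇ Q I)
    index-unique Q = AllPairs.filter⁺ (T? ∘ Q) (oneTo-unique (n ℕ.∸ 1))

    skew-nth1 : ∀ {j} → j ∈ oneTo (k n) → nth1 0 (skewIdx n) j ∈ skewIdx n
    skew-nth1 {j} j∈ = all-nth1 {P = _∈ skewIdx n} 0 (All.tabulate id)
      (subst (λ m → j ∈ oneTo m) (sym (length-skewIdx 2≤n)) j∈)

    sym-nth1 : ∀ {j} → j ∈ oneTo (k' n) → nth1 0 (symIdx n) j ∈ symIdx n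
    sym-nth1 {j} j∈ = all-nth1 {P = _∈ symIdx n} 0 (All.tabulate id)
      (subst (λ m → j ∈ oneTo m) (sym (length-symIdx 2≤n)) j∈)

    skew-⊆I : ∀ {i} → i ∈ skewIdx n → i ∈ I
    skew-⊆I i∈ = proj₁ (∈skewIdx i∈)

    skew-ε : ∀ {i} → i ∈ skewIdx n → ε i ≡ - 1ℚ
    skew-ε i∈ = cong (λ t → if t then - 1ℚ else 1ℚ) (proj₂ (∈skewIdx i∈))

    2≢0 : ℤ→ℚ (ℤ.+ 2) ≢ 0ℚ
    2≢0 ()

    skew-scale : ∀ {j} → j ∈ oneTo (k n) → 1ℚ * ⟪ v (nth1 0 (skewIdx n) j) , v (nth1 0 (skewIdx n) j) ⟫ ≡
      ℤ→ℚ (ℤ.+ 2)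
    skew-scale {j} j∈ = begin
      1ℚ * ⟪ v i , v i ⟫                    ≡⟨ ℚ.*-identityˡ ⟪ v i , v i ⟫ ⟩
      ⟪ v i , v i ⟫                         ≡⟨ ∑-upTo-allFin n (λ p → u n i p * u n i p) ⟨
      ∑ (upTo n) (λ p → u n i p * u n i p)  ≡⟨ skew-square 2≤n (proj₁ i∈) (proj₂ i∈) ⟩
      ℤ→ℚ (ℤ.+ 2)                           ∎
      where
      open ≡-Reasoning
      i  = nth1 0 (skewIdx n) j
      i∈ = ∈skewIdx (skew-nth1 j∈)

    module X = Block (skewIdx n) skew-⊆I (index-unique (skew n)) (length-skewIdx 2≤n) (- 1ℚ) skew-ε
      (const 1ℚ) (ℤ→ℚ (ℤ.+ 2)) 2≢0 skew-scale

    ℓi-square : ∀ j → ℤ→ℚ (ℤ.+ ℓi n j) ≡ ⟪ v (nth1 0 (symIdx n) j) , v (nth1 0 (symIdx n) j) ⟫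
    ℓi-square j = begin
      ℤ→ℚ (ℤ.+ ℓi n j)                                ≡⟨ cong ℤ→ℚ (+∣∑-squares∣ (uvec n i)) ⟩
      ℤ→ℚ (foldr ℤ._+_ (ℤ.+ 0) (tabulate h))
        ≡⟨ cong (λ zs → ℤ→ℚ (foldr ℤ._+_ (ℤ.+ 0) zs)) (map-tabulate id h) ⟨
      ℤ→ℚ (foldr ℤ._+_ (ℤ.+ 0) (map h F))             ≡⟨ ℤ→ℚ-foldr h F ⟩
      ∑ F (λ a → ℤ→ℚ (h a))                           ≡⟨ ∑-cong F (λ {a} _ → ℤ→ℚ-* (uvec n i a) (uvec n i a)) ⟩
      ⟪ v i , v i ⟫                                   ∎
      where
      open ≡-Reasoning
      i = nth1 0 (symIdx n) j
      h : Fin n → ℤ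
      h a = uvec n i a ℤ.* uvec n i a

    ℓi≢0 : ∀ {j} → j ∈ oneTo (k' n) → ℓi n j ≢ 0
    ℓi≢0 {j} j∈ eq = v-square≢0 (proj₁ (∈symIdx (sym-nth1 j∈)))
      (trans (sym (ℓi-square j)) (cong (λ m → ℤ→ℚ (ℤ.+ m)) eq))

    ℓ≢0 : ℓ n ≢ 0
    ℓ≢0 = lcm-foldr≢0 (ℓi n) (oneTo (k' n)) ℓi≢0

    sym-⊆I : ∀ {i} → i ∈ symIdx n → i ∈ I
    sym-⊆I i∈ = proj₁ (∈symIdx i∈)

    sym-ε : ∀ {i} → i ∈ symIdx n → ε i ≡ 1ℚ
    sym-ε i∈ = cong (λ t → if t then - 1ℚ else 1ℚ) (proj₂ (∈symIdx i∈))

    ratio : ℕ → ℚ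
    ratio j = ℤ→ℚ (ℤ.+ divℕ (ℓ n) (ℓi n j))

    sym-scale : ∀ {j} → j ∈ oneTo (k' n) → ratio j * ⟪ v (nth1 0 (symIdx n) j) , v (nth1 0 (symIdx n) j) ⟫ ≡
      ℤ→ℚ (ℤ.+ ℓ n)
    sym-scale {j} j∈ = begin
      ratio j * ⟪ v (nth1 0 (symIdx n) j) , v (nth1 0 (symIdx n) j) ⟫ ≡⟨ cong (ratio j *_) (ℓi-square j) ⟨
      ratio j * ℤ→ℚ (ℤ.+ ℓi n j)                       ≡⟨ ℤ→ℚ-* (ℤ.+ divℕ (ℓ n) (ℓi n j)) (ℤ.+ ℓi n j) ⟨
      ℤ→ℚ (ℤ.+ divℕ (ℓ n) (ℓi n j) ℤ.* ℤ.+ ℓi n j)     ≡⟨ cong ℤ→ℚ (ℤ.pos-* (divℕ (ℓ n) (ℓi n j)) (ℓi n j)) ⟨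
      ℤ→ℚ (ℤ.+ (divℕ (ℓ n) (ℓi n j) ℕ.* ℓi n j))
        ≡⟨ cong (λ m → ℤ→ℚ (ℤ.+ m)) (divℕ-* (ℓi≢0 j∈) (∣lcm-foldr (ℓi n) (oneTo (k' n)) j∈)) ⟩
      ℤ→ℚ (ℤ.+ ℓ n)                                    ∎
      where open ≡-Reasoning

    ℓℚ≢0 : ℤ→ℚ (ℤ.+ ℓ n) ≢ 0ℚ
    ℓℚ≢0 eq = ℓ≢0 (ℤ.+-injective (ℤ→ℚ-injective (ℤ.+ ℓ n) (ℤ.+ 0) eq))

    nonSkew : ℕ → Bool
    nonSkew i = not (skew n i)

    module Y = Block (symIdx n) sym-⊆I (index-unique nonSkew) (length-symIdx 2≤n) 1ℚ sym-ε
      ratio (ℤ→ℚ (ℤ.+ ℓ n)) ℓℚ≢0 sym-scale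

    xbar-X : ∀ i a b → xbar n i a b ≡ X.bar i a b
    xbar-X i a b = trans (∑-foldr (λ j → ℤ→ℚ (uEntry (k n) i j) * xmat n j a b) (oneTo (k n)))
      (∑-cong (oneTo (k n)) λ {j} _ →
      cong₂ _*_ (sym (ℚ.*-identityˡ (ℤ→ℚ (uEntry (k n) i j))))
        (outer-⊗ (nth1 0 (skewIdx n) j) (nth1 0 (skewIdx n) j) a b))

    ybar-Y : ∀ i a b → ybar n i a b ≡ Y.bar i a b
    ybar-Y i a b = trans (∑-foldr (λ j → ℤ→ℚ (ℤ.+ divℕ (ℓ n) (ℓi n j) ℤ.* uEntry (k' n) i j) * ymat n j a b)
      (oneTo (k' n))) (∑-cong (oneTo (k' n)) λ {j} _ →
      cong₂ _*_ (ℤ→ℚ-* (ℤ.+ divℕ (ℓ n) (ℓi n j)) (uEntry (k' n) i j))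
        (outer-⊗ (nth1 0 (symIdx n) j) (nth1 0 (symIdx n) j) a b))

    xs ys : List (Mat n)
    xs = map (xbar n) (oneTo (k n ℕ.∸ 1))
    ys = map (ybar n) (oneTo (k' n ℕ.∸ 1))

    map-all : ∀ {P : Mat n → Set} {f : ℕ → Mat n} {is} → (∀ {i} → i ∈ is → P (f i)) → All P (map f is)
    map-all p = All.map⁺ (All.tabulate p)

    map-pairs : ∀ {R : Mat n → Mat n → Set} {f : ℕ → Mat n} m →
      (∀ {i j} → i ∈ oneTo m → j ∈ oneTo m → i ≢ j → R (f i) (f j)) → AllPairs R (map f (oneTo m))
    map-pairs {R} {f} m r = AllPairs.map⁺ (pairs-tabulate (oneTo m) (oneTo-unique m) r)

    -- The two blocks use disjoint sets of indices, so every square `vʲ ⊗ vʲ` occurring in `Y.bar`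
    -- is orthogonal to all those in `X.bar`.
    bars-disjoint : ∀ i i′ → X.bar i ∙ Y.bar i′ ≡ 0ℚ
    bars-disjoint i i′ = trans (Y.∙-bar (X.bar i) i′) (∑-zero (oneTo (k' n)) λ {j} j∈ →
      *-zeroʳ′ (ratio j * e (k' n) i′ j) (X.bar i ∙ (Y.s j ⊗ Y.s j))
        (X.bar-outside i (Y.s∈I j∈) (sym∉skewIdx (Y.s∈S j∈))))

    outer-∙-xbar : ∀ {i j} → i ∈ I → j ∈ I → i ≢ j → ∀ t → outer (uvec n i) (uvec n j) ∙ xbar n t ≡ 0ℚ
    outer-∙-xbar {i} {j} i∈ j∈ i≢j t = trans (∙-cong (outer-⊗ i j) (xbar-X t))
      (trans (∙-comm (i ⊗ j) (X.bar t)) (X.bar-off-diagonal t i∈ j∈ i≢j))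

    outer-∙-ybar : ∀ {i j} → i ∈ I → j ∈ I → i ≢ j → ∀ t → outer (uvec n i) (uvec n j) ∙ ybar n t ≡ 0ℚ
    outer-∙-ybar {i} {j} i∈ j∈ i≢j t = trans (∙-cong (outer-⊗ i j) (ybar-Y t))
      (trans (∙-comm (i ⊗ j) (Y.bar t)) (Y.bar-off-diagonal t i∈ j∈ i≢j))

    family-members : All (InVbar n) (family n)
    family-members = All.++⁺ (pairs-all (λ {i} {j} i∈ j∈ i≢j → InVbar-cong (outer-⊗ i j) (⊗-InVbar i∈ j∈ i≢j)))
      (All.++⁺ (map-all (λ {t} t∈ → InVbar-cong (xbar-X t) (X.bar-InVbar t∈)))
               (map-all (λ {t} t∈ → InVbar-cong (ybar-Y t) (Y.bar-InVbar t∈))))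

    family-orthogonal : AllPairs (λ x y → x ∙ y ≡ 0ℚ) (family n)
    family-orthogonal = AllPairs.++⁺ pairs-orthogonal
      (AllPairs.++⁺
        (map-pairs (k n ℕ.∸ 1) (λ {i} {j} i∈ j∈ i≢j → trans (∙-cong (xbar-X i) (xbar-X j))
          (X.bar-orthogonal i∈ j∈ i≢j)))
        (map-pairs (k' n ℕ.∸ 1) (λ {i} {j} i∈ j∈ i≢j → trans (∙-cong (ybar-Y i) (ybar-Y j))
          (Y.bar-orthogonal i∈ j∈ i≢j)))
        (map-all {P = λ x → All (λ y → x ∙ y ≡ 0ℚ) ys}
          (λ {i} _ → map-all (λ {j} _ → trans (∙-cong (xbar-X i) (ybar-Y j)) (bars-disjoint i j)))))
      (pairs-all {P = λ x → All (λ y → x ∙ y ≡ 0ℚ) (xs ++ ys)}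
        (λ i∈ j∈ i≢j → All.++⁺ (map-all {is = oneTo (k n ℕ.∸ 1)} (λ {t} _ → outer-∙-xbar i∈ j∈ i≢j t))
          (map-all {is = oneTo (k' n ℕ.∸ 1)} (λ {t} _ → outer-∙-ybar i∈ j∈ i≢j t))))

    family-square≢0 : All (λ x → x ∙ x ≢ 0ℚ) (family n)
    family-square≢0 = All.++⁺
      (pairs-all (λ {i} {j} i∈ j∈ _ eq → *-nonzero {⟪ v i , v i ⟫} {⟪ v j , v j ⟫} (v-square≢0 i∈)
        (v-square≢0 j∈)
        (trans (sym (trans (∙-cong (outer-⊗ i j) (outer-⊗ i j)) (⊗-∙ i j i j))) eq)))
      (All.++⁺ (map-all (λ {t} t∈ eq → X.bar-square≢0 t∈ (trans (sym (∙-cong (xbar-X t) (xbar-X t))) eq)))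
               (map-all (λ {t} t∈ eq → Y.bar-square≢0 t∈ (trans (sym (∙-cong (ybar-Y t) (ybar-Y t))) eq))))

    -- The mixed products `i ⊗ j` are members of the family. The squares `i ⊗ i` are not, so
    -- orthogonality to them is recovered from the block, skew or symmetric, that contains `i`.
    family-complete : ∀ x → InVbar n x → All (λ y → x ∙ y ≡ 0ℚ) (family n) → ∀ a b → x a b ≡ 0ℚ
    family-complete x x∈ orth = ⊗-complete x (λ a → InVbar⇒line x∈ (row a)) (λ b → InVbar⇒line x∈ (col b))
      (λ {i} {j} i∈ j∈ → go i∈ j∈ (i ℕ.≟ j))
      where
      pair-orth = All.++⁻ˡ (pairMats n) orth
      bar-orth = All.++⁻ʳ (pairMats n) orth
      ≡x : ∀ a b → x a b ≡ x a b
      ≡x a b = refl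
      off : ∀ {i j} → i ∈ I → j ∈ I → i ≢ j → x ∙ (i ⊗ j) ≡ 0ℚ
      off {i} {j} i∈ j∈ i≢j = trans (∙-cong ≡x (λ a b → sym (outer-⊗ i j a b)))
        (pairs-all⁻ {P = λ y → x ∙ y ≡ 0ℚ} pair-orth i∈ j∈ i≢j)
      diagonal-zero : ∀ {i} → i ∈ skewIdx n ⊎ i ∈ symIdx n → x ∙ (i ⊗ i) ≡ 0ℚ
      diagonal-zero (inj₁ i∈) = X.bar-complete x x∈ off (proj₁ (skew-weights x x∈ off))
        (λ {t} t∈ → trans (∙-cong ≡x (λ a b → sym (xbar-X t a b)))
          (All.lookup (All.map⁻ (All.++⁻ˡ xs bar-orth)) t∈)) i∈
      diagonal-zero (inj₂ i∈) = Y.bar-complete x x∈ off (proj₂ (skew-weights x x∈ off))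
        (λ {t} t∈ → trans (∙-cong ≡x (λ a b → sym (ybar-Y t a b)))
          (All.lookup (All.map⁻ (All.++⁻ʳ xs bar-orth)) t∈)) i∈
      go : ∀ {i j} → i ∈ I → j ∈ I → Dec (i ≡ j) → x ∙ (i ⊗ j) ≡ 0ℚ
      go i∈ _ (yes refl) = diagonal-zero (skew-or-sym i∈)
      go i∈ j∈ (no i≢j)  = off i∈ j∈ i≢j

open Matrices

theorem4p2 : (n : ℕ) → 2 ≤ n → IsOrthogonalBasisVbar n (family n)
theorem4p2 n 2≤n = orthogonal-complete⇒basis (family n) family-members family-orthogonal family-square≢0
  family-complete
  where open Family 2≤n
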